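{- In the independence-oracle model, let $\mathcal{M}_1=(V,\mathcal{I}_1)$ and $\mathcal{M}_2=(V,\mathcal{I}_2)$ be two matroids on a common finite ground set $V$, let $S$ be a given maximum-cardinality common independent set, and put $n=|V|$, $r=|S|$. The problem Another Matroid Intersection (decide whether there is a maximum common independent set $T\neq S$ and, if so, output one) admits (1) a Las Vegas algorithm using $\widetilde O(n\sqrt r)$ expected independence queries; and (2) a deterministic algorithm using $\widetilde O(n r^{2/3})$ independence queries.
   Context: A common independent set is a member of $\mathcal I_1\cap\mathcal I_2$; it is maximum if it has maximum cardinality among all common independent sets. Independence-oracle model: the ground set $V$ and the set $S$ are given explicitly, and the matroids are accessed only through queries which, given $i\in\{1,2\}$ and $A\subseteq V$, return whether $A\in\mathcal I_i$. The cost of an algorithm is the number of queries it makes; other computation is not counted. A Las Vegas algorithm is a randomized algorithm whose output is always correct, and the bound is on its expected number of queries. The notation $\widetilde O(\cdot)$ suppresses factors polylogarithmic in $n$. -}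

module Defs where

open import Data.Bool.Base using (Bool)
open import Data.Fin.Base using (Fin)
open import Data.Fin.Patterns using (0F; 1F)
open import Data.Fin.Subset using (Subset; ⊥; _∈_; _∉_; _⊆_; _∪_; ⁅_⁆; ∣_∣)
open import Data.Integer.Base using (+_)
open import Data.Maybe.Base using (Maybe; just; nothing)
open import Data.Nat.Base using (ℕ; suc; _+_; _*_; _^_; _≤_; _<_)
open import Data.Nat.Logarithm using (⌊log₂_⌋)
open import Data.Product.Base using (_×_; ∃-syntax)
open import Data.Rational.Base as ℚ using (ℚ; 0ℚ; 1ℚ; +-*-rawSemiring)
open import Algebra.Definitions.RawSemiring +-*-rawSemiring using (sum) renaming (_^_ to _^ℚ_)
open import Level using (0ℓ)
open import Relation.Binary.PropositionalEquality.Core using (_≢_)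
open import Relation.Nullary.Decidable.Core using (does)
open import Relation.Nullary.Negation.Core using (¬_)
open import Relation.Unary using (Pred; Decidable)

-- A matroid on the ground set Fin n.  The field indep? is what an
-- independence oracle answers; classically it is no restriction.

record Matroid (n : ℕ) : Set₁ where
  field
    Indep    : Pred (Subset n) 0ℓ
    indep?   : Decidable Indep
    empty    : Indep ⊥
    subset   : ∀ {A B} → A ⊆ B → Indep B → Indep A
    exchange : ∀ {A B} → Indep A → Indep B → ∣ A ∣ < ∣ B ∣ →
               ∃[ x ] x ∈ B × x ∉ A × Indep (A ∪ ⁅ x ⁆)

open Matroid public using (Indep)

CommonIndep : ∀ {n} → Matroid n → Matroid n → Pred (Subset n) 0ℓ
CommonIndep M₁ M₂ A = Indep M₁ A × Indep M₂ A

MaximumCommonIndep : ∀ {n} → Matroid n → Matroid n → Pred (Subset n) 0ℓ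
MaximumCommonIndep M₁ M₂ A =
  CommonIndep M₁ M₂ A × (∀ B → CommonIndep M₁ M₂ B → ∣ B ∣ ≤ ∣ A ∣)

record Instance : Set₁ where
  field
    n       : ℕ
    M₁ M₂   : Matroid n
    S       : Subset n
    maximum : MaximumCommonIndep M₁ M₂ S

  r : ℕ
  r = ∣ S ∣

  IsAnother : Pred (Subset n) 0ℓ
  IsAnother T = MaximumCommonIndep M₁ M₂ T × T ≢ S

  CorrectOutput : Pred (Maybe (Subset n)) 0ℓ
  CorrectOutput (just T) = IsAnother T
  CorrectOutput nothing  = ¬ (∃[ T ] IsAnother T)

  oracle : Fin 2 → Subset n → Bool
  oracle 0F A = does (Matroid.indep? M₁ A)
  oracle 1F A = does (Matroid.indep? M₂ A)

-- Programs are well-founded trees, so every run terminates.  The node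
-- query i A asks whether A is independent in matroid i (0F and 1F for the
-- first and the second); choose k draws one of k + 1 branches uniformly,
-- independently of earlier draws.

data Mode : Set where
  deterministic randomized : Mode

data Program (n : ℕ) (Out : Set) : Mode → Set where
  return : ∀ {m} → Out → Program n Out m
  query  : ∀ {m} → Fin 2 → Subset n → (Bool → Program n Out m) → Program n Out m
  choose : (k : ℕ) → (Fin (suc k) → Program n Out randomized) →
           Program n Out randomized

module _ {n : ℕ} {Out : Set} (O : Fin 2 → Subset n → Bool) where

  EveryOutput : ∀ {m} → Pred Out 0ℓ → Program n Out m → Set
  EveryOutput P (return x)     = P x
  EveryOutput P (query i A p)  = EveryOutput P (p (O i A))
  EveryOutput P (choose k p)   = ∀ c → EveryOutput P (p c)

  queries : Program n Out deterministic → ℕ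
  queries (return x)    = 0
  queries (query i A p) = suc (queries (p (O i A)))

  expectedQueries : ∀ {m} → Program n Out m → ℚ
  expectedQueries (return x)    = 0ℚ
  expectedQueries (query i A p) = 1ℚ ℚ.+ expectedQueries (p (O i A))
  expectedQueries (choose k p)  =
    (+ 1 ℚ./ suc k) ℚ.* sum (λ c → expectedQueries (p c))

-- The program may depend on the ground set and on S, but on the matroids
-- only through queries.

Algorithm : Mode → Set
Algorithm m = ∀ n → Subset n → Program n (Maybe (Subset n)) m

runOn : ∀ {m} → Algorithm m → (I : Instance) →
        Program (Instance.n I) (Maybe (Subset (Instance.n I))) m
runOn 𝒜 I = 𝒜 (Instance.n I) (Instance.S I)

-- For a randomized algorithm this is the Las Vegas condition: the output is
-- correct whatever the random draws.

SolvesAnother : ∀ {m} → Algorithm m → Set₁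
SolvesAnother 𝒜 =
  ∀ I → EveryOutput (Instance.oracle I) (Instance.CorrectOutput I) (runOn 𝒜 I)

expectedCost : Algorithm randomized → Instance → ℚ
expectedCost 𝒜 I = expectedQueries (Instance.oracle I) (runOn 𝒜 I)

cost : Algorithm deterministic → Instance → ℚ
cost 𝒜 I = + queries (Instance.oracle I) (runOn 𝒜 I) ℚ./ 1

-- f is Õ(n · r^(a/b)), for f nonnegative and b positive: the inequality
--   f ≤ C · (1 + ⌊log₂ n⌋)^k · n · r^(a/b)
-- is raised to the b-th power, which makes both sides rational.  The 1 +
-- only affects n ≤ 1 beyond the choice of C.  C and k do not depend on the
-- instance.

_∈Õ[n·r^_/_] : (Instance → ℚ) → ℕ → ℕ → Set₁
f ∈Õ[n·r^ a / b ] =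
  ∃[ C ] ∃[ k ] ∀ I → let open Instance I in
    f I ^ℚ b ℚ.≤ + ((C * (1 + ⌊log₂ n ⌋) ^ k * n) ^ b * r ^ a) ℚ./ 1

{-# OPTIONS --safe #-}

-- In the exchange graph of S, u ∈ S has an edge to v ∉ S if S − u + v ∈ I₁, and
-- v one to u if S − u + v ∈ I₂.  If T ≠ S is another maximum common independent
-- set, every vertex of the symmetric difference of S and T has an in-neighbour
-- in it; conversely a chordless cycle can be exchanged for such a T.  So it
-- suffices to peel off sources until nothing is left or every remaining vertex
-- has a known in-edge; walking backwards then closes a cycle, and each of its
-- vertices outside S costs O(log n) queries per chord removed or ruled out.  The
-- query S − X + v tells whether v has an edge from (or to) X, so one edge is
-- found by binary search.
--
-- Peeling needs to notice when a vertex x becomes a source.  Some edges into x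
-- are watched; when too few of them are left and no more may be watched, all
-- edges into x are listed.  Deterministically, x watches up to about n / r^(2/3)
-- edges (r^(1/3) if x ∉ S) and every vertex bounds how many of its out-edges are
-- watched; then the vertices that have reached their bound are few enough for
-- listing to be cheap.  With randomness, the out-edges of √r random vertices and
-- of √r random elements of S are watched.  Always killing the least source makes
-- the order of deaths independent of the sample, so that the edges into x which
-- outlive the watched ones number only about a fraction 1 / √r in expectation.

module Submission where

open import Defs
open import Data.Bool.Base using (Bool; true; false; T; if_then_else_; _∨_)
open import Data.Bool.Properties using (T?; T-∨)
import Data.Empty as Empty
open import Data.Fin.Base using (Fin; zero; suc; toℕ; fromℕ<)
open import Data.Fin.Patterns using (0F; 1F)
open import Data.Fin.Properties as Fin using (any?; all?; injective⇒≤; toℕ-fromℕ<)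
open import Data.Fin.Subset using (Subset; ⊥; _∈_; _∉_; _⊆_; _∪_; _-_; ⁅_⁆; ∣_∣)
open import Data.Fin.Subset.Properties
  using (_∈?_; p⊆q⇒∣p∣≤∣q∣; p⊂q⇒∣p∣<∣q∣; x∈p∪q⁻; p⊆p∪q; q⊆p∪q; x∈⁅x⁆; x∈⁅y⁆⇒x≡y; p─q⊆p;
         x∈p∧x≢y⇒x∈p-y; ⊆-antisym; x∈p⇒∣p-x∣<∣p∣; ∪-identityʳ; ∉⊥; ∈⊤; ∣p∣≤n; ∣p∣≡n⇒p≡⊤;
         drop-there)
import Data.Integer.Base as ℤ
import Data.Integer.Properties as ℤ
open import Data.List.Base
  using (List; []; _∷_; _++_; map; filter; allFin; take; drop; head; length; lookup)
import Data.List.Membership.DecPropositional as DecMembership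
open import Data.List.Membership.Propositional using () renaming (_∈_ to _∈ₗ_; _∉_ to _∉ₗ_)
open import Data.List.Membership.Propositional.Properties
  using (∈-filter⁺; ∈-filter⁻; ∈-allFin; ∈-++⁺ˡ; ∈-++⁺ʳ; ∈-++⁻; ∈-map⁺; ∈-map⁻; ∈-lookup)
open import Data.List.Properties
  using (length-take; length-drop; length-filter; take++drop≡id; length-tabulate; length-map;
         length-++; map-++; ++-assoc; ++-identityʳ)
open import Data.List.Relation.Binary.Permutation.Propositional
  using (_↭_; ↭-sym; ↭-trans; ↭-reflexive; ↭⇒↭ₛ)
open import Data.List.Relation.Binary.Permutation.Propositional.Properties
  using (∈-resp-↭; drop-∷; ∷↭∷ʳ)
import Data.List.Relation.Binary.Permutation.Setoid.Properties as Permutationₛ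
open import Data.List.Relation.Binary.Sublist.Propositional
  using ([]; _∷_; _∷ʳ_; ⊆-refl; minimum)
  renaming (_⊆_ to _⊆ₗ_; lookup to ⊆⇒∈)
open import Data.List.Relation.Binary.Sublist.Propositional.Properties using (All-resp-⊆; ++⁺)
open import Data.List.Relation.Unary.All as All using (All; []; _∷_)
import Data.List.Relation.Unary.All.Properties as All
open import Data.List.Relation.Unary.AllPairs using (AllPairs; []; _∷_)
open import Data.List.Relation.Unary.Any using (here; there)
open import Data.List.Relation.Unary.Unique.Propositional using (Unique)
open import Data.Maybe.Base as Maybe using (Maybe; just; nothing)
open import Data.Nat.Base
  using (ℕ; zero; suc; _+_; _*_; _∸_; _^_; _≤_; _<_; _≤ᵇ_; z≤n; s≤s; NonZero; >-nonZero;
         >-nonZero⁻¹)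
open import Data.Nat.DivMod using (_/_; _%_; m≡m%n+[m/n]*n; m%n<n; m/n*n≤m)
open import Data.Nat.Logarithm using (⌊log₂_⌋; ⌊log₂⌋-mono-≤; ⌊log₂[2^n]⌋≡n)
import Data.Nat.Properties as ℕ
open import Data.Nat.Tactic.RingSolver using (solve-∀)
open import Data.Product.Base using (_×_; _,_; ∃-syntax; ∃₂; proj₁; proj₂)
open import Data.Rational.Base as ℚ using (ℚ; 0ℚ; 1ℚ; toℚᵘ)
import Data.Rational.Properties as ℚ
open import Data.Rational.Unnormalised.Base as ℚᵘ using (mkℚᵘ; *≡*; *≤*)
import Data.Rational.Unnormalised.Properties as ℚᵘ
open import Data.Sum.Base using (_⊎_; inj₁; inj₂; [_,_]′)
open import Data.Unit.Base using (⊤; tt)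
open import Data.Vec.Base using (tabulate; []; _∷_; here; there)
open import Data.Vec.Properties using (lookup∘tabulate; []=⇒lookup; lookup⇒[]=)
open import Function.Base using (_∘_; id; case_of_)
open import Function.Bundles using (Equivalence; _⇔_; mk⇔)
open import Level using (0ℓ)
open import Relation.Binary.PropositionalEquality
open import Relation.Nullary.Decidable using (does-⇔; dec-true)
open import Relation.Nullary.Decidable.Core
  using (Dec; yes; no; does; _⊎-dec_; _×-dec_; _→-dec_; ¬?)
open import Relation.Nullary.Negation using (¬_; contradiction)
open import Relation.Unary using (Pred; Decidable)
open import Algebra.Definitions.RawSemiring ℚ.+-*-rawSemiring
  using ()
  renaming (sum to sumℚ; _^_ to _^ℚ_)
open import Algebra.Properties.CommutativeMonoid.Sum ℕ.+-0-commutativeMonoid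
  using (sum; sum-cong-≗; ∑-distrib-+; ∑-comm)
open import Algebra.Properties.Semiring.Sum ℕ.+-*-semiring
  using (*-distribˡ-sum; *-distribʳ-sum)

-- A query `S − X + v` handles many elements of `S` at once but a single `v`, so an in-edge of some
-- `x ∈ S` can only be sought by trying every vertex outside `S`. Hence edges are sought for all
-- vertices together, in rounds of about 4n failed searches plus one search per edge found, and the
-- obstacle is to have few rounds. Give an allowed vertex `y` the weight `capacity y`. Both policies
-- have `threshold x * capacity y ≥ n` on every edge, so a round leaves each live unopened vertex
-- with watched edges from live sources of total weight at least n; a new round starts only after
-- some such vertex has lost all of them. With total weight W there are at most 1 + W / n rounds, so
-- rounds and watched edges together take O(n + W) searches, and W is balanced against the number of
-- listed edges. With a³ ≈ r both are O(n a²). With s ≈ √r samples of each kind, W is O(n s), and in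
-- expectation at most about n / s edges get listed for each of the r elements of `S` and r / s for
-- each other vertex, O(n s) altogether.

private variable
  n : ℕ
  A B : Set

-- Subsets given by a decidable predicate, and exchanges

⟪_⟫ : {P : Pred (Fin n) 0ℓ} → Decidable P → Subset n
⟪ P? ⟫ = tabulate (does ∘ P?)

module _ {P : Pred (Fin n) 0ℓ} (P? : Decidable P) {x : Fin n} where

  ∈⟪⟫⁺ : P x → x ∈ ⟪ P? ⟫
  ∈⟪⟫⁺ px with P? x in eq
  ... | yes _  = lookup⇒[]= x _ (trans (lookup∘tabulate _ x) (cong does eq))
  ... | no ¬px = contradiction px ¬px

  ∈⟪⟫⁻ : x ∈ ⟪ P? ⟫ → P x
  ∈⟪⟫⁻ x∈ with P? x in eq
  ... | yes px = px
  ... | no _   with () ← trans (sym (trans (lookup∘tabulate _ x) (cong does eq))) ([]=⇒lookup x∈)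

infix 4 _∈ₗ?_
_∈ₗ?_ : (x : Fin n) (xs : List (Fin n)) → Dec (x ∈ₗ xs)
_∈ₗ?_ = DecMembership._∈?_ Fin._≟_

opaque
  replace : Subset n → List (Fin n) → List (Fin n) → Subset n
  replace S us vs = ⟪ (λ w → (w ∈? S ×-dec ¬? (w ∈ₗ? us)) ⊎-dec w ∈ₗ? vs) ⟫

  replace⁺ : ∀ {S : Subset n} {us vs w} → (w ∈ S × w ∉ₗ us) ⊎ w ∈ₗ vs → w ∈ replace S us vs
  replace⁺ {S = S} {us} {vs} = ∈⟪⟫⁺ (λ w → (w ∈? S ×-dec ¬? (w ∈ₗ? us)) ⊎-dec w ∈ₗ? vs)

  replace⁻ : ∀ {S : Subset n} {us vs w} → w ∈ replace S us vs → (w ∈ S × w ∉ₗ us) ⊎ w ∈ₗ vs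
  replace⁻ {S = S} {us} {vs} = ∈⟪⟫⁻ (λ w → (w ∈? S ×-dec ¬? (w ∈ₗ? us)) ⊎-dec w ∈ₗ? vs)

swap : Subset n → Fin n → Fin n → Subset n
swap S u v = replace S (u ∷ []) (v ∷ [])

⊆∧∣≤∣⇒⊇ : {A B : Subset n} → A ⊆ B → ∣ B ∣ ≤ ∣ A ∣ → B ⊆ A
⊆∧∣≤∣⇒⊇ {A = A} A⊆B B≤A {x} x∈B with x ∈? A
... | yes x∈A = x∈A
... | no x∉A = contradiction (p⊂q⇒∣p∣<∣q∣ (A⊆B , x , x∈B , x∉A)) (ℕ.≤⇒≯ B≤A)

∣p∪⁅x⁆∣≤1+∣p∣ : (p : Subset n) (x : Fin n) → ∣ p ∪ ⁅ x ⁆ ∣ ≤ suc ∣ p ∣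
∣p∪⁅x⁆∣≤1+∣p∣ (true  ∷ p) zero    = s≤s (ℕ.m≤n⇒m≤1+n (ℕ.≤-reflexive (cong ∣_∣ (∪-identityʳ p))))
∣p∪⁅x⁆∣≤1+∣p∣ (false ∷ p) zero    = s≤s (ℕ.≤-reflexive (cong ∣_∣ (∪-identityʳ p)))
∣p∪⁅x⁆∣≤1+∣p∣ (true  ∷ p) (suc x) = s≤s (∣p∪⁅x⁆∣≤1+∣p∣ p x)
∣p∪⁅x⁆∣≤1+∣p∣ (false ∷ p) (suc x) = ∣p∪⁅x⁆∣≤1+∣p∣ p x

∣swap∣≤ : {S : Subset n} {u v : Fin n} → u ∈ S → ∣ swap S u v ∣ ≤ ∣ S ∣
∣swap∣≤ {S = S} {u} {v} u∈S =
  ℕ.≤-trans (p⊆q⇒∣p∣≤∣q∣ sub) (ℕ.≤-trans (∣p∪⁅x⁆∣≤1+∣p∣ (S - u) v) (x∈p⇒∣p-x∣<∣p∣ u∈S))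
  where
  sub : swap S u v ⊆ (S - u) ∪ ⁅ v ⁆
  sub w∈ with replace⁻ w∈
  ... | inj₁ (w∈S , w∉) = p⊆p∪q _ (x∈p∧x≢y⇒x∈p-y w∈S (w∉ ∘ here))
  ... | inj₂ (here refl) = q⊆p∪q _ _ (x∈⁅x⁆ v)

x∉p-x : (p : Subset n) (x : Fin n) → x ∉ p - x
x∉p-x (_ ∷ p) (suc x) (there x∈) = x∉p-x p x x∈

-- Trading `u` for `v` loses at most one element and gains one: `v` is new because the `v`s are
-- distinct and outside `S`.
∣S∣≤∣replace∣ : {S : Subset n} (es : List (Fin n × Fin n)) →
  All (_∉ S) (map proj₁ es) → Unique (map proj₁ es) →
  ∣ S ∣ ≤ ∣ replace S (map proj₂ es) (map proj₁ es) ∣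
∣S∣≤∣replace∣ [] _ _ = p⊆q⇒∣p∣≤∣q∣ (λ w∈S → replace⁺ (inj₁ (w∈S , λ ())))
∣S∣≤∣replace∣ {S = S} ((v , u) ∷ es) (v∉S ∷ vs∉S) (v∉vs ∷ uniq) = begin
  ∣ S ∣                     ≤⟨ ∣S∣≤∣replace∣ es vs∉S uniq ⟩
  ∣ R ∣                     ≤⟨ p⊆q⇒∣p∣≤∣q∣ R⊆ ⟩
  ∣ (R - u) ∪ ⁅ u ⁆ ∣       ≤⟨ ∣p∪⁅x⁆∣≤1+∣p∣ (R - u) u ⟩
  suc ∣ R - u ∣             ≤⟨ p⊂q⇒∣p∣<∣q∣ (p⊆p∪q ⁅ v ⁆ , v , q⊆p∪q _ _ (x∈⁅x⁆ v) , v∉R ∘ p─q⊆p R ⁅ u ⁆) ⟩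
  ∣ (R - u) ∪ ⁅ v ⁆ ∣       ≤⟨ p⊆q⇒∣p∣≤∣q∣ new ⟩
  ∣ replace S (u ∷ us) (v ∷ vs) ∣ ∎
  where
  open ℕ.≤-Reasoning
  us = map proj₂ es
  vs = map proj₁ es
  R = replace S us vs
  v∉R : v ∉ R
  v∉R v∈R with replace⁻ v∈R
  ... | inj₁ (v∈S , _) = v∉S v∈S
  ... | inj₂ v∈vs = All.lookup v∉vs v∈vs refl
  R⊆ : R ⊆ (R - u) ∪ ⁅ u ⁆
  R⊆ {x} x∈R with x Fin.≟ u
  ... | yes refl = q⊆p∪q _ _ (x∈⁅x⁆ u)
  ... | no x≢u = p⊆p∪q _ (x∈p∧x≢y⇒x∈p-y x∈R x≢u)
  new : (R - u) ∪ ⁅ v ⁆ ⊆ replace S (u ∷ us) (v ∷ vs)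
  new {x} x∈ with x∈p∪q⁻ (R - u) ⁅ v ⁆ x∈
  ... | inj₂ x∈v = replace⁺ (inj₂ (here (x∈⁅y⁆⇒x≡y v x∈v)))
  ... | inj₁ x∈R-u with replace⁻ (p─q⊆p R ⁅ u ⁆ x∈R-u)
  ... | inj₂ x∈vs = replace⁺ (inj₂ (there x∈vs))
  ... | inj₁ (x∈S , x∉us) = replace⁺ (inj₁ (x∈S , λ where
          (here refl) → x∉p-x R x x∈R-u
          (there x∈us) → x∉us x∈us))

-- Matroid exchange

module _ (M : Matroid n) where
  open Matroid M using (subset; exchange)

  -- `exchange` repeated until the size of `B` is reached; `k` bounds the remaining deficit.
  augment : ∀ {A B} → Indep M A → Indep M B →
            ∃[ C ] Indep M C × A ⊆ C × C ⊆ A ∪ B × ∣ B ∣ ≤ ∣ C ∣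
  augment {A} {B} iA iB = go (∣ B ∣ ∸ ∣ A ∣) A ℕ.≤-refl iA id (p⊆p∪q B)
    where
    go : ∀ k C → ∣ B ∣ ∸ ∣ C ∣ ≤ k → Indep M C → A ⊆ C → C ⊆ A ∪ B →
         ∃[ C ] Indep M C × A ⊆ C × C ⊆ A ∪ B × ∣ B ∣ ≤ ∣ C ∣
    go k C k≥ iC A⊆C C⊆ with ∣ B ∣ ℕ.≤? ∣ C ∣
    ... | yes B≤C = C , iC , A⊆C , C⊆ , B≤C
    ... | no B≰C with exchange iC iB (ℕ.≰⇒> B≰C)
    go zero C k≥ iC A⊆C C⊆ | no B≰C | _ = contradiction (ℕ.m∸n≡0⇒m≤n (ℕ.n≤0⇒n≡0 k≥)) B≰C
    go (suc k) C k≥ iC A⊆C C⊆ | no B≰C | x , x∈B , x∉C , iCx =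
      go k (C ∪ ⁅ x ⁆) smaller iCx (p⊆p∪q _ ∘ A⊆C) C′⊆
      where
      smaller : ∣ B ∣ ∸ ∣ C ∪ ⁅ x ⁆ ∣ ≤ k
      smaller = ℕ.≤-pred (ℕ.≤-trans (ℕ.∸-monoʳ-< (p⊂q⇒∣p∣<∣q∣ (p⊆p∪q ⁅ x ⁆ , x , q⊆p∪q C _ (x∈⁅x⁆ x) , x∉C))
                  (ℕ.≤-trans (∣p∪⁅x⁆∣≤1+∣p∣ C x) (ℕ.≰⇒> B≰C))) k≥)
      C′⊆ : C ∪ ⁅ x ⁆ ⊆ A ∪ B
      C′⊆ y∈ with x∈p∪q⁻ C ⁅ x ⁆ y∈
      ... | inj₁ y∈C = C⊆ y∈C
      ... | inj₂ y∈x rewrite x∈⁅y⁆⇒x≡y x y∈x = q⊆p∪q A B x∈B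

  module _ {S : Subset n} (iS : Indep M S) where

    -- This makes binary search sound: a query that removes all of `us` detects an edge at one of
    -- its members. Augmenting from `S` gives a `C` with at least ∣S∣ elements between S - us + v
    -- and S + v. If `C` misses some `u ∈ us`, counting shows that it contains `swap S u v`;
    -- otherwise it contains all of S + v, and every swap is independent.
    swap-from-replace : ∀ {v u₀ us} → u₀ ∈ₗ us → All (_∈ S) us →
      Indep M (replace S us (v ∷ [])) → ∃[ u ] u ∈ₗ us × Indep M (swap S u v)
    swap-from-replace {v} {u₀} {us} u₀∈us us⊆S iR
      with C , iC , R⊆C , C⊆ , S≤C ← augment iR iS
      with any? (λ u → u ∈ₗ? us ×-dec ¬? (u ∈? C))
    ... | yes (u , u∈us , u∉C) = u , u∈us , subset (⊆∧∣≤∣⇒⊇ C⊆swap (ℕ.≤-trans (∣swap∣≤ (All.lookup us⊆S u∈us)) S≤C)) iC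
      where
      C⊆swap : C ⊆ swap S u v
      C⊆swap {x} x∈C with x∈p∪q⁻ _ S (C⊆ x∈C)
      ... | inj₂ x∈S = replace⁺ (inj₁ (x∈S , λ { (here refl) → u∉C x∈C }))
      ... | inj₁ x∈R with replace⁻ x∈R
      ... | inj₁ (x∈S , x∉us) = replace⁺ (inj₁ (x∈S , λ { (here refl) → x∉us u∈us }))
      ... | inj₂ x∈v = replace⁺ (inj₂ x∈v)
    ... | no none = u₀ , u₀∈us , subset swap⊆C iC
      where
      swap⊆C : swap S u₀ v ⊆ C
      swap⊆C {x} x∈ with replace⁻ x∈
      ... | inj₂ x∈v = R⊆C (replace⁺ (inj₂ x∈v))
      ... | inj₁ (x∈S , _) with x ∈ₗ? us
      ... | no x∉us = R⊆C (replace⁺ (inj₁ (x∈S , x∉us)))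
      ... | yes x∈us with x ∈? C
      ... | yes x∈C = x∈C
      ... | no x∉C = contradiction (x , x∈us , x∉C) none

    replace-from-swap : ∀ {v u us} → u ∈ₗ us → Indep M (swap S u v) → Indep M (replace S us (v ∷ []))
    replace-from-swap {v} {u} {us} u∈us = subset λ {x} x∈ → case replace⁻ x∈ of λ where
      (inj₁ (x∈S , x∉us)) → replace⁺ (inj₁ (x∈S , λ { (here refl) → x∉us u∈us }))
      (inj₂ x∈v) → replace⁺ (inj₂ x∈v)

    -- Induction on the matching: when the set exchanged so far is extended by
    -- elements of swap S u v to the size of S, triangularity forces v in.
    replace-indep : (ps : List (Fin n × Fin n)) →
      All (λ (v , u) → u ∈ S × v ∉ S × Indep M (swap S u v)) ps →
      AllPairs (λ (v , u) (v′ , u′) → ¬ Indep M (swap S u v′)) ps →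
      Indep M (replace S (map proj₂ ps) (map proj₁ ps))
    replace-indep ps ok tri = go ps ok tri id
      where
      us₀ = map proj₂ ps
      go : ∀ qs → All (λ (v , u) → u ∈ S × v ∉ S × Indep M (swap S u v)) qs →
           AllPairs (λ (v , u) (v′ , u′) → ¬ Indep M (swap S u v′)) qs →
           (∀ {u} → u ∈ₗ map proj₂ qs → u ∈ₗ us₀) →
           Indep M (replace S us₀ (map proj₁ qs))
      go [] _ _ _ = subset (λ x∈ → case replace⁻ x∈ of λ where
        (inj₁ (x∈S , _)) → x∈S
        (inj₂ ())) iS
      go ((v , u) ∷ qs) ((u∈S , v∉S , iuv) ∷ ok) (tri ∷ tris) qs⊆
        with C , iC , A⊆C , C⊆ , B≤C ← augment (go qs ok tris (qs⊆ ∘ there)) iuv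
        with v ∈? C
      ... | yes v∈C = subset (λ x∈ → case replace⁻ x∈ of λ where
              (inj₁ x∈) → A⊆C (replace⁺ (inj₁ x∈))
              (inj₂ (here refl)) → v∈C
              (inj₂ (there x∈)) → A⊆C (replace⁺ (inj₂ x∈))) iC
      -- Without `v`, the set `C` is still larger than `S - u`. The element that exchange adds to
      -- `S - u` can then only be some later `v′`, and `swap S u v′` would be independent.
      ... | no v∉C = contradiction (exchange iS-u iC S-u<C) λ (x , x∈C , x∉S-u , ix) → impossible x∈C x∉S-u ix
        where
        S-u⊆swap : S - u ⊆ swap S u v
        S-u⊆swap {x} x∈ = replace⁺ (inj₁ (p─q⊆p S _ x∈ , λ { (here refl) → x∉p-x S x x∈ }))
        iS-u : Indep M (S - u)
        iS-u = subset (p─q⊆p S _) iS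
        S-u<C : ∣ S - u ∣ < ∣ C ∣
        S-u<C = ℕ.<-≤-trans (p⊂q⇒∣p∣<∣q∣ (S-u⊆swap , v , replace⁺ (inj₂ (here refl)) , v∉S ∘ p─q⊆p S _)) B≤C
        S-u⁺ : ∀ {x} → x ∈ S → x ≢ u → x ∈ S - u
        S-u⁺ = x∈p∧x≢y⇒x∈p-y
        swap⊆ : ∀ {x} → swap S u x ⊆ (S - u) ∪ ⁅ x ⁆
        swap⊆ {x} {y} y∈ with replace⁻ y∈
        ... | inj₁ (y∈S , y∉u) = p⊆p∪q _ (S-u⁺ y∈S (y∉u ∘ here))
        ... | inj₂ (here refl) = q⊆p∪q _ _ (x∈⁅x⁆ x)
        impossible : ∀ {x} → x ∈ C → x ∉ S - u → ¬ Indep M ((S - u) ∪ ⁅ x ⁆)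
        impossible {x} x∈C x∉S-u ix with x∈p∪q⁻ _ _ (C⊆ x∈C)
        ... | inj₂ x∈swap with replace⁻ x∈swap
        ...   | inj₁ (x∈S , x∉u) = x∉S-u (S-u⁺ x∈S (x∉u ∘ here))
        ...   | inj₂ (here refl) = v∉C x∈C
        impossible {x} x∈C x∉S-u ix | inj₁ x∈A with replace⁻ x∈A
        ... | inj₁ (x∈S , x∉us) = x∉S-u (S-u⁺ x∈S λ { refl → x∉us (qs⊆ (here refl)) })
        ... | inj₂ x∈vs = blocked tri x∈vs
          where
          blocked : ∀ {rs} → All (λ (v′ , u′) → ¬ Indep M (swap S u v′)) rs → x ∈ₗ map proj₁ rs → Empty.⊥
          blocked {_ ∷ _} (¬i ∷ _) (here refl) = ¬i (subset swap⊆ ix)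
          blocked {_ ∷ _} (_ ∷ ¬is) (there x∈) = blocked ¬is x∈

  -- Both S and T are bases of the truncation to rank ∣ S ∣.
  module _ {S T : Subset n} (iS : Indep M S) (iT : Indep M T) (S≡T : ∣ S ∣ ≡ ∣ T ∣) where

    exchange-out : ∀ {u} → u ∈ S → u ∉ T → ∃[ v ] v ∈ T × v ∉ S × Indep M (swap S u v)
    exchange-out {u} u∈S u∉T
      with v , v∈T , v∉S-u , iv ← exchange (subset (p─q⊆p S _) iS) iT (ℕ.<-≤-trans (x∈p⇒∣p-x∣<∣p∣ u∈S) (ℕ.≤-reflexive S≡T))
      = v , v∈T , (λ v∈S → v∉S-u (x∈p∧x≢y⇒x∈p-y v∈S λ { refl → u∉T v∈T })) , subset sub iv
      where
      sub : swap S u v ⊆ (S - u) ∪ ⁅ v ⁆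
      sub {y} y∈ with replace⁻ y∈
      ... | inj₁ (y∈S , y∉u) = p⊆p∪q _ (x∈p∧x≢y⇒x∈p-y y∈S (y∉u ∘ here))
      ... | inj₂ (here refl) = q⊆p∪q _ _ (x∈⁅x⁆ v)

    -- Removing from `S` everything outside `T` and adding `v` leaves a subset of `T`, hence an
    -- independent set, and `swap-from-replace` extracts a single `u`. Equal sizes guarantee that
    -- something is removed.
    exchange-in : ∀ {v} → v ∈ T → v ∉ S → ∃[ u ] u ∈ S × u ∉ T × Indep M (swap S u v)
    exchange-in {v} v∈T v∉S = case any? (λ u → u ∈? S ×-dec ¬? (u ∈? T)) of λ where
        (no none) → contradiction (p⊂q⇒∣p∣<∣q∣ (S⊆T none , v , v∈T , v∉S)) (ℕ.≤⇒≯ (ℕ.≤-reflexive (sym S≡T)))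
        (yes (u₀ , u₀∈S , u₀∉T)) →
          let u , u∈us , iu = swap-from-replace iS (∈us⁺ u₀∈S u₀∉T) (All.tabulate (proj₁ ∘ ∈us⁻)) (subset sub iT)
          in u , proj₁ (∈us⁻ u∈us) , proj₂ (∈us⁻ u∈us) , iu
      where
      S⊆T : ¬ (∃[ u ] u ∈ S × u ∉ T) → S ⊆ T
      S⊆T none {x} x∈S with x ∈? T
      ... | yes x∈T = x∈T
      ... | no x∉T = contradiction (x , x∈S , x∉T) none
      us : List (Fin n)
      us = filter (λ u → u ∈? S ×-dec ¬? (u ∈? T)) (allFin n)
      ∈us⁺ : ∀ {u} → u ∈ S → u ∉ T → u ∈ₗ us
      ∈us⁺ u∈S u∉T = ∈-filter⁺ _ (∈-allFin _) (u∈S , u∉T)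
      ∈us⁻ : ∀ {u} → u ∈ₗ us → u ∈ S × u ∉ T
      ∈us⁻ u∈us = proj₂ (∈-filter⁻ _ {xs = allFin n} u∈us)
      sub : replace S us (v ∷ []) ⊆ T
      sub {x} x∈ with replace⁻ x∈
      ... | inj₂ (here refl) = v∈T
      ... | inj₁ (x∈S , x∉us) with x ∈? T
      ... | yes x∈T = x∈T
      ... | no x∉T = contradiction (∈us⁺ x∈S x∉T) x∉us

-- Deterministic programs

DProgram : ℕ → Set → Set
DProgram n A = Program n A deterministic

infixl 1 _>>=_
_>>=_ : DProgram n A → (A → DProgram n B) → DProgram n B
return x >>= f = f x
query i X p >>= f = query i X λ b → p b >>= f

module _ (O : Fin 2 → Subset n → Bool) where

  run : DProgram n A → A
  run (return x) = x
  run (query i X p) = run (p (O i X))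

  -- Output and query count of the run are constrained jointly, so that the cost can be charged to
  -- what was found.
  record Ensures (p : DProgram n A) (Q : A → ℕ → Set) : Set where
    constructor ensures
    field holds : Q (run p) (queries O p)

  open Ensures public

  ensures-query : ∀ {Q : A → ℕ → Set} {i X p} →
    (∀ b → O i X ≡ b → Ensures (p b) (λ x c → Q x (suc c))) → Ensures (query i X p) Q
  ensures-query {i = i} {X} h = ensures (holds (h (O i X) refl))

  ensures->>= : ∀ {p : DProgram n A} {f : A → DProgram n B} {Q : A → ℕ → Set} {R : B → ℕ → Set} →
    Ensures p Q → (∀ x c → Q x c → Ensures (f x) (λ y d → R y (c + d))) → Ensures (p >>= f) R
  ensures->>= {p = return x} hp hf = ensures (holds (hf x 0 (holds hp)))
  ensures->>= {p = query i X p} {R = R} hp hf =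
    ensures (holds (ensures->>= {p = p (O i X)} {R = λ y c → R y (suc c)} (ensures (holds hp)) λ x c → hf x (suc c)))

  ensures-map : ∀ {p : DProgram n A} {Q R : A → ℕ → Set} →
    (∀ {x c} → Q x c → R x c) → Ensures p Q → Ensures p R
  ensures-map h (ensures q) = ensures (h q)

-- Binary search for an edge at a vertex outside `S`

n<2^1+⌊log₂n⌋ : ∀ n → n < 2 ^ suc ⌊log₂ n ⌋
n<2^1+⌊log₂n⌋ n = ℕ.≰⇒> λ 2^k≤n → ℕ.1+n≰n (begin
  suc ⌊log₂ n ⌋                ≡⟨ ⌊log₂[2^n]⌋≡n (suc ⌊log₂ n ⌋) ⟨
  ⌊log₂ (2 ^ suc ⌊log₂ n ⌋) ⌋  ≤⟨ ⌊log₂⌋-mono-≤ 2^k≤n ⟩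
  ⌊log₂ n ⌋                    ∎)
  where open ℕ.≤-Reasoning

take-nonempty : ∀ {m} {u : A} {us} → 0 < m → u ∈ₗ us → ∃[ w ] w ∈ₗ take m us
take-nonempty {m = suc _} {us = w ∷ _} _ _ = w , here refl

module Search {n : ℕ} (S : Subset n) where

  members : List (Fin n)
  members = filter (_∈? S) (allFin n)

  freeing : List (Fin n) → Fin n → Subset n
  freeing us v = replace S us (v ∷ [])

  search : Fin 2 → Fin n → ℕ → List (Fin n) → DProgram n (Maybe (Fin n))
  search i v zero us = return (head us)
  search i v (suc k) us = query i (freeing (take (2 ^ k) us) v) λ b →
    if b then search i v k (take (2 ^ k) us) else search i v k (drop (2 ^ k) us)

  -- The opening query settles whether there is an edge at all. From then on one is known to exist,
  -- so a negative answer for one half sends `search` to the other half without a further test.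
  findIn : Fin 2 → Fin n → List (Fin n) → DProgram n (Maybe (Fin n))
  findIn i v [] = return nothing
  findIn i v us@(_ ∷ _) = query i (freeing us v) λ b →
    if b then search i v (suc ⌊log₂ n ⌋) us else return nothing

  find : Fin 2 → Fin n → {P : Pred (Fin n) 0ℓ} → Decidable P → DProgram n (Maybe (Fin n))
  find i v P? = findIn i v (filter P? members)

  findCost : ℕ
  findCost = 2 + ⌊log₂ n ⌋

  module _ (O : Fin 2 → Subset n → Bool) where

    Hit : Fin 2 → Fin n → Fin n → Set
    Hit i v u = T (O i (swap S u v))

    -- All that the search needs from the matroids. The premise `u ∈ₗ us` of `hit⁻` keeps `us`
    -- nonempty: for an empty list the query asks about S + v, and a positive answer would name no
    -- partner.
    record Detects : Set where
      field
        hit⁻ : ∀ i {v u us} → u ∈ₗ us → All (_∈ S) us → T (O i (freeing us v)) →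
               ∃[ u ] u ∈ₗ us × Hit i v u
        hit⁺ : ∀ i {v u us} → u ∈ₗ us → Hit i v u → T (O i (freeing us v))

    Found : Fin 2 → Fin n → Pred (Fin n) 0ℓ → Pred (Maybe (Fin n)) 0ℓ
    Found i v P nothing  = ∀ {u} → u ∈ S → P u → ¬ Hit i v u
    Found i v P (just u) = u ∈ S × P u × Hit i v u

    module _ (detects : Detects) (i : Fin 2) (v : Fin n) where
      open Detects detects

      search-correct : ∀ k us → length us ≤ 2 ^ k → All (_∈ S) us → ∃[ u ] u ∈ₗ us × Hit i v u →
        Ensures O (search i v k us) (λ m c → c ≤ k × ∃[ u ] m ≡ just u × u ∈ₗ us × Hit i v u)
      search-correct zero (u ∷ []) _ _ (u , here refl , hit) = ensures (z≤n , u , refl , here refl , hit)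
      search-correct zero (_ ∷ _ ∷ _) (s≤s ()) _ _
      search-correct (suc k) us len us⊆S (u , u∈us , hit) = ensures-query O λ where
          true eq → ensures-map O (λ (c≤ , w , eq , w∈ , h) → s≤s c≤ , w , eq , take⊆ w∈ , h)
            (search-correct k (take (2 ^ k) us)
              (ℕ.≤-trans (ℕ.≤-reflexive (length-take (2 ^ k) us)) (ℕ.m⊓n≤m _ _))
              (All.take⁺ (2 ^ k) us⊆S)
              (hit⁻ i (proj₂ (take-nonempty (ℕ.m^n>0 2 k) u∈us)) (All.take⁺ (2 ^ k) us⊆S) (subst T (sym eq) _)))
          false eq → ensures-map O (λ (c≤ , w , eq , w∈ , h) → s≤s c≤ , w , eq , drop⊆ w∈ , h)
            (search-correct k (drop (2 ^ k) us)
              drop-short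
              (All.drop⁺ (2 ^ k) us⊆S)
              (u , (case ∈-++⁻ (take (2 ^ k) us) (subst (u ∈ₗ_) (sym (take++drop≡id (2 ^ k) us)) u∈us) of λ where
                (inj₁ u∈take) → contradiction (subst T eq (hit⁺ i u∈take hit)) id
                (inj₂ u∈drop) → u∈drop) , hit))
        where
        take⊆ : ∀ {w} → w ∈ₗ take (2 ^ k) us → w ∈ₗ us
        take⊆ = All.lookup (All.take⁺ (2 ^ k) (All.tabulate id))
        drop⊆ : ∀ {w} → w ∈ₗ drop (2 ^ k) us → w ∈ₗ us
        drop⊆ = All.lookup (All.drop⁺ (2 ^ k) (All.tabulate id))
        drop-short : length (drop (2 ^ k) us) ≤ 2 ^ k
        drop-short = ℕ.≤-trans (ℕ.≤-reflexive (length-drop (2 ^ k) us))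
          (ℕ.≤-trans (ℕ.∸-monoˡ-≤ (2 ^ k) len) (ℕ.≤-reflexive (trans (ℕ.m+n∸m≡n (2 ^ k) _) (ℕ.+-identityʳ _))))

      FoundIn : List (Fin n) → Maybe (Fin n) → Set
      FoundIn us nothing  = ∀ {u} → u ∈ₗ us → ¬ Hit i v u
      FoundIn us (just u) = u ∈ₗ us × Hit i v u

      findIn-correct : ∀ us → length us ≤ n → All (_∈ S) us →
        Ensures O (findIn i v us) (λ m c → c ≤ findCost × FoundIn us m)
      findIn-correct [] _ _ = ensures (z≤n , λ ())
      findIn-correct us@(_ ∷ _) len us⊆S = ensures-query O λ where
        false eq → ensures (s≤s z≤n , λ u∈us hit → subst T eq (hit⁺ i u∈us hit))
        true eq → ensures-map O (λ { (c≤ , u , refl , u∈us , hit) → s≤s c≤ , u∈us , hit })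
          (search-correct (suc ⌊log₂ n ⌋) us (ℕ.≤-trans len (ℕ.<⇒≤ (n<2^1+⌊log₂n⌋ n))) us⊆S
            (hit⁻ i (here refl) us⊆S (subst T (sym eq) _)))

      find-correct : ∀ {P : Pred (Fin n) 0ℓ} (P? : Decidable P) →
        Ensures O (find i v P?) (λ m c → c ≤ findCost × Found i v P m)
      find-correct {P} P? = ensures-map O (λ {m} (c≤ , found) → c≤ , convert m found)
        (findIn-correct (filter P? members)
          (ℕ.≤-trans (length-filter P? members)
            (ℕ.≤-trans (length-filter (_∈? S) (allFin n)) (ℕ.≤-reflexive (length-tabulate id))))
          (All.tabulate (proj₁ ∘ ∈us)))
        where
        ∈us : ∀ {u} → u ∈ₗ filter P? members → u ∈ S × P u
        ∈us u∈ =
          let u∈m , pu = ∈-filter⁻ P? {xs = members} u∈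
          in proj₂ (∈-filter⁻ (_∈? S) {xs = allFin n} u∈m) , pu
        convert : ∀ m → FoundIn (filter P? members) m → Found i v P m
        convert nothing none u∈S pu = none (∈-filter⁺ P? (∈-filter⁺ (_∈? S) (∈-allFin _) u∈S) pu)
        convert (just u) (u∈us , hit) = proj₁ (∈us u∈us) , proj₂ (∈us u∈us) , hit

-- Finite sums and cardinalities

sum-mono : {f g : Fin n → ℕ} → (∀ i → f i ≤ g i) → sum f ≤ sum g
sum-mono {zero} h = z≤n
sum-mono {suc n} h = ℕ.+-mono-≤ (h zero) (sum-mono (h ∘ suc))

sum-mono-< : {f g : Fin n → ℕ} → (∀ i → f i ≤ g i) → ∀ j → f j < g j → sum f < sum g
sum-mono-< {suc n} h zero lt = ℕ.+-mono-<-≤ lt (sum-mono (h ∘ suc))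
sum-mono-< {suc n} h (suc j) lt = ℕ.+-mono-≤-< (h zero) (sum-mono-< (h ∘ suc) j lt)

sum-≤-* : {f : Fin n → ℕ} {c : ℕ} → (∀ i → f i ≤ c) → sum f ≤ n * c
sum-≤-* {zero} h = z≤n
sum-≤-* {suc n} h = ℕ.+-mono-≤ (h zero) (sum-≤-* (h ∘ suc))

summand≤sum : ∀ (f : Fin n → ℕ) j → f j ≤ sum f
summand≤sum f zero = ℕ.m≤m+n _ _
summand≤sum f (suc j) = ℕ.≤-trans (summand≤sum (f ∘ suc) j) (ℕ.m≤n+m _ (f zero))

ind : Dec A → ℕ
ind (yes _) = 1
ind (no _) = 0

ind-mono : (a? : Dec A) (b? : Dec B) → (A → B) → ind a? ≤ ind b?
ind-mono (yes a) (yes b) h = ℕ.≤-refl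
ind-mono (yes a) (no ¬b) h = contradiction (h a) ¬b
ind-mono (no _) _ h = z≤n

ind≤1 : (a? : Dec A) → ind a? ≤ 1
ind≤1 (yes _) = ℕ.≤-refl
ind≤1 (no _) = z≤n

ind-yes : (a? : Dec A) → A → ind a? ≡ 1
ind-yes (yes _) _ = refl
ind-yes (no ¬a) a = contradiction a ¬a

ind-no : (a? : Dec A) → ¬ A → ind a? ≡ 0
ind-no (yes a) ¬a = contradiction a ¬a
ind-no (no _) _ = refl

count : {P : Pred (Fin n) 0ℓ} → Decidable P → ℕ
count P? = sum (λ i → ind (P? i))

module _ {P Q : Pred (Fin n) 0ℓ} (P? : Decidable P) (Q? : Decidable Q) where

  count-mono : (∀ {i} → P i → Q i) → count P? ≤ count Q?
  count-mono h = sum-mono λ i → ind-mono (P? i) (Q? i) h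

  count-mono-< : (∀ {i} → P i → Q i) → ∀ j → ¬ P j → Q j → count P? < count Q?
  count-mono-< h j ¬pj qj = sum-mono-< (λ i → ind-mono (P? i) (Q? i) h) j
    (ℕ.≤-reflexive (trans (cong suc (ind-no (P? j) ¬pj)) (sym (ind-yes (Q? j) qj))))

count≤n : {P : Pred (Fin n) 0ℓ} (P? : Decidable P) → count P? ≤ n
count≤n {n} P? = ℕ.≤-trans (sum-≤-* (λ i → ind≤1 (P? i))) (ℕ.≤-reflexive (ℕ.*-identityʳ n))

count-pos : {P : Pred (Fin n) 0ℓ} (P? : Decidable P) → ∀ j → P j → 1 ≤ count P?
count-pos P? j pj = ℕ.≤-trans (ℕ.≤-reflexive (sym (ind-yes (P? j) pj))) (summand≤sum (λ i → ind (P? i)) j)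

count-none : {P : Pred (Fin n) 0ℓ} (P? : Decidable P) → (∀ i → ¬ P i) → count P? ≡ 0
count-none {n} P? h = ℕ.n≤0⇒n≡0 (ℕ.≤-trans (sum-≤-* (λ i → ℕ.≤-reflexive (ind-no (P? i) (h i)))) (ℕ.≤-reflexive (ℕ.*-zeroʳ n)))

count-singleton : (j : Fin n) → count (λ i → i Fin.≟ j) ≤ 1
count-singleton {suc n} zero =
  s≤s (ℕ.≤-reflexive (count-none {n} {P = λ i → suc i ≡ zero} (λ i → suc i Fin.≟ zero) λ _ ()))
count-singleton {suc n} (suc j) = ℕ.≤-trans
  (count-mono {n} {P = λ i → suc i ≡ suc j} {Q = _≡ j} (λ i → suc i Fin.≟ suc j) (λ i → i Fin.≟ j) Fin.suc-injective)
  (count-singleton j)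

count-insert : {P Q : Pred (Fin n) 0ℓ} (P? : Decidable P) (Q? : Decidable Q) (j : Fin n) →
  (∀ {i} → P i → Q i ⊎ i ≡ j) → count P? ≤ suc (count Q?)
count-insert {P = P} {Q} P? Q? j h = begin
  count P?                                      ≤⟨ sum-mono (λ i → pointwise i (P? i) (Q? i) (i Fin.≟ j)) ⟩
  sum (λ i → ind (i Fin.≟ j) + ind (Q? i))      ≡⟨ ∑-distrib-+ (λ i → ind (i Fin.≟ j)) (λ i → ind (Q? i)) ⟩
  count (λ i → i Fin.≟ j) + count Q?            ≤⟨ ℕ.+-monoˡ-≤ (count Q?) (count-singleton j) ⟩
  suc (count Q?)                                ∎
  where
  open ℕ.≤-Reasoning
  pointwise : ∀ i (p? : Dec (P i)) (q? : Dec (Q i)) (e? : Dec (i ≡ j)) → ind p? ≤ ind e? + ind q?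
  pointwise i (no _) _ _ = z≤n
  pointwise i (yes p) q? (yes e) = s≤s z≤n
  pointwise i (yes p) (yes q) (no e) = s≤s z≤n
  pointwise i (yes p) (no ¬q) (no ¬e) = contradiction (h p) [ ¬q , ¬e ]′

-- Tables of known pairs

Table : ℕ → Set
Table n = Fin n → Fin n → Bool

infix 4 _⊑_
_⊑_ : Table n → Table n → Set
t ⊑ t′ = ∀ {y x} → T (t y x) → T (t′ y x)

add : Table n → Fin n → Fin n → Table n
add t y x y′ x′ = does (y′ Fin.≟ y ×-dec x′ Fin.≟ x) ∨ t y′ x′

module _ (t : Table n) (y x : Fin n) where

  add-⊑ : t ⊑ add t y x
  add-⊑ h = Equivalence.from T-∨ (inj₂ h)

  add-new : T (add t y x y x)
  add-new rewrite dec-true (y Fin.≟ y) refl | dec-true (x Fin.≟ x) refl = _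

  add⁻ : ∀ {y′ x′} → T (add t y x y′ x′) → T (t y′ x′) ⊎ (y′ ≡ y × x′ ≡ x)
  add⁻ {y′} {x′} h with y′ Fin.≟ y | x′ Fin.≟ x
  ... | yes p | yes q = inj₂ (p , q)
  ... | yes p | no _ = inj₁ h
  ... | no _ | yes _ = inj₁ h
  ... | no _ | no _ = inj₁ h

load : Table n → Fin n → ℕ
load t y = count (λ x → T? (t y x))

size : Table n → ℕ
size t = sum (load t)

size≤n² : (t : Table n) → size t ≤ n * n
size≤n² t = sum-≤-* λ y → count≤n (λ x → T? (t y x))

load-add : (t : Table n) → ∀ y x y′ → load (add t y x) y′ ≤ suc (load t y′)
load-add t y x y′ = count-insert (λ x′ → T? (add t y x y′ x′)) (λ x′ → T? (t y′ x′)) x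
  ([ inj₁ , inj₂ ∘ proj₂ ]′ ∘ add⁻ t y x)

load-add-other : (t : Table n) → ∀ y x {y′} → y′ ≢ y → load (add t y x) y′ ≤ load t y′
load-add-other t y x {y′} y′≢y = count-mono (λ x′ → T? (add t y x y′ x′)) (λ x′ → T? (t y′ x′))
  ([ id , (λ e → contradiction (proj₁ e) y′≢y) ]′ ∘ add⁻ t y x)

size-add : (t : Table n) → ∀ y x → ¬ T (t y x) → size t < size (add t y x)
size-add t y x new = sum-mono-<
  (λ y′ → count-mono (λ x′ → T? (t y′ x′)) (λ x′ → T? (add t y x y′ x′)) (add-⊑ t y x))
  y (count-mono-< (λ x′ → T? (t y x′)) (λ x′ → T? (add t y x y x′)) (add-⊑ t y x) x new (add-new t y x))

least : {P : Pred (Fin n) 0ℓ} → Decidable P → Maybe (Fin n)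
least {zero} P? = nothing
least {suc n} P? = if does (P? zero) then just zero else Maybe.map suc (least (λ i → P? (suc i)))

least-just : {P : Pred (Fin n) 0ℓ} (P? : Decidable P) → ∀ {x} → least P? ≡ just x → P x
least-just {suc n} P? eq with P? zero
least-just {suc n} P? refl | yes p = p
least-just {suc n} P? eq | no _ with least (λ i → P? (suc i)) in eq′
least-just {suc n} P? refl | no _ | just x = least-just (λ i → P? (suc i)) eq′

least-nothing : {P : Pred (Fin n) 0ℓ} (P? : Decidable P) → least P? ≡ nothing → ∀ x → ¬ P x
least-nothing {suc n} P? eq with P? zero
least-nothing {suc n} P? () | yes _
least-nothing {suc n} P? eq | no ¬p with least (λ i → P? (suc i)) in eq′
least-nothing {suc n} P? eq | no ¬p | nothing = λ where
  zero → ¬p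
  (suc x) → least-nothing (λ i → P? (suc i)) eq′ x

least-cong : {P Q : Pred (Fin n) 0ℓ} (P? : Decidable P) (Q? : Decidable Q) →
             (∀ x → P x ⇔ Q x) → least P? ≡ least Q?
least-cong {zero} P? Q? h = refl
least-cong {suc n} P? Q? h
  rewrite does-⇔ (h zero) (P? zero) (Q? zero)
        | least-cong (λ i → P? (suc i)) (λ i → Q? (suc i)) (λ i → h (suc i)) = refl

-- Peeling sources off the exchange graph

module Scanning {n : ℕ} (S : Subset n) where
  open Search S

  source target : Fin 2 → Fin n → Fin n → Fin n
  source 0F v u = u
  source 1F v u = v
  target 0F v u = v
  target 1F v u = u

  outsiders : List (Fin n)
  outsiders = filter (λ v → ¬? (v ∈? S)) (allFin n)

  probe : Fin 2 → Fin n → Fin 2 × Fin n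
  probe = _,_

  probes : List (Fin 2 × Fin n)
  probes = map (probe 0F) outsiders ++ map (probe 1F) outsiders

  module _ {Eligible : Table n → Fin n → Fin n → Set}
           (eligible? : ∀ t y x → Dec (Eligible t y x)) where

    scanProbe : ℕ → Fin 2 × Fin n → Table n → DProgram n (Table n)
    scanProbe zero _ t = return t
    scanProbe (suc k) (i , v) t =
      find i v (λ u → eligible? t (source i v u) (target i v u)) >>= λ where
        nothing → return t
        (just u) → scanProbe k (i , v) (add t (source i v u) (target i v u))

    scanProbes : List (Fin 2 × Fin n) → Table n → DProgram n (Table n)
    scanProbes [] t = return t
    -- Every success enlarges the table, which holds at most `n * n` pairs, so this fuel never runs
    -- out.
    scanProbes (p ∷ ps) t = scanProbe (suc (n * n)) p t >>= scanProbes ps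

    scan : Table n → DProgram n (Table n)
    scan = scanProbes probes

  module _ (O : Fin 2 → Subset n → Bool) where

    Edge : Fin n → Fin n → Set
    Edge y x = (y ∈ S × x ∉ S × Hit O 0F x y) ⊎ (y ∉ S × x ∈ S × Hit O 1F y x)

    edge? : ∀ y x → Dec (Edge y x)
    edge? y x = (y ∈? S ×-dec ¬? (x ∈? S) ×-dec T? _) ⊎-dec (¬? (y ∈? S) ×-dec x ∈? S ×-dec T? _)

    hit⇒edge : ∀ i {v u} → v ∉ S → u ∈ S → Hit O i v u → Edge (source i v u) (target i v u)
    hit⇒edge 0F v∉S u∈S hit = inj₁ (u∈S , v∉S , hit)
    hit⇒edge 1F v∉S u∈S hit = inj₂ (v∉S , u∈S , hit)

    module ScanCorrect (detects : Detects O)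
        {Eligible : Table n → Fin n → Fin n → Set}
        (eligible? : ∀ t y x → Dec (Eligible t y x))
        (new : ∀ {t y x} → Eligible t y x → ¬ T (t y x))
        (antitone : ∀ {t t′ y x} → t ⊑ t′ → Eligible t′ y x → Eligible t y x)
        (Inv : Table n → Set)
        (preserved : ∀ {t y x} → Inv t → Eligible t y x → Edge y x → Inv (add t y x)) where

      Exhausted : Table n → Fin 2 × Fin n → Set
      Exhausted t (i , v) = ∀ {u} → u ∈ S → Eligible t (source i v u) (target i v u) → ¬ Hit O i v u

      -- The reason why one pass over the probes suffices: eligibility only shrinks as the table
      -- grows, so a probe that has run dry stays dry during the later ones.
      exhausted-⊑ : ∀ {t t′} → t ⊑ t′ → ∀ {p} → Exhausted t p → Exhausted t′ p
      exhausted-⊑ t⊑t′ ex u∈S el = ex u∈S (antitone t⊑t′ el)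

      -- Every search but the last adds an entry. The cost is therefore amortised against the growth
      -- of the table, and the `suc` on the right pays for the one failed search.
      scanProbe-correct : ∀ k {i v} t → v ∉ S → n * n < k + size t → Inv t →
        Ensures O (scanProbe eligible? k (i , v) t) (λ t′ c →
          Inv t′ × t ⊑ t′ × Exhausted t′ (i , v) × c + size t * findCost ≤ suc (size t′) * findCost)
      scanProbe-correct zero t _ fuel _ = contradiction (size≤n² t) (ℕ.<⇒≱ fuel)
      scanProbe-correct (suc k) {i} {v} t v∉S fuel inv =
        ensures->>= O (find-correct O detects i v _) λ where
          nothing c (c≤ , none) → ensures (inv , id , none , ℕ.+-monoˡ-≤ (size t * findCost) (ℕ.≤-trans (ℕ.≤-reflexive (ℕ.+-identityʳ c)) c≤))
          (just u) c (c≤ , u∈S , el , hit) →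
            let y = source i v u
                x = target i v u
                bigger = size-add t y x (new el)
            in ensures-map O (λ {t′} {d} (inv′ , t⊑ , ex , d≤) → inv′ , (λ h → t⊑ (add-⊑ t y x h)) , ex , (begin
                 c + d + size t * findCost            ≡⟨ regroup c d (size t * findCost) ⟩
                 d + (c + size t * findCost)          ≤⟨ ℕ.+-monoʳ-≤ d (ℕ.+-monoˡ-≤ _ c≤) ⟩
                 d + suc (size t) * findCost          ≤⟨ ℕ.+-monoʳ-≤ d (ℕ.*-monoˡ-≤ findCost bigger) ⟩
                 d + size (add t y x) * findCost      ≤⟨ d≤ ⟩
                 suc (size t′) * findCost             ∎))
               (scanProbe-correct k (add t y x) v∉S
                 (ℕ.≤-trans (ℕ.≤-trans fuel (ℕ.≤-reflexive (sym (ℕ.+-suc k (size t))))) (ℕ.+-monoʳ-≤ k bigger))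
                 (preserved inv el (hit⇒edge i v∉S u∈S hit)))
        where
        open ℕ.≤-Reasoning
        regroup : ∀ c d s → c + d + s ≡ d + (c + s)
        regroup = solve-∀

      scanProbes-correct : ∀ ps t → All (λ p → proj₂ p ∉ S) ps → Inv t →
        Ensures O (scanProbes eligible? ps t) (λ t′ c →
          Inv t′ × t ⊑ t′ × All (Exhausted t′) ps × c + size t * findCost ≤ (length ps + size t′) * findCost)
      scanProbes-correct [] t _ inv = ensures (inv , id , [] , ℕ.≤-refl)
      scanProbes-correct (p ∷ ps) t (p∉S ∷ ps∉S) inv =
        ensures->>= O (scanProbe-correct (suc (n * n)) t p∉S (s≤s (ℕ.m≤m+n _ _)) inv) λ t₁ c (inv₁ , t⊑t₁ , ex , c≤) →
          ensures-map O (λ {t₂} {d} (inv₂ , t₁⊑t₂ , exs , d≤) →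
              inv₂ , (λ h → t₁⊑t₂ (t⊑t₁ h)) , exhausted-⊑ t₁⊑t₂ {p} ex ∷ exs , (begin
              c + d + size t * findCost                         ≡⟨ regroup c d (size t * findCost) ⟩
              d + (c + size t * findCost)                       ≤⟨ ℕ.+-monoʳ-≤ d c≤ ⟩
              d + suc (size t₁) * findCost                      ≡⟨ regroup′ d findCost (size t₁ * findCost) ⟩
              findCost + (d + size t₁ * findCost)               ≤⟨ ℕ.+-monoʳ-≤ findCost d≤ ⟩
              suc (length ps + size t₂) * findCost              ∎))
            (scanProbes-correct ps t₁ ps∉S inv₁)
        where
        open ℕ.≤-Reasoning
        regroup : ∀ c d s → c + d + s ≡ d + (c + s)
        regroup = solve-∀
        regroup′ : ∀ d f s → d + (f + s) ≡ f + (d + s)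
        regroup′ = solve-∀

      probes∉S : All (λ p → proj₂ p ∉ S) probes
      probes∉S = All.tabulate λ {p} p∈ → case ∈-++⁻ (map (probe 0F) outsiders) p∈ of λ where
          (inj₁ p∈₀) → let v , v∈ , eq = ∈-map⁻ (probe 0F) p∈₀ in subst (λ p → proj₂ p ∉ S) (sym eq) (outsider v∈)
          (inj₂ p∈₁) → let v , v∈ , eq = ∈-map⁻ (probe 1F) p∈₁ in subst (λ p → proj₂ p ∉ S) (sym eq) (outsider v∈)
        where
        outsider : ∀ {v} → v ∈ₗ outsiders → v ∉ S
        outsider v∈ = proj₂ (∈-filter⁻ (λ v → ¬? (v ∈? S)) {xs = allFin n} v∈)

      length-probes : length probes ≤ n + n
      length-probes = begin
        length probes                                                             ≡⟨ length-++ (map (probe 0F) outsiders) ⟩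
        length (map (probe 0F) outsiders) + length (map (probe 1F) outsiders)           ≡⟨ cong₂ _+_ (length-map (probe 0F) outsiders) (length-map (probe 1F) outsiders) ⟩
        length outsiders + length outsiders                                       ≤⟨ ℕ.+-mono-≤ outs outs ⟩
        n + n                                                                     ∎
        where
        open ℕ.≤-Reasoning
        outs : length outsiders ≤ n
        outs = ℕ.≤-trans (length-filter _ (allFin n)) (ℕ.≤-reflexive (length-tabulate id))

      scan-correct : ∀ t → Inv t →
        Ensures O (scan eligible? t) (λ t′ c →
          Inv t′ × t ⊑ t′ × (∀ {y x} → Edge y x → ¬ Eligible t′ y x) ×
          c + size t * findCost ≤ (n + n + size t′) * findCost)
      scan-correct t inv = ensures-map O (λ {t′} (inv′ , t⊑t′ , exs , c≤) → inv′ , t⊑t′ , done exs ,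
            ℕ.≤-trans c≤ (ℕ.*-monoˡ-≤ findCost (ℕ.+-monoˡ-≤ (size t′) length-probes)))
          (scanProbes-correct probes t probes∉S inv)
        where
        outsider : ∀ {v} → v ∉ S → v ∈ₗ outsiders
        outsider v∉S = ∈-filter⁺ (λ v → ¬? (v ∈? S)) (∈-allFin _) v∉S
        done : ∀ {t′} → All (Exhausted t′) probes → ∀ {y x} → Edge y x → ¬ Eligible t′ y x
        done exs (inj₁ (y∈S , x∉S , hit)) el =
          All.lookup exs (∈-++⁺ˡ (∈-map⁺ (probe 0F) (outsider x∉S))) y∈S el hit
        done exs (inj₂ (y∉S , x∈S , hit)) el =
          All.lookup exs (∈-++⁺ʳ (map (probe 0F) outsiders) (∈-map⁺ (probe 1F) (outsider y∉S))) x∈S el hit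

module Peeling {n : ℕ} (S : Subset n) where
  open Search S
  open Scanning S

  -- allowed: the vertices whose out-edges may be watched;
  -- capacity y: how many watched edges may leave y;
  -- quota x: up to how many watched edges into x a round searches for;
  -- threshold x: with fewer watched edges, all edges into x get listed.
  record Policy : Set₁ where
    field
      Allowed : Pred (Fin n) 0ℓ
      allowed? : Decidable Allowed
      capacity quota threshold : Fin n → ℕ

  -- Both tables take the source of an edge first. A vertex is `opened` when its in-edges get
  -- listed; from then on no further edges into it are watched.
  record State : Set where
    constructor state
    field
      watched listed : Table n
      opened dead : Subset n

  Live : Table n → Subset n → Fin n → Fin n → Set
  Live w D x y = T (w y x) × y ∉ D

  live? : ∀ w D x → Decidable (Live w D x)
  live? w D x y = T? (w y x) ×-dec ¬? (y ∈? D)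

  live : Table n → Subset n → Fin n → ℕ
  live w D x = count (live? w D x)

  module Algorithm (policy : Policy) where
    open Policy policy

    Refillable : State → Table n → Fin n → Fin n → Set
    Refillable (state _ _ opened dead) w y x =
      Allowed y × y ∉ dead × x ∉ dead × x ∉ opened × ¬ T (w y x) ×
      load w y < capacity y × live w dead x < quota x

    refillable? : ∀ st w y x → Dec (Refillable st w y x)
    refillable? (state _ _ opened dead) w y x =
      allowed? y ×-dec ¬? (y ∈? dead) ×-dec ¬? (x ∈? dead) ×-dec ¬? (x ∈? opened) ×-dec ¬? (T? (w y x))
      ×-dec load w y ℕ.<? capacity y ×-dec live w dead x ℕ.<? quota x

    Openable : State → Table n → Fin n → Set
    Openable (state _ _ opened dead) w x = x ∉ dead × x ∉ opened × live w dead x < threshold x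

    openable? : ∀ st w x → Dec (Openable st w x)
    openable? (state _ _ opened dead) w x =
      ¬? (x ∈? dead) ×-dec ¬? (x ∈? opened) ×-dec live w dead x ℕ.<? threshold x

    Listable : State → Table n → Table n → Fin n → Fin n → Set
    Listable st w l y x = Openable st w x × y ∉ State.dead st × ¬ T (w y x) × ¬ T (l y x)

    listable? : ∀ st w l y x → Dec (Listable st w l y x)
    listable? st w l y x =
      openable? st w x ×-dec ¬? (y ∈? State.dead st) ×-dec ¬? (T? (w y x)) ×-dec ¬? (T? (l y x))

    round : State → DProgram n State
    round st@(state watched listed opened dead) =
      scan (refillable? st) watched >>= λ w →
      scan (listable? st w) listed >>= λ l →
      return (state w l (opened ∪ ⟪ openable? st w ⟫) dead)

    Stalled : State → Fin n → Set
    Stalled (state w _ opened dead) x = x ∉ dead × x ∉ opened × ¬ (∃[ y ] Live w dead x y)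

    stalled? : ∀ st → Decidable (Stalled st)
    stalled? (state w _ opened dead) x = ¬? (x ∈? dead) ×-dec ¬? (x ∈? opened) ×-dec ¬? (any? (live? w dead x))

    settle : State → DProgram n State
    settle st with any? (stalled? st)
    ... | yes _ = round st
    ... | no _ = return st

    Known : State → Fin n → Fin n → Set
    Known (state w l _ dead) y x = y ∉ dead × (T (w y x) ⊎ T (l y x))

    known? : ∀ st y x → Dec (Known st y x)
    known? (state w l _ dead) y x = ¬? (y ∈? dead) ×-dec (T? (w y x) ⊎-dec T? (l y x))

    Source : State → Fin n → Set
    Source st x = x ∉ State.dead st × ¬ (∃[ y ] Known st y x)

    source? : ∀ st → Decidable (Source st)
    source? st x = ¬? (x ∈? State.dead st) ×-dec ¬? (any? λ y → known? st y x)

    kill : Fin n → State → State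
    kill x (state w l opened dead) = state w l opened (dead ∪ ⁅ x ⁆)

    peelFrom : ℕ → State → DProgram n State
    peelFrom zero st = return st
    peelFrom (suc k) st with least (source? st)
    ... | nothing = return st
    ... | just x = settle (kill x st) >>= peelFrom k

    initial : State
    initial = state (λ _ _ → false) (λ _ _ → false) ⊥ ⊥

    peel : DProgram n State
    peel = round initial >>= peelFrom n

  module _ (O : Fin 2 → Subset n → Bool) where

    -- The order in which vertices die depends on the graph only, not on the
    -- policy; this is what makes the random sample independent of it.
    TrueSource : Subset n → Fin n → Set
    TrueSource D x = x ∉ D × ¬ (∃[ y ] (y ∉ D × Edge O y x))

    trueSource? : ∀ D → Decidable (TrueSource D)
    trueSource? D x = ¬? (x ∈? D) ×-dec ¬? (any? λ y → ¬? (y ∈? D) ×-dec edge? O y x)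

    killSource : Subset n → Maybe (Fin n) → Subset n
    killSource D nothing = D
    killSource D (just x) = D ∪ ⁅ x ⁆

    killed : ℕ → Subset n
    killed zero = ⊥
    killed (suc t) = killSource (killed t) (least (trueSource? (killed t)))

    module PeelCorrect (detects : Detects O) (policy : Policy) where
      open Policy policy
      open Algorithm policy

      record WatchInv (D : Subset n) (w : Table n) : Set where
        field
          edge : ∀ {y x} → T (w y x) → Edge O y x × Allowed y
          load≤ : ∀ y → load w y ≤ capacity y
          live≤ : ∀ x → live w D x ≤ quota x
      open WatchInv

      Unlisted : Table n → Subset n → Fin n → Fin n → Set
      Unlisted w D x y = y ∉ D × Edge O y x × ¬ T (w y x)

      unlisted? : ∀ w D x → Decidable (Unlisted w D x)
      unlisted? w D x y = ¬? (y ∈? D) ×-dec edge? O y x ×-dec ¬? (T? (w y x))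

      weight : Subset n → ℕ
      weight D = sum λ y → ind (allowed? y ×-dec y ∈? D) * capacity y

      -- The weight of the live sources watched by `x` plus all dead weight. When such a source
      -- dies, its capacity moves from the first part to the second, so deaths never lower this sum;
      -- once `x` has no live watched edge, only the dead weight is left.
      potential : Table n → Subset n → Fin n → ℕ
      potential w D x = sum λ y → (ind (live? w D x y) + ind (allowed? y ×-dec y ∈? D)) * capacity y

      module _ (bound : Fin n → ℕ)
        (threshold-pos : ∀ x → 1 ≤ threshold x)
        (threshold≤quota : ∀ x → threshold x ≤ quota x)
        (n≤threshold*capacity : ∀ {y x} → Edge O y x → n ≤ threshold x * capacity y)
        -- The situation right after a refill, when `x` is about to be listed: an allowed source of
        -- an unwatched edge into `x` must have used up its capacity.
        (unlisted≤bound : ∀ t → t ≤ n → ∀ w → WatchInv (killed t) w → ∀ x → x ∉ killed t →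
          (∀ {y} → Allowed y → Unlisted w (killed t) x y → capacity y ≤ load w y) →
          live w (killed t) x < threshold x →
          count (unlisted? w (killed t) x) ≤ bound x) where

        indegree : Table n → Fin n → ℕ
        indegree l x = count (λ y → T? (l y x))

        record Inv (t : ℕ) (st : State) : Set where
          open State st
          field
            watch : WatchInv dead watched
            listed-edge : ∀ {y x} → T (listed y x) → Edge O y x
            unopened : ∀ {y x} → x ∉ opened → ¬ T (listed y x)
            listed≤ : ∀ x → indegree listed x ≤ bound x
            complete : ∀ {y x} → x ∈ opened → Edge O y x → y ∉ dead → T (watched y x) ⊎ T (listed y x)
            canonical : dead ≡ killed t
            t≤∣dead∣ : t ≤ ∣ dead ∣

        -- After ρ rounds, the last one at dead weight m.  By charged, weight n
        -- dies after that round before an unopened vertex loses all its watched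
        -- edges, so rounds are rare.
        record Settled (st : State) (ρ m : ℕ) : Set where
          open State st
          field
            awake : ∀ {x} → x ∉ dead → x ∉ opened → ∃[ y ] Live watched dead x y
            rounds : ρ * n ≤ m + n
            m≤weight : m ≤ weight dead
            charged : ∀ {x} → x ∉ dead → x ∉ opened → n + m ≤ potential watched dead x

        -- A round makes two scans with at most `n + n` failed searches each, whence `4 * n`; every
        -- other search is charged to the entry that it adds.
        Paid : State → ℕ → ℕ → Set
        Paid st ρ c = c ≤ (ρ * (4 * n) + size (State.watched st) + size (State.listed st)) * findCost

        live-add-self : ∀ w D y x → live (add w y x) D x ≤ suc (live w D x)
        live-add-self w D y x = count-insert (live? (add w y x) D x) (live? w D x) y
          λ (h , y∉D) → [ (λ h → inj₁ (h , y∉D)) , inj₂ ∘ proj₁ ]′ (add⁻ w y x h)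

        live-add-other : ∀ w D y x {x′} → x′ ≢ x → live (add w y x) D x′ ≤ live w D x′
        live-add-other w D y x {x′} x′≢x = count-mono (live? (add w y x) D x′) (live? w D x′)
          λ (h , y∉D) → [ (_, y∉D) , (λ e → contradiction (proj₂ e) x′≢x) ]′ (add⁻ w y x h)

        live-⊑ : ∀ {w w′ : Table n} D x → w ⊑ w′ → live w D x ≤ live w′ D x
        live-⊑ {w} {w′} D x w⊑ = count-mono (live? w D x) (live? w′ D x) λ (h , y∉D) → w⊑ h , y∉D

        load-⊑ : ∀ {w w′ : Table n} y → w ⊑ w′ → load w y ≤ load w′ y
        load-⊑ {w} {w′} y w⊑ = count-mono (λ x → T? (w y x)) (λ x → T? (w′ y x)) w⊑

        watch-add : ∀ st {w y x} → WatchInv (State.dead st) w → Refillable st w y x → Edge O y x →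
                    WatchInv (State.dead st) (add w y x)
        watch-add st {w} {y} {x} inv (al , _ , _ , _ , _ , ld< , lv<) e = record
          { edge = λ h → case add⁻ w y x h of λ where
              (inj₁ h) → edge inv h
              (inj₂ (refl , refl)) → e , al
          ; load≤ = λ y′ → case y′ Fin.≟ y of λ where
              (yes refl) → ℕ.≤-trans (load-add w y x y) ld<
              (no y′≢y) → ℕ.≤-trans (load-add-other w y x y′≢y) (load≤ inv y′)
          ; live≤ = λ x′ → case x′ Fin.≟ x of λ where
              (yes refl) → ℕ.≤-trans (live-add-self w _ y x) lv<
              (no x′≢x) → ℕ.≤-trans (live-add-other w _ y x x′≢x) (live≤ inv x′)
          }

        module Round (t : ℕ) (t≤n : t ≤ n) (st : State) (inv : Inv t st) where
          open State st
          open Inv inv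

          Listing : Table n → Table n → Set
          Listing w l = ∀ {y x} → T (l y x) → T (listed y x) ⊎ (Openable st w x × Unlisted w dead x y)

          refill-new : ∀ {w y x} → Refillable st w y x → ¬ T (w y x)
          refill-new (_ , _ , _ , _ , new , _) = new

          refill-antitone : ∀ {w w′ y x} → w ⊑ w′ → Refillable st w′ y x → Refillable st w y x
          refill-antitone {w} {w′} {y} {x} w⊑ (al , y∉ , x∉ , x∉o , new , ld , lv) =
            al , y∉ , x∉ , x∉o , (λ h → new (w⊑ h)) ,
            ℕ.≤-<-trans (load-⊑ {w} {w′} y w⊑) ld , ℕ.≤-<-trans (live-⊑ {w} {w′} dead x w⊑) lv

          list-new : ∀ {w l y x} → Listable st w l y x → ¬ T (l y x)
          list-new (_ , _ , _ , new) = new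

          list-antitone : ∀ {w l l′ y x} → l ⊑ l′ → Listable st w l′ y x → Listable st w l y x
          list-antitone l⊑ (op , y∉ , h , new) = op , y∉ , h , (λ h′ → new (l⊑ h′))

          list-preserved : ∀ {w l y x} → Listing w l → Listable st w l y x → Edge O y x → Listing w (add l y x)
          list-preserved {w} {l} {y} {x} lis (op , y∉ , h , _) e h′ = case add⁻ l y x h′ of λ where
            (inj₁ h) → lis h
            (inj₂ (refl , refl)) → inj₂ (op , y∉ , e , h)

          module Refill = ScanCorrect O detects (refillable? st)
            (λ {w} {y} {x} → refill-new {w} {y} {x}) (λ {w} {w′} {y} {x} → refill-antitone {w} {w′} {y} {x})
            (WatchInv dead) (λ {w} {y} {x} → watch-add st {w} {y} {x})

          module Enumerate (w : Table n) = ScanCorrect O detects (listable? st w)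
            (λ {l} {y} {x} → list-new {w} {l} {y} {x}) (λ {l} {l′} {y} {x} → list-antitone {w} {l} {l′} {y} {x})
            (Listing w) (λ {l} {y} {x} → list-preserved {w} {l} {y} {x})

          module Result (w l : Table n) (watch′ : WatchInv dead w) (w⊑ : watched ⊑ w) (l⊑ : listed ⊑ l)
              (full : ∀ {y x} → Edge O y x → ¬ Refillable st w y x)
              (listing : Listing w l)
              (all-listed : ∀ {y x} → Edge O y x → ¬ Listable st w l y x) where

            st′ : State
            st′ = state w l (opened ∪ ⟪ openable? st w ⟫) dead

            opened⁺ : ∀ {x} → Openable st w x → x ∈ opened ∪ ⟪ openable? st w ⟫
            opened⁺ op = q⊆p∪q opened _ (∈⟪⟫⁺ (openable? st w) op)

            opened⁻ : ∀ {x} → x ∈ opened ∪ ⟪ openable? st w ⟫ → x ∈ opened ⊎ Openable st w x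
            opened⁻ x∈ = [ inj₁ , inj₂ ∘ ∈⟪⟫⁻ (openable? st w) ]′ (x∈p∪q⁻ opened _ x∈)

            new≤ : ∀ {x} → Openable st w x → count (unlisted? w dead x) ≤ bound x
            new≤ {x} (x∉ , x∉o , few) = subst (λ D → count (unlisted? w D x) ≤ bound x) (sym canonical)
              (unlisted≤bound t t≤n w (subst (λ D → WatchInv D w) canonical watch′) x (x∉ ∘ subst (x ∈_) (sym canonical))
                (λ {y} al un → let y∉ , e , new = subst (λ D → Unlisted w D x y) (sym canonical) un in
                  -- Below its capacity `y` would still be refillable, because `x` is below its
                  -- threshold and hence below its quota.
                  ℕ.≮⇒≥ λ ld → full e (al , y∉ , x∉ , x∉o , new , ld , ℕ.<-≤-trans few (threshold≤quota x)))
                (subst (λ D → live w D x < threshold x) canonical few))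

            inv′ : Inv t st′
            inv′ = record
              { watch = watch′
              ; listed-edge = λ h → case listing h of λ where
                  (inj₁ h) → listed-edge h
                  (inj₂ (_ , _ , e , _)) → e
              ; unopened = λ x∉ h → case listing h of λ where
                  (inj₁ h) → unopened (x∉ ∘ p⊆p∪q _) h
                  (inj₂ (op , _)) → x∉ (opened⁺ op)
              -- Listed edges into `x` all come from the one round that opens `x`, so the bound for
              -- that round holds for good.
              ; listed≤ = λ x → case x ∈? opened of λ where
                  (yes x∈) → ℕ.≤-trans (count-mono (λ y → T? (l y x)) (λ y → T? (listed y x)) λ h → case listing h of λ where
                    (inj₁ h) → h
                    (inj₂ ((_ , x∉ , _) , _)) → contradiction x∈ x∉) (listed≤ x)
                  (no x∉o) → case openable? st w x of λ where
                    (yes op) → ℕ.≤-trans (count-mono (λ y → T? (l y x)) (unlisted? w dead x) λ h → case listing h of λ where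
                      (inj₁ h) → contradiction h (unopened x∉o)
                      (inj₂ (_ , un)) → un) (new≤ op)
                    (no ¬op) → ℕ.≤-trans (ℕ.≤-reflexive (count-none (λ y → T? (l y x)) λ y h → case listing h of λ where
                      (inj₁ h) → unopened x∉o h
                      (inj₂ (op , _)) → ¬op op)) z≤n
              ; complete = λ x∈ e y∉ → case opened⁻ x∈ of λ where
                  (inj₁ x∈) → [ inj₁ ∘ w⊑ , inj₂ ∘ l⊑ ]′ (complete x∈ e y∉)
                  (inj₂ op) → known op e y∉
              ; canonical = canonical
              ; t≤∣dead∣ = t≤∣dead∣
              }
              where
              known : ∀ {y x} → Openable st w x → Edge O y x → y ∉ dead → T (w y x) ⊎ T (l y x)
              known {y} {x} op e y∉ with T? (w y x) | T? (l y x)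
              ... | yes h | _ = inj₁ h
              ... | no _ | yes h = inj₂ h
              ... | no ¬w | no ¬l = contradiction (op , y∉ , ¬w , ¬l) (all-listed e)

            enough : ∀ {x} → x ∉ dead → x ∉ opened ∪ ⟪ openable? st w ⟫ → threshold x ≤ live w dead x
            enough x∉ x∉o = ℕ.≮⇒≥ λ few → x∉o (opened⁺ (x∉ , x∉o ∘ p⊆p∪q _ , few))

            -- Each of the at least `threshold x` live watched edges into `x` comes from a `y` with
            -- `n ≤ threshold x * capacity y`. Summing over them gives `threshold x` times the
            -- claim.
            weighted-live : ∀ {x} → threshold x ≤ live w dead x →
                            n ≤ sum (λ y → ind (live? w dead x y) * capacity y)
            weighted-live {x} th≤ = ℕ.*-cancelˡ-≤ (threshold x) ⦃ >-nonZero (threshold-pos x) ⦄ (begin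
              threshold x * n                                                      ≤⟨ ℕ.*-monoˡ-≤ n th≤ ⟩
              live w dead x * n                                                    ≡⟨ *-distribʳ-sum n (λ y → ind (live? w dead x y)) ⟩
              sum (λ y → ind (live? w dead x y) * n)                               ≤⟨ sum-mono (λ y → pointwise y (live? w dead x y)) ⟩
              sum (λ y → threshold x * (ind (live? w dead x y) * capacity y))      ≡⟨ *-distribˡ-sum (threshold x) (λ y → ind (live? w dead x y) * capacity y) ⟨
              threshold x * sum (λ y → ind (live? w dead x y) * capacity y)        ∎)
              where
              open ℕ.≤-Reasoning
              pointwise : ∀ y (l? : Dec (Live w dead x y)) → ind l? * n ≤ threshold x * (ind l? * capacity y)
              pointwise y (no _) = z≤n
              pointwise y (yes (h , _)) rewrite ℕ.+-identityʳ n | ℕ.+-identityʳ (capacity y) =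
                n≤threshold*capacity (proj₁ (edge watch′ h))

            settled : ∀ ρ → ρ * n ≤ weight dead → Settled st′ (suc ρ) (weight dead)
            settled ρ ρ≤ = record
              { awake = λ x∉ x∉o → nonempty (ℕ.≤-trans (threshold-pos _) (enough x∉ x∉o))
              ; rounds = ℕ.≤-trans (ℕ.≤-reflexive (ℕ.+-comm n (ρ * n))) (ℕ.+-monoˡ-≤ n ρ≤)
              ; m≤weight = ℕ.≤-refl
              ; charged = λ {x} x∉ x∉o → begin
                  n + weight dead  ≤⟨ ℕ.+-monoˡ-≤ (weight dead) (weighted-live (enough x∉ x∉o)) ⟩
                  sum (λ y → ind (live? w dead x y) * capacity y) + weight dead
                    ≡⟨ ∑-distrib-+ (λ y → ind (live? w dead x y) * capacity y) (λ y → ind (allowed? y ×-dec y ∈? dead) * capacity y) ⟨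
                  sum (λ y → ind (live? w dead x y) * capacity y + ind (allowed? y ×-dec y ∈? dead) * capacity y)
                    ≡⟨ sum-cong-≗ (λ y → ℕ.*-distribʳ-+ (capacity y) (ind (live? w dead x y)) _) ⟨
                  potential w dead x ∎
              }
              where
              open ℕ.≤-Reasoning
              nonempty : ∀ {x} → 1 ≤ live w dead x → ∃[ y ] Live w dead x y
              nonempty {x} 1≤ = case any? (live? w dead x) of λ where
                (yes some) → some
                (no none) → contradiction 1≤ (ℕ.<⇒≱ (ℕ.≤-reflexive (cong suc (count-none (live? w dead x) λ y lv → none (y , lv)))))

          -- The premise `ρ * n ≤ weight dead` says that weight `n` has died for each of the `ρ`
          -- earlier rounds. It restores the bound `rounds` after one more round.
          round-correct : ∀ ρ c → ρ * n ≤ weight dead → Paid st ρ c →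
            Ensures O (round st) (λ st′ d → Inv t st′ × State.dead st′ ≡ dead ×
              Settled st′ (suc ρ) (weight dead) × Paid st′ (suc ρ) (c + d))
          round-correct ρ c ρ≤ paid =
            ensures->>= O (Refill.scan-correct watched watch) λ w d₁ (watch′ , w⊑ , full , d₁≤) →
            ensures->>= O (Enumerate.scan-correct w listed inj₁) λ l d₂ (listing , l⊑ , all-listed , d₂≤) →
            let module R = Result w l watch′ w⊑ l⊑ full listing all-listed in
            ensures (R.inv′ , refl , R.settled ρ ρ≤ , pay w l d₁ d₂ d₁≤ d₂≤)
            where
            open ℕ.≤-Reasoning
            F = findCost
            pay : ∀ w l d₁ d₂ → d₁ + size watched * F ≤ (n + n + size w) * F → d₂ + size listed * F ≤ (n + n + size l) * F →
                  c + (d₁ + (d₂ + 0)) ≤ (suc ρ * (4 * n) + size w + size l) * F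
            pay w l d₁ d₂ d₁≤ d₂≤ = begin
              c + (d₁ + (d₂ + 0))                                                         ≤⟨ ℕ.+-monoˡ-≤ _ paid ⟩
              (ρ * (4 * n) + size watched + size listed) * F + (d₁ + (d₂ + 0))            ≡⟨ regroup ρ n F (size watched) (size listed) d₁ d₂ ⟩
              ρ * (4 * n) * F + (d₁ + size watched * F) + (d₂ + size listed * F)          ≤⟨ ℕ.+-mono-≤ (ℕ.+-monoʳ-≤ (ρ * (4 * n) * F) d₁≤) d₂≤ ⟩
              ρ * (4 * n) * F + (n + n + size w) * F + (n + n + size l) * F               ≡⟨ regroup′ ρ n F (size w) (size l) ⟩
              (suc ρ * (4 * n) + size w + size l) * F                                     ∎
              where
              regroup : ∀ ρ n F a b d₁ d₂ → (ρ * (4 * n) + a + b) * F + (d₁ + (d₂ + 0)) ≡ ρ * (4 * n) * F + (d₁ + a * F) + (d₂ + b * F)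
              regroup = solve-∀
              regroup′ : ∀ ρ n F a b → ρ * (4 * n) * F + (n + n + a) * F + (n + n + b) * F ≡ (suc ρ * (4 * n) + a + b) * F
              regroup′ = solve-∀

        module Kill (t : ℕ) (st : State) (inv : Inv t st) (ρ m : ℕ) (set : Settled st ρ m) where
          open State st
          open Inv inv
          open Settled set

          known⇒edge : ∀ {y x} → Known st y x → y ∉ dead × Edge O y x
          known⇒edge (y∉ , inj₁ h) = y∉ , proj₁ (edge watch h)
          known⇒edge (y∉ , inj₂ h) = y∉ , listed-edge h

          -- Partial knowledge of the graph still determines the sources exactly: at an opened
          -- vertex every live in-edge is known, and an unopened live vertex is certified not to be
          -- a source by the watched edge that `awake` provides.
          source⇔ : ∀ x → Source st x ⇔ TrueSource dead x
          source⇔ x = mk⇔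
            (λ (x∉ , none) → x∉ , λ (y , y∉ , e) → case x ∈? opened of λ where
              (yes x∈o) → none (y , y∉ , complete x∈o e y∉)
              (no x∉o) → let y , h , y∉ = awake x∉ x∉o in none (y , y∉ , inj₁ h))
            (λ (x∉ , none) → x∉ , λ (y , k) → none (y , known⇒edge k))

          module _ {z : Fin n} (eq : least (source? st) ≡ just z) where

            dead′ : Subset n
            dead′ = dead ∪ ⁅ z ⁆

            z∉dead : z ∉ dead
            z∉dead = proj₁ (least-just (source? st) eq)

            alive : ∀ {y} → y ∉ dead′ → y ∉ dead
            alive y∉ = y∉ ∘ p⊆p∪q _

            kill-inv : Inv (suc t) (kill z st)
            kill-inv = record
              { watch = record
                { edge = edge watch
                ; load≤ = load≤ watch
                ; live≤ = λ x → ℕ.≤-trans (count-mono (live? watched dead′ x) (live? watched dead x) λ (h , y∉) → h , alive y∉) (live≤ watch x) }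
              ; listed-edge = listed-edge
              ; unopened = unopened
              ; listed≤ = listed≤
              ; complete = λ x∈ e y∉ → complete x∈ e (alive y∉)
              ; canonical = trans (cong (killSource dead) (trans (sym eq) (least-cong (source? st) (trueSource? dead) source⇔)))
                  (cong (λ D → killSource D (least (trueSource? D))) canonical)
              ; t≤∣dead∣ = ℕ.≤-trans (s≤s t≤∣dead∣) (p⊂q⇒∣p∣<∣q∣ (p⊆p∪q _ , z , q⊆p∪q dead _ (x∈⁅x⁆ z) , z∉dead))
              }

            weight-grows : weight dead ≤ weight dead′
            weight-grows = sum-mono λ y → ℕ.*-monoˡ-≤ (capacity y)
              (ind-mono (allowed? y ×-dec y ∈? dead) (allowed? y ×-dec y ∈? dead′) λ (al , y∈) → al , p⊆p∪q _ y∈)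

            potential-grows : ∀ x → potential watched dead x ≤ potential watched dead′ x
            potential-grows x = sum-mono λ y → ℕ.*-monoˡ-≤ (capacity y) (case y ∈? dead of λ where
                (yes y∈) → ℕ.+-mono-≤
                  (ℕ.≤-trans (ℕ.≤-reflexive (ind-no (live? watched dead x y) λ (_ , y∉) → y∉ y∈)) z≤n)
                  (ind-mono (allowed? y ×-dec y ∈? dead) (allowed? y ×-dec y ∈? dead′) λ (al , y∈) → al , p⊆p∪q _ y∈)
                (no y∉) → ℕ.≤-trans
                  (ℕ.≤-trans (ℕ.≤-reflexive (trans (cong (ind (live? watched dead x y) +_) (ind-no (allowed? y ×-dec y ∈? dead) (y∉ ∘ proj₂))) (ℕ.+-identityʳ _)))
                    (either y (T? (watched y x)) (y ∈? dead′)))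
                  ℕ.≤-refl)
              where
              either : ∀ y → Dec (T (watched y x)) → Dec (y ∈ dead′) →
                ind (live? watched dead x y) ≤ ind (live? watched dead′ x y) + ind (allowed? y ×-dec y ∈? dead′)
              either y (no ¬h) _ = ℕ.≤-trans (ℕ.≤-reflexive (ind-no (live? watched dead x y) (¬h ∘ proj₁))) z≤n
              either y (yes h) (yes y∈) = ℕ.≤-trans (ind≤1 (live? watched dead x y)) (ℕ.≤-trans
                (ℕ.≤-reflexive (sym (ind-yes (allowed? y ×-dec y ∈? dead′) (proj₂ (edge watch h) , y∈)))) (ℕ.m≤n+m _ _))
              either y (yes h) (no y∉) = ℕ.≤-trans (ind≤1 (live? watched dead x y)) (ℕ.≤-trans
                (ℕ.≤-reflexive (sym (ind-yes (live? watched dead′ x y) (h , y∉)))) (ℕ.m≤m+n _ _))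

            -- The potential of `x` was at least `n + m` at the last round and has not dropped, but
            -- now it consists of dead weight alone. So weight `n` has died since, which pays for a
            -- new round.
            stalled⇒due : ∀ {x} → Stalled (kill z st) x → ρ * n ≤ weight dead′
            stalled⇒due {x} (x∉ , x∉o , none) = begin
              ρ * n                     ≤⟨ rounds ⟩
              m + n                     ≡⟨ ℕ.+-comm m n ⟩
              n + m                     ≤⟨ charged (alive x∉) x∉o ⟩
              potential watched dead x  ≤⟨ potential-grows x ⟩
              potential watched dead′ x ≡⟨ sum-cong-≗ (λ y → cong (λ k → (k + ind (allowed? y ×-dec y ∈? dead′)) * capacity y)
                                             (ind-no (live? watched dead′ x y) λ lv → none (y , lv))) ⟩
              weight dead′              ∎
              where open ℕ.≤-Reasoning

            settle-correct : ∀ c → suc t ≤ n → Paid st ρ c →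
              Ensures O (settle (kill z st)) (λ st′ d → Inv (suc t) st′ ×
                ∃₂ λ ρ′ m′ → Settled st′ ρ′ m′ × Paid st′ ρ′ (c + d))
            settle-correct c t<n paid with any? (stalled? (kill z st))
            ... | yes (x , stalled) = ensures-map O (λ (inv′ , _ , set′ , paid′) → inv′ , _ , _ , set′ , paid′)
              (Round.round-correct (suc t) t<n (kill z st) kill-inv ρ c (stalled⇒due stalled) paid)
            ... | no none = ensures (kill-inv , ρ , m , record
                { awake = λ {x} x∉ x∉o → case any? (live? watched dead′ x) of λ where
                    (yes some) → some
                    (no ¬some) → contradiction (x , x∉ , x∉o , ¬some) none
                ; rounds = rounds
                ; m≤weight = ℕ.≤-trans m≤weight weight-grows
                ; charged = λ {x} x∉ x∉o → ℕ.≤-trans (charged (alive x∉) x∉o) (potential-grows x)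
                } , ℕ.≤-trans (ℕ.≤-reflexive (ℕ.+-identityʳ c)) paid)

        -- No source is left, so following edges backwards runs into a cycle
        -- unless everything is dead.
        Stuck : State → Set
        Stuck st = ∀ {x} → x ∉ State.dead st → ∃[ y ] Known st y x

        peelFrom-correct : ∀ k t st ρ m c → k + t ≡ n → Inv t st → Settled st ρ m → Paid st ρ c →
          Ensures O (peelFrom k st) (λ st′ d → Stuck st′ × ∃[ t′ ] Inv t′ st′ ×
            ∃₂ λ ρ′ m′ → Settled st′ ρ′ m′ × Paid st′ ρ′ (c + d))
        -- Each step kills a new vertex, so when the fuel is used up all `n` vertices are dead and
        -- being stuck is vacuous.
        peelFrom-correct zero t st ρ m c refl inv set paid = ensures
          ((λ {x} x∉ → contradiction (subst (x ∈_) (sym all-dead) ∈⊤) x∉) , t , inv , ρ , m , set , ℕ.≤-trans (ℕ.≤-reflexive (ℕ.+-identityʳ c)) paid)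
          where
          all-dead : State.dead st ≡ _
          all-dead = ∣p∣≡n⇒p≡⊤ (ℕ.≤-antisym (∣p∣≤n (State.dead st)) (Inv.t≤∣dead∣ inv))
        peelFrom-correct (suc k) t st ρ m c k+t inv set paid with least (source? st) in eq
        ... | nothing = ensures ((λ {x} x∉ → case any? (λ y → known? st y x) of λ where
                (yes some) → some
                (no none) → contradiction (x∉ , none) (least-nothing (source? st) eq x)) ,
              t , inv , ρ , m , set , ℕ.≤-trans (ℕ.≤-reflexive (ℕ.+-identityʳ c)) paid)
        ... | just x = ensures->>= O
              (Kill.settle-correct t st inv ρ m set eq c (ℕ.≤-trans (s≤s (ℕ.m≤n+m t k)) (ℕ.≤-reflexive k+t)) paid)
              λ st′ d (inv′ , ρ′ , m′ , set′ , paid′) →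
                ensures-map O (λ {st″} {d′} (stuck , t″ , inv″ , ρ″ , m″ , set″ , paid″) →
                    stuck , t″ , inv″ , ρ″ , m″ , set″ , subst (Paid st″ ρ″) (ℕ.+-assoc c d d′) paid″)
                  (peelFrom-correct k (suc t) st′ ρ′ m′ (c + d) (trans (ℕ.+-suc k t) k+t) inv′ set′ paid′)

        total : ℕ
        total = sum λ y → ind (allowed? y) * capacity y

        -- The rounds contribute `4 * (total + n)`, the watched edges `total` and the listed ones
        -- `sum bound`.
        peelCost : ℕ
        peelCost = (4 * n + 5 * total + sum bound) * findCost

        initial-inv : Inv 0 initial
        initial-inv = record
          { watch = record
            { edge = λ ()
            ; load≤ = λ y → ℕ.≤-trans (ℕ.≤-reflexive (count-none {n} (λ x → T? false) λ _ ())) z≤n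
            ; live≤ = λ x → ℕ.≤-trans (ℕ.≤-reflexive (count-none (live? (λ _ _ → false) ⊥ x) λ _ ())) z≤n }
          ; listed-edge = λ ()
          ; unopened = λ _ ()
          ; listed≤ = λ x → ℕ.≤-trans (ℕ.≤-reflexive (count-none {n} (λ y → T? false) λ _ ())) z≤n
          ; complete = λ x∈ → contradiction x∈ ∉⊥
          ; canonical = refl
          ; t≤∣dead∣ = z≤n
          }

        paid⇒peelCost : ∀ {st t ρ m c} → Inv t st → Settled st ρ m → Paid st ρ c → c ≤ peelCost
        paid⇒peelCost {st} {ρ = ρ} {m} {c} inv set paid = begin
          c                                                                 ≤⟨ paid ⟩
          (ρ * (4 * n) + size watched + size listed) * findCost             ≤⟨ ℕ.*-monoˡ-≤ findCost (ℕ.+-mono-≤ (ℕ.+-mono-≤ rounds≤ watched≤) listed-size) ⟩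
          (4 * (total + n) + total + sum bound) * findCost                  ≡⟨ cong (λ k → (k + sum bound) * findCost) (regroup total n) ⟩
          peelCost                                                          ∎
          where
          open ℕ.≤-Reasoning
          open State st
          open Inv inv
          open Settled set
          regroup : ∀ a n → 4 * (a + n) + a ≡ 4 * n + 5 * a
          regroup = solve-∀
          swap-* : ∀ ρ n → ρ * (4 * n) ≡ 4 * (ρ * n)
          swap-* = solve-∀
          weight≤ : weight dead ≤ total
          weight≤ = sum-mono λ y → ℕ.*-monoˡ-≤ (capacity y) (ind-mono (allowed? y ×-dec y ∈? dead) (allowed? y) proj₁)
          rounds≤ : ρ * (4 * n) ≤ 4 * (total + n)
          rounds≤ = ℕ.≤-trans (ℕ.≤-reflexive (swap-* ρ n)) (ℕ.*-monoʳ-≤ 4 (ℕ.≤-trans rounds (ℕ.+-monoˡ-≤ n (ℕ.≤-trans m≤weight weight≤))))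
          watched≤ : size watched ≤ total
          watched≤ = sum-mono λ y → row y (allowed? y)
            where
            row : ∀ y (a? : Dec (Allowed y)) → load watched y ≤ ind a? * capacity y
            row y (yes _) = ℕ.≤-trans (load≤ watch y) (ℕ.≤-reflexive (sym (ℕ.+-identityʳ _)))
            row y (no ¬al) = ℕ.≤-reflexive (count-none (λ x → T? (watched y x)) λ x h → ¬al (proj₂ (edge watch h)))
          listed-size : size listed ≤ sum bound
          listed-size = ℕ.≤-trans (ℕ.≤-reflexive (∑-comm (λ y x → ind (T? (listed y x))))) (sum-mono listed≤)

        peel-correct : Ensures O peel (λ st c → (∃[ t ] State.dead st ≡ killed t) × Stuck st ×
          (∀ {y x} → Known st y x → Edge O y x) × c ≤ peelCost)
        peel-correct = ensures->>= O (Round.round-correct 0 z≤n initial initial-inv 0 0 z≤n z≤n)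
          λ st d (inv , _ , set , paid) → ensures-map O
            (λ (stuck , t , inv′ , ρ , m , set′ , paid′) →
              (t , Inv.canonical inv′) , stuck , proj₂ ∘ Kill.known⇒edge t _ inv′ ρ m set′ , paid⇒peelCost inv′ set′ paid′)
            (peelFrom-correct n 0 st 1 _ d (ℕ.+-identityʳ n) inv set paid)

-- Closed walks

Unique-⊆ : {xs ys : List A} → xs ⊆ₗ ys → Unique ys → Unique xs
Unique-⊆ [] [] = []
Unique-⊆ (y ∷ʳ τ) (_ ∷ u) = Unique-⊆ τ u
Unique-⊆ (refl ∷ τ) (y∉ ∷ u) = All-resp-⊆ τ y∉ ∷ Unique-⊆ τ u

Unique-↭ : {xs ys : List A} → xs ↭ ys → Unique xs → Unique ys
Unique-↭ p = Permutationₛ.Unique-resp-↭ (setoid _) (↭⇒↭ₛ p)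

lookup-injective : {xs : List A} → Unique xs → ∀ {i j} → lookup xs i ≡ lookup xs j → i ≡ j
lookup-injective (_ ∷ _) {zero} {zero} _ = refl
lookup-injective (x∉ ∷ _) {zero} {suc j} eq = contradiction eq (All.lookup x∉ (∈-lookup j))
lookup-injective (x∉ ∷ _) {suc i} {zero} eq = contradiction (sym eq) (All.lookup x∉ (∈-lookup i))
lookup-injective (_ ∷ u) {suc i} {suc j} eq = cong suc (lookup-injective u eq)

Unique⇒length≤ : {xs : List (Fin n)} → Unique xs → length xs ≤ n
Unique⇒length≤ u = injective⇒≤ (lookup-injective u)

-- The pair (v , q) stands for a vertex v outside S followed by q in S; the
-- walk p , (v₁ , q₁) , … , (vₖ , qₖ) visits p, v₁, q₁, …, vₖ, qₖ in this order.
Hops : ℕ → Set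
Hops n = List (Fin n × Fin n)

firsts seconds : Hops n → List (Fin n)
firsts = map proj₁
seconds = map proj₂

data Walk (Step : Fin n → Fin n → Fin n → Set) : Fin n → Hops n → Fin n → Set where
  [] : ∀ {p} → Walk Step p [] p
  _∷_ : ∀ {p v q es e} → Step p v q → Walk Step q es e → Walk Step p ((v , q) ∷ es) e

private variable Step Step′ : Fin n → Fin n → Fin n → Set

_++ʷ_ : ∀ {p m e} {es fs : Hops n} → Walk Step p es m → Walk Step m fs e → Walk Step p (es ++ fs) e
[] ++ʷ w′ = w′
(r ∷ w) ++ʷ w′ = r ∷ (w ++ʷ w′)

mapʷ : (∀ {p v q} → Step p v q → Step′ p v q) → ∀ {p e} {es : Hops n} → Walk Step p es e → Walk Step′ p es e
mapʷ f [] = []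
mapʷ f (r ∷ w) = f r ∷ mapʷ f w

upto after : Fin n → Hops n → Hops n
upto u [] = []
upto u ((v , q) ∷ es) with u Fin.≟ q
... | yes _ = (v , q) ∷ []
... | no _ = (v , q) ∷ upto u es
after u [] = []
after u ((v , q) ∷ es) with u Fin.≟ q
... | yes _ = es
... | no _ = after u es

walk-upto : ∀ {u p e} {es : Hops n} → u ∈ₗ seconds es → Walk Step p es e → Walk Step p (upto u es) u
walk-upto {u = u} {es = (v , q) ∷ es} u∈ (r ∷ w) with u Fin.≟ q
walk-upto u∈ (r ∷ w) | yes refl = r ∷ []
walk-upto (here eq) (r ∷ w) | no u≢q = contradiction eq u≢q
walk-upto (there u∈) (r ∷ w) | no _ = r ∷ walk-upto u∈ w

walk-after : ∀ {u p e} {es : Hops n} → u ∈ₗ seconds es → Walk Step p es e → Walk Step u (after u es) e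
walk-after {u = u} {es = (v , q) ∷ es} u∈ (r ∷ w) with u Fin.≟ q
walk-after u∈ (r ∷ w) | yes refl = w
walk-after (here eq) (r ∷ w) | no u≢q = contradiction eq u≢q
walk-after (there u∈) (r ∷ w) | no _ = walk-after u∈ w

upto-⊆ : (u : Fin n) (es : Hops n) → seconds (upto u es) ⊆ₗ seconds es
upto-⊆ u [] = []
upto-⊆ u ((v , q) ∷ es) with u Fin.≟ q
... | yes _ = refl ∷ minimum _
... | no _ = refl ∷ upto-⊆ u es

after-⊆ : {u : Fin n} (es : Hops n) → u ∈ₗ seconds es → u ∷ seconds (after u es) ⊆ₗ seconds es
after-⊆ {u = u} ((v , q) ∷ es) u∈ with u Fin.≟ q
after-⊆ ((v , q) ∷ es) u∈ | yes refl = ⊆-refl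
after-⊆ ((v , q) ∷ es) (here eq) | no u≢q = contradiction eq u≢q
after-⊆ ((v , q) ∷ es) (there u∈) | no _ = q ∷ʳ after-⊆ es u∈

length-after : {u : Fin n} (es : Hops n) → u ∈ₗ seconds es → length (after u es) < length es
length-after {u = u} ((v , q) ∷ es) u∈ with u Fin.≟ q
length-after ((v , q) ∷ es) u∈ | yes refl = ℕ.≤-refl
length-after ((v , q) ∷ es) (here eq) | no u≢q = contradiction eq u≢q
length-after ((v , q) ∷ es) (there u∈) | no _ = ℕ.m≤n⇒m≤1+n (length-after es u∈)

length-upto : (u : Fin n) (es : Hops n) → length (upto u es) ≤ length es
length-upto u [] = z≤n
length-upto u ((v , q) ∷ es) with u Fin.≟ q
... | yes _ = s≤s z≤n
... | no _ = s≤s (length-upto u es)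

upto-nonempty : {u : Fin n} (es : Hops n) → u ∈ₗ seconds es → 1 ≤ length (upto u es)
upto-nonempty {u = u} ((v , q) ∷ es) u∈ with u Fin.≟ q
... | yes _ = s≤s z≤n
... | no _ = s≤s z≤n

length-upto-< : ∀ {u p e} {es : Hops n} → Walk Step p es e → u ∈ₗ seconds es → u ≢ e → length (upto u es) < length es
length-upto-< {u = u} {es = (v , q) ∷ es} (r ∷ w) u∈ u≢e with u Fin.≟ q
length-upto-< (r ∷ []) u∈ u≢e | yes refl = contradiction refl u≢e
length-upto-< (r ∷ (_ ∷ _)) u∈ u≢e | yes refl = s≤s (s≤s z≤n)
length-upto-< (r ∷ w) (here eq) u≢e | no u≢q = contradiction eq u≢q
length-upto-< (r ∷ w) (there u∈) u≢e | no u≢q = s≤s (length-upto-< w u∈ u≢e)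

record Cycle (Step : Fin n → Fin n → Fin n → Set) : Set where
  constructor cycle
  field
    {start} : Fin n
    hops : Hops n
    walk : Walk Step start hops start
    unique : Unique (seconds hops)
    nonempty : 1 ≤ length hops

module _ {A : Pred (Fin n) 0ℓ} (back : ∀ q → A q → ∃₂ λ v p → A p × Step p v q) where

  -- The walk grows at its front until `p` recurs, which the pigeonhole principle forces within
  -- `n + 1` steps; the part up to that recurrence is closed. Only elements of `S` are kept distinct
  -- here; for the vertices outside `S` distinctness will follow from the absence of chords.
  closeWalk : ∀ k {p e es} → Walk Step p es e → Unique (seconds es) → A p → n < k + length (seconds es) → Cycle Step
  closeWalk zero w u ap n< = contradiction (Unique⇒length≤ u) (ℕ.<⇒≱ n<)
  closeWalk (suc k) {p} {es = es} w u ap n< with p ∈ₗ? seconds es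
  ... | yes p∈ = cycle (upto p es) (walk-upto p∈ w) (Unique-⊆ (upto-⊆ p es) u) (upto-nonempty es p∈)
  ... | no p∉ = let v , p′ , ap′ , r = back p ap in
    closeWalk k (r ∷ w) (All.¬Any⇒All¬ _ p∉ ∷ u) ap′ (ℕ.≤-trans n< (ℕ.≤-reflexive (sym (ℕ.+-suc k _))))

  findCycle : ∀ {q} → A q → Cycle Step
  findCycle aq = closeWalk (suc n) [] [] aq (s≤s (ℕ.m≤m+n n _))

-- Removing chords

module Cleaning {n : ℕ} (S : Subset n) where
  open Search S

  clean : ℕ → Fin n → Hops n → Hops n → DProgram n (Hops n)
  clean zero p todo done = return done
  clean (suc k) p [] done = return done
  clean (suc k) p todo@((v , q) ∷ es) done =
    find 1F v (λ u → u ∈ₗ? seconds (es ++ done) ×-dec ¬? (u Fin.≟ q)) >>= λ where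
      (just u) →
        if does (u ∈ₗ? seconds es)
        then clean k p ((v , u) ∷ after u es) done
        else clean k p ((v , u) ∷ []) (after u done)
      nothing → find 0F v (λ u → u ∈ₗ? seconds (todo ++ done) ×-dec ¬? (u Fin.≟ p)) >>= λ where
        (just u) →
          if does (u ∈ₗ? seconds done)
          then clean k u todo (upto u done)
          else clean k u (upto u todo) []
        nothing → clean k q es (done ++ (v , q) ∷ [])

  module _ (O : Fin 2 → Subset n → Bool) (detects : Detects O) where

    Hop : Fin n → Fin n → Fin n → Set
    Hop p v q = p ∈ S × v ∉ S × q ∈ S × Hit O 0F v p × Hit O 1F v q

    Chordless : List (Fin n) → Fin n → Fin n → Fin n → Set
    Chordless qs p v q = Hop p v q × (∀ {u} → u ∈ₗ qs → Hit O 1F v u → u ≡ q) × (∀ {u} → u ∈ₗ qs → Hit O 0F v u → u ≡ p)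

    chordless-mono : ∀ {qs qs′} → (∀ {u} → u ∈ₗ qs′ → u ∈ₗ qs) → ∀ {p v q} → Chordless qs p v q → Chordless qs′ p v q
    chordless-mono sub (hop , out , inn) = hop , out ∘ sub , inn ∘ sub

    ChordlessCycle : Hops n → Set
    ChordlessCycle es = ∃[ p ] Walk (Chordless (seconds es)) p es p × Unique (seconds es) × 1 ≤ length es

    seconds-++ : ∀ (es fs : Hops n) → seconds (es ++ fs) ≡ seconds es ++ seconds fs
    seconds-++ = map-++ proj₂

    seconds-in-S : ∀ {p e es} → p ∈ S → Walk Hop p es e → All (_∈ S) (seconds es)
    seconds-in-S p∈ [] = []
    seconds-in-S p∈ ((_ , _ , q∈ , _) ∷ w) = q∈ ∷ seconds-in-S q∈ w

    clean-correct : ∀ k {p m todo done} → 2 * length todo + length done < k → 1 ≤ length (todo ++ done) →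
      Walk Hop p todo m → Walk (Chordless (seconds (todo ++ done))) m done p →
      Unique (seconds (todo ++ done)) →
      Ensures O (clean k p todo done) (λ es c → ChordlessCycle es × c ≤ k * (2 * findCost))
    clean-correct zero () _ _ _ _
    clean-correct (suc k) _ ne [] w′ u = ensures ((_ , w′ , u , ne) , z≤n)
    clean-correct (suc k) {p} {m} {todo@((v , q) ∷ es)} {done} (s≤s k≥) ne (hop@(p∈ , v∉ , q∈ , pv , vq) ∷ w) w′ u∷@(q∉ ∷ u) =
      ensures->>= O (find-correct O detects 1F v _) λ where
        (just x) c (c≤ , x∈S , (x∈ , x≢q) , vx) → case-out x c c≤ x∈S x∈ vx
        nothing c (c≤ , none) → ensures->>= O (find-correct O detects 0F v _) λ where
          (just x) d (d≤ , x∈S , (x∈ , x≢p) , xv) → case-in x c d c≤ d≤ x∈S x∈ x≢p xv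
          nothing d (d≤ , none′) → ensures-map O (λ {es′} {c′} (cyc , c′≤) → cyc , budget₂ c≤ d≤ c′≤)
            (clean-correct k
              (ℕ.≤-trans (ℕ.≤-reflexive rotate-measure) k≥)
              (ℕ.≤-trans (s≤s z≤n) (ℕ.≤-reflexive (sym (trans (length-++ es) (trans (cong (length es +_) (length-++ done)) (shift (length es) (length done)))))))
              w
              (mapʷ (chordless-mono rotate⁻) w′ ++ʷ ((hop , (λ {x} x∈ vx → case x Fin.≟ q of λ where
                  (yes eq) → eq
                  (no x≢q) → case rotate⁻ x∈ of λ where
                    (here eq) → eq
                    (there x∈) → contradiction vx (none (∈S (there x∈)) (x∈ , x≢q))) ,
                (λ {x} x∈ xv → case x Fin.≟ p of λ where
                  (yes eq) → eq
                  (no x≢p) → contradiction xv (none′ (∈S (rotate⁻ x∈)) (rotate⁻ x∈ , x≢p)))) ∷ []))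
              (Unique-↭ rotate u∷))
      where
      open ℕ.≤-Reasoning
      F = findCost
      ∈S : ∀ {x} → x ∈ₗ seconds (todo ++ done) → x ∈ S
      ∈S = All.lookup (seconds-in-S p∈ ((hop ∷ w) ++ʷ mapʷ proj₁ w′))
      shift : ∀ a b → a + (b + 1) ≡ suc (a + b)
      shift = solve-∀
      rotate-measure : suc (2 * length es + length (done ++ (v , q) ∷ [])) ≡ 2 * length todo + length done
      rotate-measure = trans (cong (λ l → suc (2 * length es + l)) (length-++ done)) (eq (length es) (length done))
        where
        eq : ∀ a b → suc (2 * a + (b + 1)) ≡ 2 * suc a + b
        eq = solve-∀
      rotate : q ∷ seconds (es ++ done) ↭ seconds (es ++ (done ++ (v , q) ∷ []))
      rotate = ↭-trans (∷↭∷ʳ q (seconds (es ++ done)))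
        (↭-reflexive (trans (sym (seconds-++ (es ++ done) ((v , q) ∷ []))) (cong seconds (++-assoc es done ((v , q) ∷ [])))))
      rotate⁻ : ∀ {x} → x ∈ₗ seconds (es ++ (done ++ (v , q) ∷ [])) → x ∈ₗ q ∷ seconds (es ++ done)
      rotate⁻ = ∈-resp-↭ (↭-sym rotate)

      budget₁ : ∀ {c c′} → c ≤ F → c′ ≤ k * (2 * F) → c + c′ ≤ suc k * (2 * F)
      budget₁ c≤ c′≤ = ℕ.+-mono-≤ (ℕ.≤-trans c≤ (ℕ.m≤m+n F (F + 0))) c′≤
      budget₂ : ∀ {c d c′} → c ≤ F → d ≤ F → c′ ≤ k * (2 * F) → c + (d + c′) ≤ suc k * (2 * F)
      budget₂ {c} {d} {c′} c≤ d≤ c′≤ = begin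
        c + (d + c′)        ≡⟨ ℕ.+-assoc c d c′ ⟨
        c + d + c′          ≤⟨ ℕ.+-mono-≤ (ℕ.+-mono-≤ c≤ (ℕ.≤-trans d≤ (ℕ.m≤m+n F 0))) c′≤ ⟩
        suc k * (2 * F)     ∎

      continue : ∀ {p′ m′ todo′ done′} → 2 * length todo′ + length done′ < 2 * length todo + length done →
        1 ≤ length (todo′ ++ done′) →
        Walk Hop p′ todo′ m′ → Walk (Chordless (seconds (todo ++ done))) m′ done′ p′ →
        seconds todo′ ++ seconds done′ ⊆ₗ seconds todo ++ seconds done →
        Ensures O (clean k p′ todo′ done′) (λ es c → ChordlessCycle es × c ≤ k * (2 * F))
      continue {todo′ = todo′} {done′} less ne′ w₁ w₂ sub = clean-correct k (ℕ.≤-trans less k≥) ne′ w₁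
        (mapʷ (chordless-mono (⊆⇒∈ sub′)) w₂) (Unique-⊆ sub′ u∷)
        where
        sub′ : seconds (todo′ ++ done′) ⊆ₗ seconds (todo ++ done)
        sub′ = subst₂ _⊆ₗ_ (sym (seconds-++ todo′ done′)) (sym (seconds-++ todo done)) sub

      in-done : ∀ {x} fs → x ∈ₗ seconds (fs ++ done) → x ∉ₗ seconds fs → x ∈ₗ seconds done
      in-done {x} fs x∈ x∉ with ∈-++⁻ (seconds fs) (subst (x ∈ₗ_) (seconds-++ fs done) x∈)
      ... | inj₁ x∈fs = contradiction x∈fs x∉
      ... | inj₂ x∈done = x∈done

      case-out : ∀ x c → c ≤ F → x ∈ S → x ∈ₗ seconds (es ++ done) → Hit O 1F v x →
        Ensures O (if does (x ∈ₗ? seconds es)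
          then clean k p ((v , x) ∷ after x es) done
          else clean k p ((v , x) ∷ []) (after x done)) (λ es′ c′ → ChordlessCycle es′ × c + c′ ≤ suc k * (2 * F))
      case-out x c c≤ x∈S x∈ vx with x ∈ₗ? seconds es
      ... | yes x∈es = ensures-map O (λ (cyc , c′≤) → cyc , budget₁ c≤ c′≤)
        (continue (ℕ.+-monoˡ-< (length done) (ℕ.*-monoʳ-< 2 (s≤s (length-after es x∈es)))) (s≤s z≤n)
          ((p∈ , v∉ , x∈S , pv , vx) ∷ walk-after x∈es w) w′
          (++⁺ (q ∷ʳ after-⊆ es x∈es) ⊆-refl))
      ... | no x∉es = ensures-map O (λ (cyc , c′≤) → cyc , budget₁ c≤ c′≤)
        (continue (ℕ.+-mono-≤-< (ℕ.*-monoʳ-≤ 2 (s≤s (z≤n {length es}))) (length-after done (in-done es x∈ x∉es))) (s≤s z≤n)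
          ((p∈ , v∉ , x∈S , pv , vx) ∷ []) (walk-after (in-done es x∈ x∉es) w′)
          (q ∷ʳ ++⁺ {as = []} (minimum _) (after-⊆ done (in-done es x∈ x∉es))))

      case-in : ∀ x c d → c ≤ F → d ≤ F → x ∈ S → x ∈ₗ seconds (todo ++ done) → x ≢ p → Hit O 0F v x →
        Ensures O (if does (x ∈ₗ? seconds done)
          then clean k x todo (upto x done)
          else clean k x (upto x todo) []) (λ es′ c′ → ChordlessCycle es′ × c + (d + c′) ≤ suc k * (2 * F))
      case-in x c d c≤ d≤ x∈S x∈ x≢p xv with x ∈ₗ? seconds done
      ... | yes x∈done = ensures-map O (λ (cyc , c′≤) → cyc , budget₂ c≤ d≤ c′≤)
        (continue (ℕ.+-monoʳ-< (2 * length todo) (length-upto-< w′ x∈done x≢p)) (s≤s z≤n)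
          ((x∈S , v∉ , q∈ , xv , vq) ∷ w) (walk-upto x∈done w′)
          (++⁺ (⊆-refl {x = seconds todo}) (upto-⊆ x done)))
      ... | no x∉done = ensures-map O (λ (cyc , c′≤) → cyc , budget₂ c≤ d≤ c′≤)
        (continue (shorter w′) (ℕ.≤-trans (upto-nonempty todo x∈todo) (ℕ.≤-reflexive (cong length (sym (++-identityʳ (upto x todo))))))
          (walk-upto x∈todo ((x∈S , v∉ , q∈ , xv , vq) ∷ w)) []
          (++⁺ (upto-⊆ x todo) (minimum _)))
        where
        x∈todo : x ∈ₗ seconds todo
        x∈todo = case ∈-++⁻ (seconds todo) (subst (x ∈ₗ_) (seconds-++ todo done) x∈) of λ where
          (inj₁ x∈todo) → x∈todo
          (inj₂ x∈done) → contradiction x∈done x∉done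
        shorter : ∀ {done′} → Walk (Chordless (seconds (todo ++ done))) m done′ p →
                  2 * length (upto x todo) + 0 < 2 * length todo + length done′
        shorter [] = ℕ.+-monoˡ-< 0 (ℕ.*-monoʳ-< 2 (length-upto-< (hop ∷ w) x∈todo x≢p))
        shorter (_ ∷ _) = ℕ.+-mono-≤-< (ℕ.*-monoʳ-≤ 2 (length-upto x todo)) (s≤s z≤n)

-- The algorithm for a given policy

module Solver {n : ℕ} (S : Subset n) (policy : Peeling.Policy S) where
  open Search S
  open Scanning S
  open Peeling S
  open Algorithm policy
  open Cleaning S

  Alive : State → Fin n → Set
  Alive st q = q ∈ S × q ∉ State.dead st

  alive? : ∀ st → Decidable (Alive st)
  alive? st q = q ∈? S ×-dec ¬? (q ∈? State.dead st)

  KnownHop : State → Fin n → Fin n → Fin n → Set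
  KnownHop st p v q = v ∉ S × Known st v q × Known st p v

  Back : State → Fin n → Set
  Back st q = ∃₂ λ v p → Alive st p × KnownHop st p v q

  back? : ∀ st → Dec (∀ q → Alive st q → Back st q)
  back? st = all? λ q → alive? st q →-dec any? λ v → any? λ p →
    alive? st p ×-dec ¬? (v ∈? S) ×-dec known? st v q ×-dec known? st p v

  finish : State → DProgram n (Maybe (Subset n))
  finish st with any? (alive? st) | back? st
  ... | yes (q , alive) | yes back = let open Cycle (findCycle back alive) in
    clean (suc (2 * n)) start hops [] >>= λ es →
    return (just (replace S (seconds es) (firsts es)))
  -- Never reached: peeling stops only when every live vertex has a known in-edge. Deciding `back?`
  -- reads the tables and asks no queries.
  ... | yes _ | no _ = return nothing
  ... | no _ | _ = return nothing

  solve : DProgram n (Maybe (Subset n))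
  solve = peel >>= finish

-- Correctness on an instance

does⁺ : {A : Set} (a? : Dec A) → A → T (does a?)
does⁺ (yes _) _ = _
does⁺ (no ¬a) a = ¬a a

does⁻ : {A : Set} (a? : Dec A) → T (does a?) → A
does⁻ (yes a) _ = a

module OnInstance (I : Instance) where
  open Instance I renaming (n to N)
  open Search S
  open Scanning S
  open Peeling S

  matroid : Fin 2 → Matroid N
  matroid 0F = M₁
  matroid 1F = M₂

  S-indep : ∀ i → Indep (matroid i) S
  S-indep 0F = proj₁ (proj₁ maximum)
  S-indep 1F = proj₂ (proj₁ maximum)

  oracle⁺ : ∀ i {A} → Indep (matroid i) A → T (oracle i A)
  oracle⁺ 0F = does⁺ (Matroid.indep? M₁ _)
  oracle⁺ 1F = does⁺ (Matroid.indep? M₂ _)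

  oracle⁻ : ∀ i {A} → T (oracle i A) → Indep (matroid i) A
  oracle⁻ 0F = does⁻ (Matroid.indep? M₁ _)
  oracle⁻ 1F = does⁻ (Matroid.indep? M₂ _)

  detects : Detects oracle
  detects = record
    { hit⁻ = λ i u∈ us⊆S h → let u , u∈us , iu = swap-from-replace (matroid i) (S-indep i) u∈ us⊆S (oracle⁻ i h)
                              in u , u∈us , oracle⁺ i iu
    ; hit⁺ = λ i u∈ h → oracle⁺ i (replace-from-swap (matroid i) (S-indep i) u∈ (oracle⁻ i h))
    }

  Differs : Subset N → Fin N → Set
  Differs T x = (x ∈ S × x ∉ T) ⊎ (x ∉ S × x ∈ T)

  module _ {T : Subset N} (maxT : MaximumCommonIndep M₁ M₂ T) where

    S≡T : ∣ S ∣ ≡ ∣ T ∣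
    S≡T = ℕ.≤-antisym (proj₂ maxT S (proj₁ maximum)) (proj₂ maximum T (proj₁ maxT))

    in-edge : ∀ {x} → Differs T x → ∃[ y ] Differs T y × Edge oracle y x
    in-edge (inj₁ (x∈S , x∉T)) =
      let v , v∈T , v∉S , iv = exchange-out M₂ (S-indep 1F) (proj₂ (proj₁ maxT)) S≡T x∈S x∉T
      in v , inj₂ (v∉S , v∈T) , inj₂ (v∉S , x∈S , oracle⁺ 1F iv)
    in-edge (inj₂ (x∉S , x∈T)) =
      let u , u∈S , u∉T , iu = exchange-in M₁ (S-indep 0F) (proj₁ (proj₁ maxT)) S≡T x∈T x∉S
      in u , inj₁ (u∈S , u∉T) , inj₁ (u∈S , x∉S , oracle⁺ 0F iu)

    -- A vertex of the symmetric difference has an in-neighbour there, which by induction is still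
    -- alive, so it is never a source.
    killed-agrees : ∀ t {x} → x ∈ killed oracle t → ¬ Differs T x
    killed-agrees zero x∈ _ = ∉⊥ x∈
    killed-agrees (suc t) {x} x∈ dif with least (trueSource? oracle (killed oracle t)) in eq
    ... | nothing = killed-agrees t x∈ dif
    ... | just z with x∈p∪q⁻ (killed oracle t) _ x∈
    ... | inj₁ x∈t = killed-agrees t x∈t dif
    ... | inj₂ x∈z with refl ← x∈⁅y⁆⇒x≡y z x∈z =
      let y , dif′ , e = in-edge dif
      in proj₂ (least-just (trueSource? oracle (killed oracle t)) eq) (y , (λ y∈ → killed-agrees t y∈ dif′) , e)

    all-agree : (∀ x → ¬ Differs T x) → T ≡ S
    all-agree agree = ⊆-antisym
      (λ {x} x∈T → case x ∈? S of λ where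
        (yes x∈S) → x∈S
        (no x∉S) → contradiction (inj₂ (x∉S , x∈T)) (agree x))
      (λ {x} x∈S → case x ∈? T of λ where
        (yes x∈T) → x∈T
        (no x∉T) → contradiction (inj₁ (x∈S , x∉T)) (agree x))

  open Cleaning S

  -- The other matching on the same cycle: `es` pairs each `v` with its successor, as needed for
  -- `M₂`, and `tails` pairs it with its predecessor, as needed for `M₁`. On a closed walk the
  -- elements of `S` are the same up to rotation.
  tails : Fin N → Hops N → Hops N
  tails p [] = []
  tails p ((v , q) ∷ es) = (v , p) ∷ tails q es

  firsts-tails : ∀ p es → firsts (tails p es) ≡ firsts es
  firsts-tails p [] = refl
  firsts-tails p ((v , q) ∷ es) = cong (v ∷_) (firsts-tails q es)

  seconds-tails : ∀ {R : Fin N → Fin N → Fin N → Set} {p es e} → Walk R p es e → p ∷ seconds es ≡ seconds (tails p es) ++ (e ∷ [])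
  seconds-tails [] = refl
  seconds-tails (_∷_ {p} r w) = cong (p ∷_) (seconds-tails w)

  Exclusive : Fin 2 → List (Fin N) → Fin N × Fin N → Set
  Exclusive i keys (v , k) = k ∈ S × v ∉ S × Hit oracle i v k × (∀ {u} → u ∈ₗ keys → Hit oracle i v u → u ≡ k)

  -- If each `v` can be exchanged with no key but its own partner, the matching is triangular in
  -- whatever order it is listed, and `replace-indep` applies.
  exclusive⇒indep : ∀ i keys es → All (Exclusive i keys) es → (∀ {u} → u ∈ₗ seconds es → u ∈ₗ keys) → Unique (seconds es) →
    Indep (matroid i) (replace S (seconds es) (firsts es))
  exclusive⇒indep i keys es ex sub uniq = replace-indep (matroid i) (S-indep i) es
    (All.map (λ (k∈S , v∉S , h , _) → k∈S , v∉S , oracle⁻ i h) ex) (triangular es ex sub uniq)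
    where
    triangular : ∀ es → All (Exclusive i keys) es → (∀ {u} → u ∈ₗ seconds es → u ∈ₗ keys) → Unique (seconds es) →
      AllPairs (λ (v , u) (v′ , u′) → ¬ Indep (matroid i) (swap S u v′)) es
    triangular [] _ _ _ = []
    triangular ((v , u) ∷ es) (_ ∷ ex) sub (u∉ ∷ uniq) =
      All.tabulate (λ {(v′ , u′)} e∈ ind → All.lookup u∉ (∈-map⁺ proj₂ e∈)
        (proj₂ (proj₂ (proj₂ (All.lookup ex e∈))) (sub (here refl)) (oracle⁺ i ind)))
      ∷ triangular es ex (sub ∘ there) uniq

  module _ {p es} (w : Walk (Chordless oracle detects (seconds es)) p es p) (uniq : Unique (seconds es)) (ne : 1 ≤ length es) where

    heads-exclusive : ∀ {p e fs} → Walk (Chordless oracle detects (seconds es)) p fs e → All (Exclusive 1F (seconds es)) fs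
    heads-exclusive [] = []
    heads-exclusive (((_ , v∉ , q∈ , _ , vq) , out , _) ∷ w) = (q∈ , v∉ , vq , out) ∷ heads-exclusive w

    tails-exclusive : ∀ {p e fs} → Walk (Chordless oracle detects (seconds es)) p fs e → All (Exclusive 0F (seconds es)) (tails p fs)
    tails-exclusive [] = []
    tails-exclusive (((p∈ , v∉ , _ , pv , _) , _ , inn) ∷ w) = (p∈ , v∉ , pv , inn) ∷ tails-exclusive w

    tails↭ : seconds (tails p es) ↭ seconds es
    tails↭ = drop-∷ (↭-trans (∷↭∷ʳ p (seconds (tails p es))) (↭-reflexive (sym (seconds-tails w))))

    result : Subset N
    result = replace S (seconds es) (firsts es)

    result-indep₁ : Indep M₁ result
    result-indep₁ = Matroid.subset M₁ sub
      (exclusive⇒indep 0F (seconds es) (tails p es) (tails-exclusive w) (∈-resp-↭ tails↭) (Unique-↭ (↭-sym tails↭) uniq))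
      where
      sub : ∀ {x} → x ∈ result → x ∈ replace S (seconds (tails p es)) (firsts (tails p es))
      sub x∈ rewrite firsts-tails p es = case replace⁻ x∈ of λ where
        (inj₁ (x∈S , x∉)) → replace⁺ (inj₁ (x∈S , x∉ ∘ ∈-resp-↭ tails↭))
        (inj₂ x∈) → replace⁺ (inj₂ x∈)

    result-indep₂ : Indep M₂ result
    result-indep₂ = exclusive⇒indep 1F (seconds es) es (heads-exclusive w) id uniq

    firsts∉S : All (_∉ S) (firsts es)
    firsts∉S = All.map⁺ (All.map (proj₁ ∘ proj₂) (heads-exclusive w))

    -- A `v` occurring twice would have edges to two distinct elements of the cycle, one of which
    -- would be a chord.
    firsts-unique : Unique (firsts es)
    firsts-unique = go es (heads-exclusive w) id uniq
      where
      go : ∀ fs → All (Exclusive 1F (seconds es)) fs → (∀ {u} → u ∈ₗ seconds fs → u ∈ₗ seconds es) → Unique (seconds fs) → Unique (firsts fs)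
      go [] _ _ _ = []
      go ((v , q) ∷ fs) ((_ , _ , vq , _) ∷ ex) sub (q∉ ∷ u) =
        All.map⁺ (All.tabulate λ { {(v′ , q′)} f∈ refl → All.lookup q∉ (∈-map⁺ proj₂ f∈)
          (proj₂ (proj₂ (proj₂ (All.lookup ex f∈))) (sub (here refl)) vq) })
        ∷ go fs ex (sub ∘ there) u

    result-another : IsAnother result
    result-another = ((result-indep₁ , result-indep₂) , λ B cB → ℕ.≤-trans (proj₂ maximum B cB) (∣S∣≤∣replace∣ es firsts∉S firsts-unique)) ,
      differs es firsts∉S ne
      where
      differs : ∀ fs → All (_∉ S) (firsts fs) → 1 ≤ length fs → replace S (seconds fs) (firsts fs) ≢ S
      differs ((v , q) ∷ fs) (v∉S ∷ _) _ eq = v∉S (subst (v ∈_) eq (replace⁺ (inj₂ (here refl))))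

  module _ (policy : Peeling.Policy S) where
    open Solver S policy
    open Algorithm policy
    module Peel = PeelCorrect oracle detects policy

    module _ (st : State) (stuck : ∀ {x} → x ∉ State.dead st → ∃[ y ] Known st y x)
             (known⇒edge : ∀ {y x} → Known st y x → Edge oracle y x) where

      into-S : ∀ {v q} → q ∈ S → Edge oracle v q → v ∉ S × Hit oracle 1F v q
      into-S q∈S (inj₁ (_ , q∉S , _)) = contradiction q∈S q∉S
      into-S q∈S (inj₂ (v∉S , _ , h)) = v∉S , h

      out-of-S : ∀ {p v} → v ∉ S → Edge oracle p v → p ∈ S × Hit oracle 0F v p
      out-of-S v∉S (inj₁ (p∈S , _ , h)) = p∈S , h
      out-of-S v∉S (inj₂ (_ , v∈S , _)) = contradiction v∈S v∉S

      alive-back : ∀ q → Alive st q → Back st q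
      alive-back q (q∈S , q∉) =
        let v , kvq@(v∉ , _) = stuck q∉
            v∉S , _ = into-S q∈S (known⇒edge kvq)
            p , kpv@(p∉ , _) = stuck v∉
            p∈S , _ = out-of-S v∉S (known⇒edge kpv)
        in v , p , (p∈S , p∉) , v∉S , kvq , kpv

      -- A live vertex outside `S` has a live in-neighbour, which lies in `S`; so once `S` is dead,
      -- everything is.
      none-alive : ¬ (∃[ q ] Alive st q) → ∀ {x} → x ∈ State.dead st
      none-alive none {x} with x ∈? State.dead st
      ... | yes x∈ = x∈
      ... | no x∉ with x ∈? S
      ... | yes x∈S = contradiction (x , x∈S , x∉) none
      ... | no x∉S = let y , k@(y∉ , _) = stuck x∉ in
        contradiction (y , proj₁ (out-of-S x∉S (known⇒edge k)) , y∉) none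

      alive-in-S : ∀ {p q} {es : Hops N} → q ∈ S → Walk (KnownHop st) p es q → Walk (Hop oracle detects) p es q × p ∈ S
      alive-in-S q∈S [] = [] , q∈S
      alive-in-S q∈S ((v∉S , kvq , kpv) ∷ w) =
        let w′ , q′∈S = alive-in-S q∈S w
            p∈S , pv = out-of-S v∉S (known⇒edge kpv)
        in (p∈S , v∉S , q′∈S , pv , proj₂ (into-S q′∈S (known⇒edge kvq))) ∷ w′ , p∈S

      start-in-S : ∀ {p} {es : Hops N} → 1 ≤ length es → Walk (KnownHop st) p es p → p ∈ S
      start-in-S _ ((v∉S , _ , kpv) ∷ _) = proj₁ (out-of-S v∉S (known⇒edge kpv))

      finish-correct : ∃[ t ] State.dead st ≡ killed oracle t →
        Ensures oracle (finish st) (λ out c → CorrectOutput out × c ≤ suc (2 * N) * (2 * findCost))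
      finish-correct (t , canonical) with any? (alive? st) | back? st
      ... | yes (q , alive) | yes back = ensures->>= oracle
          (clean-correct oracle detects (suc (2 * N)) (s≤s short) (subst (λ es → 1 ≤ length es) (sym (++-identityʳ hops)) nonempty)
            (proj₁ (alive-in-S (start-in-S nonempty walk) walk)) []
            (subst (λ es → Unique (seconds es)) (sym (++-identityʳ hops)) unique))
          λ es c ((_ , w , uniq , ne) , c≤) → ensures (result-another w uniq ne , ℕ.≤-trans (ℕ.≤-reflexive (ℕ.+-identityʳ c)) c≤)
        where
        open Cycle (findCycle back alive)
        short : 2 * length hops + 0 ≤ 2 * N
        short = ℕ.≤-trans (ℕ.≤-reflexive (ℕ.+-identityʳ _)) (ℕ.*-monoʳ-≤ 2 (subst (_≤ N) (length-map proj₂ hops) (Unique⇒length≤ unique)))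
      ... | yes _ | no ¬back = contradiction alive-back ¬back
      ... | no none | _ = ensures ((λ (T , maxT , T≢S) → T≢S (all-agree maxT λ x →
              killed-agrees maxT t (subst (x ∈_) canonical (none-alive none)))) , z≤n)

    module _ (bound : Fin N → ℕ)
        (threshold-pos : ∀ x → 1 ≤ Policy.threshold policy x)
        (threshold≤quota : ∀ x → Policy.threshold policy x ≤ Policy.quota policy x)
        (n≤threshold*capacity : ∀ {y x} → Edge oracle y x → N ≤ Policy.threshold policy x * Policy.capacity policy y)
        (unlisted≤bound : ∀ t → t ≤ N → ∀ w → Peel.WatchInv (killed oracle t) w → ∀ x → x ∉ killed oracle t →
          (∀ {y} → Policy.Allowed policy y → Peel.Unlisted w (killed oracle t) x y → Policy.capacity policy y ≤ load w y) →
          live w (killed oracle t) x < Policy.threshold policy x →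
          count (Peel.unlisted? w (killed oracle t) x) ≤ bound x) where

      private
        peelCost = Peel.peelCost bound threshold-pos threshold≤quota n≤threshold*capacity unlisted≤bound

      solve-correct : Ensures oracle solve (λ out c → CorrectOutput out × c ≤ peelCost + suc (2 * N) * (2 * findCost))
      solve-correct = ensures->>= oracle
        (Peel.peel-correct bound threshold-pos threshold≤quota n≤threshold*capacity unlisted≤bound)
        λ st c (canonical , stuck , known⇒edge , c≤) →
          ensures-map oracle (λ (correct , d≤) → correct , ℕ.+-mono-≤ c≤ d≤) (finish-correct st stuck known⇒edge canonical)

-- The deterministic policy and its cost

m<[1+m/n]*n : ∀ m n .{{_ : NonZero n}} → m < suc (m / n) * n
m<[1+m/n]*n m n = begin-strict
  m                   ≡⟨ m≡m%n+[m/n]*n m n ⟩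
  m % n + m / n * n   <⟨ ℕ.+-monoˡ-< (m / n * n) (m%n<n m n) ⟩
  suc (m / n) * n     ∎
  where open ℕ.≤-Reasoning

count-members : ∀ {n} (S : Subset n) → count (_∈? S) ≤ ∣ S ∣
count-members [] = z≤n
count-members (true ∷ S) = s≤s (ℕ.≤-trans (count-mono (λ x → suc x ∈? (true ∷ S)) (_∈? S) drop-there) (count-members S))
count-members (false ∷ S) = ℕ.≤-trans (count-mono (λ x → suc x ∈? (false ∷ S)) (_∈? S) drop-there) (count-members S)

module Sides {n : ℕ} (S : Subset n) where

  bySide : {A : Set} → A → A → Fin n → A
  bySide inside outside x = if does (x ∈? S) then inside else outside

  bySide-∈ : ∀ {A : Set} {p q : A} {x} → x ∈ S → bySide p q x ≡ p
  bySide-∈ {x = x} x∈ with x ∈? S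
  ... | yes _ = refl
  ... | no x∉ = contradiction x∈ x∉

  bySide-∉ : ∀ {A : Set} {p q : A} {x} → x ∉ S → bySide p q x ≡ q
  bySide-∉ {x = x} x∉ with x ∈? S
  ... | yes x∈ = contradiction x∈ x∉
  ... | no _ = refl

  sum-bySide : ∀ p q → sum (bySide p q) ≤ ∣ S ∣ * p + n * q
  sum-bySide p q = begin
    sum (bySide p q)                                  ≤⟨ sum-mono pointwise ⟩
    sum (λ x → ind (x ∈? S) * p + q)                  ≡⟨ ∑-distrib-+ (λ x → ind (x ∈? S) * p) (λ _ → q) ⟩
    sum (λ x → ind (x ∈? S) * p) + sum {n} (λ _ → q)  ≤⟨ ℕ.+-mono-≤ (ℕ.≤-reflexive (sym (*-distribʳ-sum p (λ x → ind (x ∈? S))))) (sum-≤-* {f = λ (_ : Fin n) → q} λ _ → ℕ.≤-refl) ⟩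
    count (_∈? S) * p + n * q                         ≤⟨ ℕ.+-monoˡ-≤ (n * q) (ℕ.*-monoˡ-≤ p (count-members S)) ⟩
    ∣ S ∣ * p + n * q                                 ∎
    where
    open ℕ.≤-Reasoning
    pointwise : ∀ x → bySide p q x ≤ ind (x ∈? S) * p + q
    pointwise x with x ∈? S
    ... | yes _ = ℕ.≤-trans (ℕ.m≤m+n p 0) (ℕ.m≤m+n (p + 0) q)
    ... | no _ = ℕ.≤-refl

  -- With a³ ≈ r, every term of the cost is of order n a².
  detPolicy : (a : ℕ) .{{_ : NonZero a}} .{{_ : NonZero (a * a)}} → Peeling.Policy S
  detPolicy a = record
    { Allowed = λ _ → ⊤
    ; allowed? = λ _ → yes tt
    ; capacity = bySide (suc (n / a)) (a * a)
    ; quota = bySide (suc (n / (a * a))) a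
    ; threshold = bySide (suc (n / (a * a))) a
    }

-- Here `suc b` is the integer cube root a of r, and r < (a + 1)³ ≤ (2a)³ explains the factor 8.
module Deterministic (I : Instance) (b : ℕ)
  (a³≤r : suc b * suc b * suc b ≤ Instance.r I) (r≤8a³ : Instance.r I ≤ 8 * (suc b * suc b * suc b)) where
  open Instance I renaming (n to N)
  open Search S
  open Scanning S
  open Peeling S
  open Sides S
  open OnInstance I using (detects; solve-correct)

  a a² D E : ℕ
  a = suc b
  a² = a * a
  D = suc (N / a²)
  E = suc (N / a)

  policy : Policy
  policy = detPolicy a

  open Policy policy
  open PeelCorrect oracle detects policy
  open WatchInv

  -- Double counting of watched edges: a source of an unlisted edge has used up
  -- its capacity κ, while no target has more than q live watched edges.
  saturated : ∀ {w D x κ q} {Q : Pred (Fin N) 0ℓ} (Q? : Decidable Q) → WatchInv D w →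
    (∀ {y} → Allowed y → Unlisted w D x y → capacity y ≤ load w y) →
    (∀ {y} → Edge oracle y x → capacity y ≡ κ) →
    (∀ {y x′} → Edge oracle y x → Edge oracle y x′ → Q x′) →
    (∀ {x′} → Q x′ → quota x′ ≤ q) →
    count (unlisted? w D x) * κ ≤ count Q? * q
  saturated {w} {D} {x} {κ} {q} {Q} Q? inv full cap side quo = begin
    count (unlisted? w D x) * κ                                              ≡⟨ *-distribʳ-sum κ (λ y → ind (unlisted? w D x y)) ⟩
    sum (λ y → ind (unlisted? w D x y) * κ)                                  ≤⟨ sum-mono (λ y → row y (unlisted? w D x y)) ⟩
    sum (λ y → sum λ x′ → ind (Q? x′ ×-dec live? w D x′ y))                  ≡⟨ ∑-comm (λ y x′ → ind (Q? x′ ×-dec live? w D x′ y)) ⟩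
    sum (λ x′ → sum λ y → ind (Q? x′ ×-dec live? w D x′ y))                  ≤⟨ sum-mono (λ x′ → column x′ (Q? x′)) ⟩
    sum (λ x′ → ind (Q? x′) * q)                                             ≡⟨ *-distribʳ-sum q (λ x′ → ind (Q? x′)) ⟨
    count Q? * q                                                             ∎
    where
    open ℕ.≤-Reasoning
    row : ∀ y (u? : Dec (Unlisted w D x y)) → ind u? * κ ≤ sum (λ x′ → ind (Q? x′ ×-dec live? w D x′ y))
    row y (no _) = z≤n
    row y (yes un@(y∉ , e , _)) = begin
      κ + 0                                             ≡⟨ trans (ℕ.+-identityʳ κ) (sym (cap e)) ⟩
      capacity y                                        ≤⟨ full _ un ⟩
      load w y                                          ≤⟨ count-mono (λ x′ → T? (w y x′)) (λ x′ → Q? x′ ×-dec live? w D x′ y)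
                                                            (λ h → side e (proj₁ (edge inv h)) , h , y∉) ⟩
      sum (λ x′ → ind (Q? x′ ×-dec live? w D x′ y))     ∎
    column : ∀ x′ (q? : Dec (Q x′)) → sum (λ y → ind (q? ×-dec live? w D x′ y)) ≤ ind q? * q
    column x′ (no ¬q) = ℕ.≤-reflexive (count-none (λ y → no ¬q ×-dec live? w D x′ y) λ y h → ¬q (proj₁ h))
    column x′ (yes qx) = begin
      sum (λ y → ind (yes qx ×-dec live? w D x′ y))     ≤⟨ count-mono (λ y → yes qx ×-dec live? w D x′ y) (live? w D x′) proj₂ ⟩
      live w D x′                                       ≤⟨ live≤ inv x′ ⟩
      quota x′                                          ≤⟨ quo qx ⟩
      q                                                 ≡⟨ ℕ.+-identityʳ q ⟨
      q + 0                                             ∎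

  -- What double counting yields. Edges into `S` leave vertices of capacity a², while the r possible
  -- targets have quota `D`: at most r D / a² ≤ 8 a D are unlisted. Edges out of `S` leave vertices
  -- of capacity `E`, while at most N targets have quota a: at most N a / E ≤ a².
  bound : Fin N → ℕ
  bound = bySide (8 * (a * D)) a²

  N≤D*a² : N ≤ D * a²
  N≤D*a² = ℕ.<⇒≤ (m<[1+m/n]*n N a²)

  N≤E*a : N ≤ E * a
  N≤E*a = ℕ.<⇒≤ (m<[1+m/n]*n N a)

  unlisted≤bound : ∀ t → t ≤ N → ∀ w → WatchInv (killed oracle t) w → ∀ x → x ∉ killed oracle t →
    (∀ {y} → Allowed y → Unlisted w (killed oracle t) x y → capacity y ≤ load w y) →
    live w (killed oracle t) x < threshold x →
    count (unlisted? w (killed oracle t) x) ≤ bound x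
  unlisted≤bound t _ w inv x _ full _ = case x ∈? S of λ where
      (yes x∈) → ℕ.≤-trans (inside x∈) (ℕ.≤-reflexive (sym (bySide-∈ x∈)))
      (no x∉) → ℕ.≤-trans (outside x∉) (ℕ.≤-reflexive (sym (bySide-∉ x∉)))
    where
    open ℕ.≤-Reasoning
    U = count (unlisted? w (killed oracle t) x)
    assoc-* : ∀ a d → 8 * (a * a * a) * d ≡ 8 * (a * d) * (a * a)
    assoc-* = solve-∀
    comm-* : ∀ a e → e * a * a ≡ a * a * e
    comm-* = solve-∀
    inside : x ∈ S → U ≤ 8 * (a * D)
    inside x∈ = ℕ.*-cancelʳ-≤ U (8 * (a * D)) a² (begin
      U * a²                       ≤⟨ saturated {q = D} (_∈? S) inv full
                                       (λ { (inj₁ (_ , x∉ , _)) → contradiction x∈ x∉ ; (inj₂ (y∉ , _)) → bySide-∉ y∉ })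
                                       (λ { (inj₁ (_ , x∉ , _)) _ → contradiction x∈ x∉
                                          ; (inj₂ (y∉ , _)) (inj₁ (y∈ , _)) → contradiction y∈ y∉
                                          ; (inj₂ _) (inj₂ (_ , x′∈ , _)) → x′∈ })
                                       (λ x′∈ → ℕ.≤-reflexive (bySide-∈ x′∈)) ⟩
      count (_∈? S) * D            ≤⟨ ℕ.*-monoˡ-≤ D (ℕ.≤-trans (count-members S) r≤8a³) ⟩
      8 * (a * a * a) * D          ≡⟨ assoc-* a D ⟩
      8 * (a * D) * a²             ∎)
    outside : x ∉ S → U ≤ a²
    outside x∉ = ℕ.*-cancelʳ-≤ U a² E (begin
      U * E                        ≤⟨ saturated {q = a} (λ x′ → ¬? (x′ ∈? S)) inv full
                                       (λ { (inj₁ (y∈ , _)) → bySide-∈ y∈ ; (inj₂ (_ , x∈ , _)) → contradiction x∈ x∉ })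
                                       (λ { (inj₂ (_ , x∈ , _)) _ → contradiction x∈ x∉
                                          ; (inj₁ (y∈ , _)) (inj₂ (y∉ , _)) → contradiction y∈ y∉
                                          ; (inj₁ _) (inj₁ (_ , x′∉ , _)) → x′∉ })
                                       (λ x′∉ → ℕ.≤-reflexive (bySide-∉ x′∉)) ⟩
      count (λ x′ → ¬? (x′ ∈? S)) * a  ≤⟨ ℕ.*-monoˡ-≤ a (ℕ.≤-trans (count≤n (λ x′ → ¬? (x′ ∈? S))) N≤E*a) ⟩
      E * a * a                    ≡⟨ comm-* a E ⟩
      a² * E                       ∎)

  threshold-pos : ∀ x → 1 ≤ threshold x
  threshold-pos x with x ∈? S
  ... | yes _ = s≤s z≤n
  ... | no _ = s≤s z≤n

  n≤threshold*capacity : ∀ {y x} → Edge oracle y x → N ≤ threshold x * capacity y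
  n≤threshold*capacity (inj₁ (y∈ , x∉ , _)) =
    ℕ.≤-trans (ℕ.≤-trans N≤E*a (ℕ.≤-reflexive (ℕ.*-comm E a))) (ℕ.≤-reflexive (sym (cong₂ _*_ (bySide-∉ x∉) (bySide-∈ y∈))))
  n≤threshold*capacity (inj₂ (y∉ , x∈ , _)) =
    ℕ.≤-trans N≤D*a² (ℕ.≤-reflexive (sym (cong₂ _*_ (bySide-∈ x∈) (bySide-∉ y∉))))

  r≤N : r ≤ N
  r≤N = ∣p∣≤n S

  1≤a² : 1 ≤ a²
  1≤a² = s≤s z≤n

  a²≤N : a² ≤ N
  a²≤N = ℕ.≤-trans (ℕ.m≤m*n a² a) (ℕ.≤-trans a³≤r r≤N)

  a≤N : a ≤ N
  a≤N = ℕ.≤-trans (ℕ.m≤m*n a a) a²≤N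

  1≤N : 1 ≤ N
  1≤N = ℕ.≤-trans 1≤a² a²≤N

  open ℕ.≤-Reasoning

  a*E≤ : a * E ≤ 2 * N
  a*E≤ = begin
    a * E               ≡⟨ ℕ.*-suc a (N / a) ⟩
    a + a * (N / a)     ≤⟨ ℕ.+-mono-≤ a≤N (ℕ.≤-trans (ℕ.≤-reflexive (ℕ.*-comm a (N / a))) (m/n*n≤m N a)) ⟩
    N + N               ≡⟨ cong (N +_) (ℕ.+-identityʳ N) ⟨
    2 * N               ∎

  a²*D≤ : a² * D ≤ 2 * N
  a²*D≤ = begin
    a² * D              ≡⟨ ℕ.*-suc a² (N / a²) ⟩
    a² + a² * (N / a²)  ≤⟨ ℕ.+-mono-≤ a²≤N (ℕ.≤-trans (ℕ.≤-reflexive (ℕ.*-comm a² (N / a²))) (m/n*n≤m N a²)) ⟩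
    N + N               ≡⟨ cong (N +_) (ℕ.+-identityʳ N) ⟨
    2 * N               ∎

  -- The factor 1 is the indicator of `Allowed`, which always holds here; written this way, the sum
  -- is the `total` of the peeling bound by computation.
  watchable : ℕ
  watchable = sum λ y → 1 * capacity y

  -- 17 = 8 · 2 + 1: at most 8a³ vertices of capacity `E`, where `a * E ≤ 2 * N`, and at most N of
  -- capacity a².
  total≤ : watchable ≤ 17 * (N * a²)
  total≤ = begin
    sum (λ y → 1 * capacity y)            ≡⟨ sum-cong-≗ (λ y → ℕ.+-identityʳ (capacity y)) ⟩
    sum capacity                          ≤⟨ sum-bySide E a² ⟩
    r * E + N * a²                        ≤⟨ ℕ.+-monoˡ-≤ (N * a²) (ℕ.*-monoˡ-≤ E r≤8a³) ⟩
    8 * (a * a * a) * E + N * a²          ≡⟨ regroup a E (N * a²) ⟩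
    8 * (a² * (a * E)) + N * a²           ≤⟨ ℕ.+-monoˡ-≤ (N * a²) (ℕ.*-monoʳ-≤ 8 (ℕ.*-monoʳ-≤ a² a*E≤)) ⟩
    8 * (a² * (2 * N)) + N * a²           ≡⟨ collect a² N ⟩
    17 * (N * a²)                         ∎
    where
    regroup : ∀ a e m → 8 * (a * a * a) * e + m ≡ 8 * (a * a * (a * e)) + m
    regroup = solve-∀
    collect : ∀ s m → 8 * (s * (2 * m)) + m * s ≡ 17 * (m * s)
    collect = solve-∀

  bounds≤ : sum bound ≤ 129 * (N * a²)
  bounds≤ = begin
    sum bound                                      ≤⟨ sum-bySide (8 * (a * D)) a² ⟩
    r * (8 * (a * D)) + N * a²                     ≤⟨ ℕ.+-monoˡ-≤ (N * a²) (ℕ.*-monoˡ-≤ (8 * (a * D)) r≤8a³) ⟩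
    8 * (a * a * a) * (8 * (a * D)) + N * a²       ≡⟨ regroup a D (N * a²) ⟩
    64 * (a² * (a² * D)) + N * a²                  ≤⟨ ℕ.+-monoˡ-≤ (N * a²) (ℕ.*-monoʳ-≤ 64 (ℕ.*-monoʳ-≤ a² a²*D≤)) ⟩
    64 * (a² * (2 * N)) + N * a²                   ≡⟨ collect a² N ⟩
    129 * (N * a²)                                 ∎
    where
    regroup : ∀ a d m → 8 * (a * a * a) * (8 * (a * d)) + m ≡ 64 * (a * a * (a * a * d)) + m
    regroup = solve-∀
    collect : ∀ s m → 64 * (s * (2 * m)) + m * s ≡ 129 * (m * s)
    collect = solve-∀

  open Solver S policy using (solve)

  -- Per unit `N * a²`, peeling takes 4 + 5 · 17 + 129 searches and cleaning 6, together 224; the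
  -- factor 2 to 448 comes from `findCost`, which is at most 2 (1 + log n).
  solved : Ensures oracle solve (λ out c → CorrectOutput out × c ≤ 448 * (1 + ⌊log₂ N ⌋) * (N * a²))
  solved = ensures-map oracle (λ {_} {c} (correct , c≤) → correct , (begin
      c                                                           ≤⟨ c≤ ⟩
      (4 * N + 5 * watchable + sum bound) * F + suc (2 * N) * (2 * F)     ≤⟨ ℕ.+-mono-≤
        (ℕ.*-monoˡ-≤ F (ℕ.+-mono-≤ (ℕ.+-mono-≤ (ℕ.*-monoʳ-≤ 4 N≤) (ℕ.*-monoʳ-≤ 5 total≤)) bounds≤))
        (ℕ.*-monoˡ-≤ (2 * F) (ℕ.+-mono-≤ (ℕ.≤-trans 1≤N N≤) (ℕ.*-monoʳ-≤ 2 N≤))) ⟩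
      (4 * M + 5 * (17 * M) + 129 * M) * F + (M + 2 * M) * (2 * F)  ≡⟨ collect M F ⟩
      224 * M * F                                                 ≤⟨ ℕ.*-monoʳ-≤ (224 * M) (ℕ.m≤m+n F ⌊log₂ N ⌋) ⟩
      224 * M * (F + ⌊log₂ N ⌋)                                   ≡⟨ expand M ⌊log₂ N ⌋ ⟩
      448 * (1 + ⌊log₂ N ⌋) * M                                   ∎))
    (solve-correct policy bound threshold-pos (λ _ → ℕ.≤-refl) n≤threshold*capacity unlisted≤bound)
    where
    F = findCost
    M = N * a²
    N≤ : N ≤ M
    N≤ = ℕ.m≤m*n N a²
    collect : ∀ m f → (4 * m + 5 * (17 * m) + 129 * m) * f + (m + 2 * m) * (2 * f) ≡ 224 * m * f
    collect = solve-∀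
    expand : ∀ m l → 224 * m * (2 + l + l) ≡ 448 * (1 + l) * m
    expand = solve-∀

-- Sums over samples

module _ {N : ℕ} where

  -- `N ^ s` times the expectation over `s` independent uniform draws; without the division
  -- everything stays in ℕ.
  sumSamples : ℕ → (List (Fin N) → ℕ) → ℕ
  sumSamples zero F = F []
  sumSamples (suc s) F = sum λ c → sumSamples s (λ cs → F (c ∷ cs))

  sumSamples-mono : ∀ s {F G} → (∀ cs → length cs ≡ s → F cs ≤ G cs) → sumSamples s F ≤ sumSamples s G
  sumSamples-mono zero h = h [] refl
  sumSamples-mono (suc s) h = sum-mono λ c → sumSamples-mono s λ cs len → h (c ∷ cs) (cong suc len)

  sumSamples-cong : ∀ s {F G} → (∀ cs → F cs ≡ G cs) → sumSamples s F ≡ sumSamples s G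
  sumSamples-cong zero h = h []
  sumSamples-cong (suc s) h = sum-cong-≗ λ c → sumSamples-cong s (λ cs → h (c ∷ cs))

  sumSamples-+ : ∀ s F G → sumSamples s (λ cs → F cs + G cs) ≡ sumSamples s F + sumSamples s G
  sumSamples-+ zero F G = refl
  sumSamples-+ (suc s) F G = trans (sum-cong-≗ λ c → sumSamples-+ s (λ cs → F (c ∷ cs)) (λ cs → G (c ∷ cs)))
    (∑-distrib-+ (λ c → sumSamples s (λ cs → F (c ∷ cs))) (λ c → sumSamples s (λ cs → G (c ∷ cs))))

  sumSamples-*ʳ : ∀ s F k → sumSamples s (λ cs → F cs * k) ≡ sumSamples s F * k
  sumSamples-*ʳ zero F k = refl
  sumSamples-*ʳ (suc s) F k = trans (sum-cong-≗ λ c → sumSamples-*ʳ s (λ cs → F (c ∷ cs)) k)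
    (sym (*-distribʳ-sum k (λ c → sumSamples s (λ cs → F (c ∷ cs)))))

  sumSamples-sum : ∀ s {m} (F : List (Fin N) → Fin m → ℕ) → sumSamples s (λ cs → sum (F cs)) ≡ sum (λ j → sumSamples s (λ cs → F cs j))
  sumSamples-sum zero F = refl
  sumSamples-sum (suc s) F = trans (sum-cong-≗ λ c → sumSamples-sum s (λ cs → F (c ∷ cs)))
    (∑-comm (λ c j → sumSamples s (λ cs → F (c ∷ cs) j)))

  sumSamples-const : ∀ s k → sumSamples s (λ _ → k) ≡ N ^ s * k
  sumSamples-const zero k = sym (ℕ.+-identityʳ k)
  sumSamples-const (suc s) k = trans (sum-cong-≗ {N} λ _ → sumSamples-const s k) (trans (const N (N ^ s * k)) (sym (ℕ.*-assoc N (N ^ s) k)))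
    where
    const : ∀ m x → sum {m} (λ _ → x) ≡ m * x
    const zero x = refl
    const (suc m) x = cong (x +_) (const m x)

ind-× : {A B : Set} (a? : Dec A) (b? : Dec B) → ind (a? ×-dec b?) ≡ ind a? * ind b?
ind-× (yes _) (yes _) = refl
ind-× (yes _) (no _) = refl
ind-× (no _) _ = refl

ind-cong : {A B : Set} (a? : Dec A) (b? : Dec B) → (A → B) → (B → A) → ind a? ≡ ind b?
ind-cong a? b? f g = ℕ.≤-antisym (ind-mono a? b? f) (ind-mono b? a? g)

sumSamples-all : ∀ {N} {P : Pred (Fin N) 0ℓ} (P? : Decidable P) s → sumSamples s (λ zs → ind (All.all? P? zs)) ≡ count P? ^ s
sumSamples-all P? zero = refl
sumSamples-all P? (suc s) = begin
  sum (λ c → sumSamples s (λ zs → ind (All.all? P? (c ∷ zs))))            ≡⟨ sum-cong-≗ (λ c → sumSamples-cong s λ zs → step c zs) ⟩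
  sum (λ c → sumSamples s (λ zs → ind (All.all? P? zs) * ind (P? c)))     ≡⟨ sum-cong-≗ (λ c → sumSamples-*ʳ s (λ zs → ind (All.all? P? zs)) (ind (P? c))) ⟩
  sum (λ c → sumSamples s (λ zs → ind (All.all? P? zs)) * ind (P? c))     ≡⟨ sum-cong-≗ (λ c → cong (_* ind (P? c)) (sumSamples-all P? s)) ⟩
  sum (λ c → count P? ^ s * ind (P? c))                               ≡⟨ *-distribˡ-sum (count P? ^ s) (λ c → ind (P? c)) ⟨
  count P? ^ s * count P?                                             ≡⟨ ℕ.*-comm (count P? ^ s) (count P?) ⟩
  count P? ^ suc s                                                    ∎
  where
  open ≡-Reasoning
  step : ∀ c zs → ind (All.all? P? (c ∷ zs)) ≡ ind (All.all? P? zs) * ind (P? c)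
  step c zs = trans (ind-cong (All.all? P? (c ∷ zs)) (All.all? P? zs ×-dec P? c) (λ { (p ∷ ps) → ps , p }) (λ (ps , p) → p ∷ ps))
    (ind-× (All.all? P? zs) (P? c))

-- The two leading terms of the binomial expansion; this is the discrete form of comparing a sum of
-- s-th powers with an integral.
[1+s]mˢ+mˢ⁺¹≤[1+m]ˢ⁺¹ : ∀ s m → suc s * m ^ s + m ^ suc s ≤ suc m ^ suc s
[1+s]mˢ+mˢ⁺¹≤[1+m]ˢ⁺¹ zero m = ℕ.≤-refl
[1+s]mˢ+mˢ⁺¹≤[1+m]ˢ⁺¹ (suc s) m = begin
  suc (suc s) * m ^ suc s + m ^ suc (suc s)             ≡⟨ regroup s m (m ^ s) ⟩
  m ^ suc s + m * (suc s * m ^ s + m ^ suc s)           ≤⟨ ℕ.+-mono-≤ (ℕ.^-monoˡ-≤ (suc s) (ℕ.n≤1+n m)) (ℕ.*-monoʳ-≤ m ([1+s]mˢ+mˢ⁺¹≤[1+m]ˢ⁺¹ s m)) ⟩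
  suc m ^ suc s + m * suc m ^ suc s                     ∎
  where
  open ℕ.≤-Reasoning
  regroup : ∀ s m p → suc (suc s) * (m * p) + m * (m * p) ≡ m * p + m * (suc s * p + m * p)
  regroup = solve-∀

argmin : ∀ {N} {P : Pred (Fin N) 0ℓ} (P? : Decidable P) (d : Fin N → ℕ) → ∀ j → P j →
         ∃[ i ] P i × (∀ {z} → P z → d i ≤ d z)
argmin {P = P} P? d j pj = go (d j) j pj ℕ.≤-refl
  where
  go : ∀ k j → P j → d j ≤ k → ∃[ i ] P i × (∀ {z} → P z → d i ≤ d z)
  go k j pj dj≤ with any? (λ z → P? z ×-dec d z ℕ.<? d j)
  ... | no none = j , pj , λ {z} pz → ℕ.≮⇒≥ λ lt → none (z , pz , lt)
  go zero j pj dj≤ | yes (z , pz , lt) = contradiction (ℕ.<-≤-trans lt dj≤) λ ()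
  go (suc k) j pj dj≤ | yes (z , pz , lt) = go k z pz (ℕ.≤-pred (ℕ.≤-trans lt dj≤))

module _ {N : ℕ} (d : Fin N → ℕ) where

  before? : {P : Pred (Fin N) 0ℓ} → Decidable P → ∀ j → Decidable (λ z → P z → d z < d j)
  before? P? j z = P? z →-dec (d z ℕ.<? d j)

  -- For `j` in `P`, the power counts the sequences of `s` samples in which every member of `P`
  -- comes strictly before `j`. So this is the unnormalised expected number of such `j`.
  moment : ℕ → {P : Pred (Fin N) 0ℓ} → Decidable P → ℕ
  moment s P? = sum λ j → ind (P? j) * count (before? P? j) ^ s

  -- Deleting the d-least element of P telescopes the sum.
  moment≤ : ∀ s k {P : Pred (Fin N) 0ℓ} (P? : Decidable P) → count P? ≤ k →
            suc s * moment s P? + count (λ z → ¬? (P? z)) ^ suc s ≤ N ^ suc s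
  moment≤ s k {P} P? c≤ with any? P?
  ... | no none = ℕ.≤-trans (ℕ.≤-reflexive (cong (λ m → suc s * m + count (λ z → ¬? (P? z)) ^ suc s) empty))
        (ℕ.≤-trans (ℕ.≤-reflexive (cong (_+ count (λ z → ¬? (P? z)) ^ suc s) (ℕ.*-zeroʳ (suc s)))) (ℕ.^-monoˡ-≤ (suc s) (count≤n (λ z → ¬? (P? z)))))
    where
    empty : moment s P? ≡ 0
    empty = ℕ.n≤0⇒n≡0 (ℕ.≤-trans (sum-≤-* {f = λ j → ind (P? j) * count (before? P? j) ^ s} {c = 0}
      λ j → ℕ.≤-reflexive (cong (_* count (before? P? j) ^ s) (ind-no (P? j) λ p → none (j , p)))) (ℕ.≤-reflexive (ℕ.*-zeroʳ N)))
  moment≤ s zero {P} P? c≤ | yes (j , pj) = contradiction (ℕ.≤-trans (count-pos P? j pj) c≤) λ ()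
  -- Before the least element `i` count only the `m` elements outside `P`, so `i` contributes at
  -- most mˢ; deleting `i` raises `m` by at least one, and (s + 1) mˢ ≤ (m + 1)ˢ⁺¹ - mˢ⁺¹ absorbs
  -- the contribution.
  moment≤ s (suc k) {P} P? c≤ | yes (j , pj) with i , pi , least ← argmin P? d j pj = begin
      suc s * moment s P? + m ^ suc s                        ≤⟨ ℕ.+-monoˡ-≤ (m ^ suc s) (ℕ.*-monoʳ-≤ (suc s) split) ⟩
      suc s * (m ^ s + moment s P′?) + m ^ suc s             ≡⟨ regroup (suc s) (m ^ s) (moment s P′?) (m ^ suc s) ⟩
      suc s * moment s P′? + (suc s * m ^ s + m ^ suc s)     ≤⟨ ℕ.+-monoʳ-≤ (suc s * moment s P′?) ([1+s]mˢ+mˢ⁺¹≤[1+m]ˢ⁺¹ s m) ⟩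
      suc s * moment s P′? + suc m ^ suc s                   ≤⟨ ℕ.+-monoʳ-≤ (suc s * moment s P′?) (ℕ.^-monoˡ-≤ (suc s) m<) ⟩
      suc s * moment s P′? + count (λ z → ¬? (P′? z)) ^ suc s ≤⟨ moment≤ s k P′? (ℕ.≤-pred (ℕ.≤-trans P′<P c≤)) ⟩
      N ^ suc s                                              ∎
    where
    open ℕ.≤-Reasoning
    regroup : ∀ a b c d → a * (b + c) + d ≡ a * c + (a * b + d)
    regroup = solve-∀
    m = count (λ z → ¬? (P? z))
    P′ : Pred (Fin N) 0ℓ
    P′ z = P z × z ≢ i
    P′? : Decidable P′
    P′? z = P? z ×-dec ¬? (z Fin.≟ i)
    P′<P : count P′? < count P?
    P′<P = count-mono-< P′? P? proj₁ i (λ (_ , i≢i) → i≢i refl) pi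
    m< : m < count (λ z → ¬? (P′? z))
    m< = count-mono-< (λ z → ¬? (P? z)) (λ z → ¬? (P′? z)) (λ ¬p (p , _) → ¬p p) i (λ ¬p → ¬p pi) (λ (_ , i≢i) → i≢i refl)
    pointwise : ∀ z → ind (P? z) * count (before? P? z) ^ s ≤ ind (z Fin.≟ i) * m ^ s + ind (P′? z) * count (before? P′? z) ^ s
    pointwise z with P? z | z Fin.≟ i
    ... | no _ | _ = z≤n
    ... | yes p | yes refl = ℕ.≤-trans (ℕ.+-monoˡ-≤ 0 (ℕ.^-monoˡ-≤ s
            (count-mono (before? P? z) (λ w → ¬? (P? w)) (λ h pw → ℕ.<⇒≱ (h pw) (least pw))))) (ℕ.m≤m+n (m ^ s + 0) _)
    ... | yes p | no _ = ℕ.+-monoˡ-≤ 0 (ℕ.^-monoˡ-≤ s (count-mono (before? P? z) (before? P′? z) (λ h pw → h (proj₁ pw))))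
    split : moment s P? ≤ m ^ s + moment s P′?
    split = begin
      moment s P?                                                          ≤⟨ sum-mono pointwise ⟩
      sum (λ z → ind (z Fin.≟ i) * m ^ s + ind (P′? z) * count (before? P′? z) ^ s)
        ≡⟨ ∑-distrib-+ (λ z → ind (z Fin.≟ i) * m ^ s) (λ z → ind (P′? z) * count (before? P′? z) ^ s) ⟩
      sum (λ z → ind (z Fin.≟ i) * m ^ s) + moment s P′?                   ≡⟨ cong (_+ moment s P′?) (*-distribʳ-sum (m ^ s) (λ z → ind (z Fin.≟ i))) ⟨
      count (λ z → z Fin.≟ i) * m ^ s + moment s P′?                       ≤⟨ ℕ.+-monoˡ-≤ _ (ℕ.*-monoˡ-≤ (m ^ s) (count-singleton i)) ⟩
      1 * m ^ s + moment s P′?                                             ≡⟨ cong (_+ moment s P′?) (ℕ.+-identityʳ (m ^ s)) ⟩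
      m ^ s + moment s P′?                                                 ∎

  module _ {P : Pred (Fin N) 0ℓ} (P? : Decidable P) where

    Later : List (Fin N) → Fin N → Set
    Later zs j = P j × All (λ z → P z → d z < d j) zs

    later? : ∀ zs → Decidable (Later zs)
    later? zs j = P? j ×-dec All.all? (before? P? j) zs

    -- In expectation, at most N / (s + 1) elements of P come after all
    -- elements of P among s independent samples.
    later≤ : ∀ s → suc s * sumSamples s (λ zs → count (later? zs)) ≤ N ^ suc s
    later≤ s = begin
      suc s * sumSamples s (λ zs → count (later? zs))    ≡⟨ cong (suc s *_) expand ⟩
      suc s * moment s P?                                ≤⟨ ℕ.m≤m+n _ _ ⟩
      suc s * moment s P? + count (λ z → ¬? (P? z)) ^ suc s ≤⟨ moment≤ s (count P?) P? ℕ.≤-refl ⟩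
      N ^ suc s                                          ∎
      where
      open ℕ.≤-Reasoning
      expand : sumSamples s (λ zs → count (later? zs)) ≡ moment s P?
      expand = trans (sumSamples-sum s (λ zs j → ind (later? zs j))) (sum-cong-≗ λ j →
        trans (sumSamples-cong s λ zs → trans (ind-× (P? j) (All.all? (before? P? j) zs)) (ℕ.*-comm (ind (P? j)) _))
          (trans (sumSamples-*ʳ s (λ zs → ind (All.all? (before? P? j) zs)) (ind (P? j)))
            (trans (cong (_* ind (P? j)) (sumSamples-all (before? P? j) s)) (ℕ.*-comm _ (ind (P? j))))))

-- Enumerating a subset

elements : ∀ {n} (S : Subset n) → Fin ∣ S ∣ → Fin n
elements (true ∷ S) zero = zero
elements (true ∷ S) (suc j) = suc (elements S j)
elements (false ∷ S) j = suc (elements S j)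

count-elements : ∀ {n} (S : Subset n) {P : Pred (Fin n) 0ℓ} (P? : Decidable P) → (∀ {x} → P x → x ∈ S) →
                 count P? ≤ count (λ j → P? (elements S j))
count-elements [] P? _ = z≤n
count-elements (true ∷ S) P? P⊆S = ℕ.+-monoʳ-≤ (ind (P? zero)) (count-elements S (λ x → P? (suc x)) (λ p → drop-there (P⊆S p)))
count-elements (false ∷ S) P? P⊆S = ℕ.+-mono-≤ (ℕ.≤-reflexive (ind-no (P? zero) (λ p → case P⊆S p of λ ())))
  (count-elements S (λ x → P? (suc x)) (λ p → drop-there (P⊆S p)))

count-∈ₗ : ∀ {n} (xs : List (Fin n)) → count (_∈ₗ? xs) ≤ length xs
count-∈ₗ {n} [] = ℕ.≤-reflexive (count-none {n} (λ x → x ∈ₗ? []) λ _ ())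
count-∈ₗ (x ∷ xs) = ℕ.≤-trans
  (count-insert (_∈ₗ? (x ∷ xs)) (_∈ₗ? xs) x λ { (here eq) → inj₂ eq ; (there x∈) → inj₁ x∈ })
  (s≤s (count-∈ₗ xs))

-- The sampling policy and its expected cost

module Sampling {n : ℕ} (S : Subset n) {k : ℕ} (member : Fin (suc k) → Fin n) where

  -- Every vertex, with one of them repeated to make the range visibly nonempty.
  vertex : Fin (suc n) → Fin n
  vertex zero = member zero
  vertex (suc x) = x

  sample : List (Fin (suc n)) → List (Fin (suc k)) → List (Fin n)
  sample ws us = map vertex ws ++ map member us

  -- Only the out-edges of sampled vertices are watched, and once they are
  -- dead all edges into x are listed.
  samplePolicy : List (Fin n) → Peeling.Policy S
  samplePolicy zs = record
    { Allowed = _∈ₗ zs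
    ; allowed? = _∈ₗ? zs
    -- Loads and numbers of live edges are at most `n`, so neither this capacity nor this quota is
    -- ever reached.
    ; capacity = λ _ → suc n
    ; quota = λ _ → suc n
    ; threshold = λ _ → 1
    }

-- The size of `S` enters through an equation and its elements through an abstract `member`, because
-- a uniform draw from `S` needs a range of the form `Fin (suc k)`.
module Randomised (I : Instance) {k : ℕ} (member : Fin (suc k) → Fin (Instance.n I)) (r≡1+k : Instance.r I ≡ suc k)
  (enumerates : ∀ {P : Pred (Fin (Instance.n I)) 0ℓ} (P? : Decidable P) → (∀ {x} → P x → x ∈ Instance.S I) →
                count P? ≤ count (λ j → P? (member j))) where
  open Instance I renaming (n to N)
  open Search S
  open Scanning S
  open Peeling S
  open OnInstance I using (detects; solve-correct)
  open Sampling S member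

  killed-suc : ∀ t → killed oracle t ⊆ killed oracle (suc t)
  killed-suc t x∈ with least (trueSource? oracle (killed oracle t))
  ... | nothing = x∈
  ... | just z = p⊆p∪q _ x∈

  killed-mono : ∀ {t t′} → t ≤ t′ → killed oracle t ⊆ killed oracle t′
  killed-mono {t} {t′} t≤t′ {x} x∈ = subst (λ u → x ∈ killed oracle u) (ℕ.m+[n∸m]≡n t≤t′) (later (t′ ∸ t) x∈)
    where
    later : ∀ d {x} → x ∈ killed oracle t → x ∈ killed oracle (t + d)
    later zero {x} x∈ = subst (λ u → x ∈ killed oracle u) (sym (ℕ.+-identityʳ t)) x∈
    later (suc d) {x} x∈ = subst (λ u → x ∈ killed oracle u) (sym (ℕ.+-suc t d)) (killed-suc (t + d) (later d x∈))

  -- The number of stages 0, ..., N at which `y` has not died. It is read off from `killed` and is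
  -- thus fixed before any sample is drawn.
  deathTime : Fin N → ℕ
  deathTime y = count {suc N} (λ τ → ¬? (y ∈? killed oracle (toℕ τ)))

  deathTime-< : ∀ {t y z} → t ≤ N → z ∈ killed oracle t → y ∉ killed oracle t → deathTime z < deathTime y
  deathTime-< {t} {y} {z} t≤N z∈ y∉ = count-mono-<
    (λ τ → ¬? (z ∈? killed oracle (toℕ τ))) (λ τ → ¬? (y ∈? killed oracle (toℕ τ)))
    (λ {τ} z∉ y∈ → z∉ (killed-mono {t} {toℕ τ} (ℕ.≰⇒≥ λ τ≤t → y∉ (killed-mono {toℕ τ} {t} τ≤t y∈)) z∈))
    (fromℕ< (s≤s t≤N))
    (λ z∉ → z∉ (subst (λ u → z ∈ killed oracle u) (sym (toℕ-fromℕ< (s≤s t≤N))) z∈))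
    (subst (λ u → y ∉ killed oracle u) (sym (toℕ-fromℕ< (s≤s t≤N))) y∉)

  module _ {p : ℕ} (pick : Fin p → Fin N) (x : Fin N) where

    LaterPick : List (Fin p) → Fin p → Set
    LaterPick = Later (deathTime ∘ pick) (λ j → edge? oracle (pick j) x)

    laterPick? : ∀ zs → Decidable (LaterPick zs)
    laterPick? = later? (deathTime ∘ pick) (λ j → edge? oracle (pick j) x)

    tail : List (Fin p) → ℕ
    tail zs = count (laterPick? zs)

  module _ (ws : List (Fin (suc N))) (us : List (Fin (suc k))) where

    policy : Policy
    policy = samplePolicy (sample ws us)

    open Policy policy
    open PeelCorrect oracle detects policy
    open WatchInv

    -- The two samples serve different targets. The in-neighbours of `x ∈ S` may be any vertices
    -- outside `S`, so uniform vertices are compared with them. Those of `x ∉ S` lie in `S`, and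
    -- sampling `S` itself leaves only about r / s of them instead of n / s, which matters because
    -- there may be n such targets.
    bound : Fin N → ℕ
    bound x = ind (x ∈? S) * tail vertex x ws + ind (¬? (x ∈? S)) * tail member x us

    n≤threshold*capacity : ∀ {y x} → Edge oracle y x → N ≤ threshold x * capacity y
    n≤threshold*capacity _ = ℕ.≤-trans (ℕ.n≤1+n N) (ℕ.≤-reflexive (sym (ℕ.+-identityʳ (suc N))))

    unlisted≤bound : ∀ t → t ≤ N → ∀ w → WatchInv (killed oracle t) w → ∀ x → x ∉ killed oracle t →
      (∀ {y} → Allowed y → Unlisted w (killed oracle t) x y → capacity y ≤ load w y) →
      live w (killed oracle t) x < threshold x →
      count (unlisted? w (killed oracle t) x) ≤ bound x
    unlisted≤bound t t≤N w inv x _ full few = split (x ∈? S)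
      where
      D = killed oracle t
      -- When `x` is listed, its sampled in-neighbours are dead: a live one would either be watched,
      -- although threshold 1 means that no live watched edge is left, or have exhausted a capacity
      -- that exceeds every load.
      dead-sample : ∀ {z} → z ∈ₗ sample ws us → Edge oracle z x → z ∈ D
      dead-sample {z} z∈ e with z ∈? D
      ... | yes z∈D = z∈D
      ... | no z∉D with T? (w z x)
      ... | yes h = contradiction (ℕ.≤-trans (count-pos (live? w D x) z (h , z∉D)) (ℕ.≤-pred few)) λ ()
      ... | no ¬h = contradiction (full z∈ (z∉D , e , ¬h)) (ℕ.<⇒≱ (s≤s (count≤n (λ x′ → T? (w z x′)))))
      is-later : ∀ {p} (pick : Fin p → Fin N) {zs} → (∀ {z} → z ∈ₗ zs → pick z ∈ₗ sample ws us) →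
        ∀ {j} → Unlisted w D x (pick j) → LaterPick pick x zs j
      is-later pick sub (y∉ , e , _) = e , All.tabulate λ z∈ ez → deathTime-< t≤N (dead-sample (sub z∈) ez) y∉
      inside : x ∈ S → count (unlisted? w D x) ≤ tail vertex x ws
      inside _ = ℕ.≤-trans
        (count-mono (unlisted? w D x) (λ y → laterPick? vertex x ws (suc y)) (λ {y} → is-later vertex (λ z∈ → ∈-++⁺ˡ (∈-map⁺ vertex z∈)) {suc y}))
        (ℕ.m≤n+m _ (ind (laterPick? vertex x ws zero)))
      outside : x ∉ S → count (unlisted? w D x) ≤ tail member x us
      outside x∉ = ℕ.≤-trans
        (enumerates (unlisted? w D x) λ where
          (_ , inj₁ (y∈ , _) , _) → y∈
          (_ , inj₂ (_ , x∈ , _) , _) → contradiction x∈ x∉)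
        (count-mono (λ j → unlisted? w D x (member j)) (laterPick? member x us)
          (λ {j} → is-later member (λ z∈ → ∈-++⁺ʳ (map vertex ws) (∈-map⁺ member z∈)) {j}))

      split : (x? : Dec (x ∈ S)) → count (unlisted? w D x) ≤ ind x? * tail vertex x ws + ind (¬? x?) * tail member x us
      split (yes x∈) = ℕ.≤-trans (inside x∈) (ℕ.≤-trans (ℕ.m≤m+n (tail vertex x ws) 0) (ℕ.m≤m+n (tail vertex x ws + 0) 0))
      split (no x∉) = ℕ.≤-trans (outside x∉) (ℕ.m≤m+n (tail member x us) 0)

    open Solver S policy using (solve)

    solved : Ensures oracle solve (λ out c → CorrectOutput out ×
      c ≤ (4 * N + 5 * ((length ws + length us) * suc N) + sum bound) * findCost + suc (2 * N) * (2 * findCost))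
    solved = ensures-map oracle (λ (correct , c≤) → correct , ℕ.≤-trans c≤
        (ℕ.+-monoˡ-≤ (suc (2 * N) * (2 * findCost)) (ℕ.*-monoˡ-≤ findCost (ℕ.+-monoˡ-≤ (sum bound) (ℕ.+-monoʳ-≤ (4 * N) (ℕ.*-monoʳ-≤ 5 watchable≤))))))
      (solve-correct policy bound (λ _ → s≤s z≤n) (λ _ → s≤s z≤n) n≤threshold*capacity unlisted≤bound)
      where
      open ℕ.≤-Reasoning
      watchable≤ : sum (λ y → ind (allowed? y) * suc N) ≤ (length ws + length us) * suc N
      watchable≤ = begin
        sum (λ y → ind (allowed? y) * suc N)               ≡⟨ *-distribʳ-sum (suc N) (λ y → ind (allowed? y)) ⟨
        count allowed? * suc N                             ≤⟨ ℕ.*-monoˡ-≤ (suc N) (count-∈ₗ (sample ws us)) ⟩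
        length (sample ws us) * suc N                      ≡⟨ cong (_* suc N) (trans (length-++ (map vertex ws)) (cong₂ _+_ (length-map vertex ws) (length-map member us))) ⟩
        (length ws + length us) * suc N                    ∎

  sampleCost : List (Fin (suc N)) → List (Fin (suc k)) → ℕ
  sampleCost ws us = queries oracle (Solver.solve S (policy ws us))

  module _ (s : ℕ) (1≤s : 1 ≤ s) (r≤[1+s]² : r ≤ suc s * suc s) where

    -- Linearity of expectation over the targets in `Q`, with `later≤` applied to the in-neighbours
    -- of each one.
    tails : ∀ {p c} (pick : Fin p → Fin N) {Q : Pred (Fin N) 0ℓ} (Q? : Decidable Q) → count Q? ≤ c →
      suc s * sumSamples s (λ zs → sum (λ x → ind (Q? x) * tail pick x zs)) ≤ c * p ^ suc s
    tails {p} {c} pick Q? Q≤c = begin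
      suc s * sumSamples s (λ zs → sum (λ x → ind (Q? x) * tail pick x zs))       ≡⟨ cong (suc s *_) (sumSamples-sum s (λ zs x → ind (Q? x) * tail pick x zs)) ⟩
      suc s * sum (λ x → sumSamples s (λ zs → ind (Q? x) * tail pick x zs))       ≡⟨ *-distribˡ-sum (suc s) (λ x → sumSamples s (λ zs → ind (Q? x) * tail pick x zs)) ⟩
      sum (λ x → suc s * sumSamples s (λ zs → ind (Q? x) * tail pick x zs))       ≤⟨ sum-mono vertexwise ⟩
      sum (λ x → ind (Q? x) * p ^ suc s)                                          ≡⟨ *-distribʳ-sum (p ^ suc s) (λ x → ind (Q? x)) ⟨
      count Q? * p ^ suc s                                                        ≤⟨ ℕ.*-monoˡ-≤ (p ^ suc s) Q≤c ⟩
      c * p ^ suc s                                                               ∎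
      where
      open ℕ.≤-Reasoning
      commute : ∀ a b c → a * (b * c) ≡ c * (a * b)
      commute = solve-∀
      vertexwise : ∀ x → suc s * sumSamples s (λ zs → ind (Q? x) * tail pick x zs) ≤ ind (Q? x) * p ^ suc s
      vertexwise x = begin
        suc s * sumSamples s (λ zs → ind (Q? x) * tail pick x zs)     ≡⟨ cong (suc s *_) (sumSamples-cong s λ zs → ℕ.*-comm (ind (Q? x)) (tail pick x zs)) ⟩
        suc s * sumSamples s (λ zs → tail pick x zs * ind (Q? x))     ≡⟨ cong (suc s *_) (sumSamples-*ʳ s (tail pick x) (ind (Q? x))) ⟩
        suc s * (sumSamples s (tail pick x) * ind (Q? x))             ≡⟨ commute (suc s) _ (ind (Q? x)) ⟩
        ind (Q? x) * (suc s * sumSamples s (tail pick x))             ≤⟨ ℕ.*-monoʳ-≤ (ind (Q? x)) (later≤ (deathTime ∘ pick) (λ j → edge? oracle (pick j) x) s) ⟩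
        ind (Q? x) * p ^ suc s                                        ∎

    base insideTails outsideTails F Wˢ Uˢ : ℕ
    F = findCost
    base = (4 * N + 5 * ((s + s) * suc N)) * F + suc (2 * N) * (2 * F)
    insideTails = sumSamples s (λ ws → sum (λ x → ind (x ∈? S) * tail vertex x ws))
    outsideTails = sumSamples s (λ us → sum (λ x → ind (¬? (x ∈? S)) * tail member x us))
    Wˢ = suc N ^ s
    Uˢ = suc k ^ s

    open ℕ.≤-Reasoning

    1+k≤ : suc k ≤ suc s * suc s
    1+k≤ = subst (_≤ suc s * suc s) r≡1+k r≤[1+s]²

    insideTails≤ : insideTails ≤ suc s * suc N * Wˢ
    insideTails≤ = ℕ.*-cancelˡ-≤ (suc s) (begin
      suc s * insideTails                            ≤⟨ tails vertex (_∈? S) (ℕ.≤-trans (count-members S) r≤[1+s]²) ⟩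
      suc s * suc s * (suc N * Wˢ)         ≡⟨ regroup (suc s) (suc N) Wˢ ⟩
      suc s * (suc s * suc N * Wˢ)         ∎)
      where
      regroup : ∀ a b c → a * a * (b * c) ≡ a * (a * b * c)
      regroup = solve-∀

    outsideTails≤ : outsideTails ≤ suc s * N * Uˢ
    outsideTails≤ = ℕ.*-cancelˡ-≤ (suc s) (begin
      suc s * outsideTails                            ≤⟨ tails member (λ x → ¬? (x ∈? S)) (count≤n (λ x → ¬? (x ∈? S))) ⟩
      N * (suc k * Uˢ)                     ≤⟨ ℕ.*-monoʳ-≤ N (ℕ.*-monoˡ-≤ Uˢ 1+k≤) ⟩
      N * (suc s * suc s * Uˢ)             ≡⟨ regroup (suc s) N Uˢ ⟩
      suc s * (suc s * N * Uˢ)             ∎)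
      where
      regroup : ∀ a b c → b * (a * a * c) ≡ a * (a * b * c)
      regroup = solve-∀

    -- One tail term depends on `ws` only and the other on `us` only, so summing over the other
    -- sample just multiplies by its number of outcomes.
    sum-cost : sumSamples s (λ ws → sumSamples s (λ us → sampleCost ws us)) ≤ Wˢ * (Uˢ * base) + Uˢ * insideTails * F + Wˢ * outsideTails * F
    sum-cost = begin
      sumSamples s (λ ws → sumSamples s (λ us → sampleCost ws us))       ≤⟨ sumSamples-mono s (λ ws ∣ws∣ → sumSamples-mono s λ us ∣us∣ → pointwise ws us ∣ws∣ ∣us∣) ⟩
      sumSamples s (λ ws → sumSamples s (λ us → base + b ws * F + c us * F))   ≡⟨ sumSamples-cong s inner ⟩
      sumSamples s (λ ws → Uˢ * base + b ws * (Uˢ * F) + outsideTails * F)       ≡⟨ sumSamples-+ s (λ ws → Uˢ * base + b ws * (Uˢ * F)) (λ _ → outsideTails * F) ⟩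
      sumSamples s (λ ws → Uˢ * base + b ws * (Uˢ * F)) + sumSamples s (λ _ → outsideTails * F)
        ≡⟨ cong₂ _+_ (sumSamples-+ s (λ _ → Uˢ * base) (λ ws → b ws * (Uˢ * F))) (sumSamples-const s (outsideTails * F)) ⟩
      sumSamples s (λ _ → Uˢ * base) + sumSamples s (λ ws → b ws * (Uˢ * F)) + Wˢ * (outsideTails * F)
        ≡⟨ cong (_+ Wˢ * (outsideTails * F)) (cong₂ _+_ (sumSamples-const s (Uˢ * base)) (sumSamples-*ʳ s b (Uˢ * F))) ⟩
      Wˢ * (Uˢ * base) + insideTails * (Uˢ * F) + Wˢ * (outsideTails * F)                  ≡⟨ regroup (Wˢ * (Uˢ * base)) insideTails Uˢ F Wˢ outsideTails ⟩
      Wˢ * (Uˢ * base) + Uˢ * insideTails * F + Wˢ * outsideTails * F                      ∎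
      where
      b : List (Fin (suc N)) → ℕ
      b ws = sum (λ x → ind (x ∈? S) * tail vertex x ws)
      c : List (Fin (suc k)) → ℕ
      c us = sum (λ x → ind (¬? (x ∈? S)) * tail member x us)
      regroup : ∀ a b u f w c → a + b * (u * f) + w * (c * f) ≡ a + u * b * f + w * c * f
      regroup = solve-∀
      split : ∀ e b c f g → (e + (b + c)) * f + g ≡ e * f + g + b * f + c * f
      split = solve-∀
      collect : ∀ u a b f → u * (a + b * f) ≡ u * a + b * (u * f)
      collect = solve-∀
      pointwise : ∀ ws us → length ws ≡ s → length us ≡ s → sampleCost ws us ≤ base + b ws * F + c us * F
      pointwise ws us refl ∣us∣ = begin
        sampleCost ws us                                                     ≤⟨ proj₂ (holds (solved ws us)) ⟩
        (4 * N + 5 * ((length ws + length us) * suc N) + sum (bound ws us)) * F + suc (2 * N) * (2 * F)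
          ≡⟨ cong₂ (λ l σ → (4 * N + 5 * ((length ws + l) * suc N) + σ) * F + suc (2 * N) * (2 * F)) ∣us∣
              (∑-distrib-+ (λ x → ind (x ∈? S) * tail vertex x ws) (λ x → ind (¬? (x ∈? S)) * tail member x us)) ⟩
        (4 * N + 5 * ((s + s) * suc N) + (b ws + c us)) * F + suc (2 * N) * (2 * F)
          ≡⟨ split (4 * N + 5 * ((s + s) * suc N)) (b ws) (c us) F (suc (2 * N) * (2 * F)) ⟩
        base + b ws * F + c us * F                                        ∎
      inner : ∀ ws → sumSamples s (λ us → base + b ws * F + c us * F) ≡ Uˢ * base + b ws * (Uˢ * F) + outsideTails * F
      inner ws = trans (sumSamples-+ s (λ _ → base + b ws * F) (λ us → c us * F))
        (cong₂ _+_ (trans (sumSamples-const s (base + b ws * F)) (collect Uˢ base (b ws) F)) (sumSamples-*ʳ s c F))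

    1≤N : 1 ≤ N
    1≤N = ℕ.≤-trans (ℕ.≤-trans (s≤s z≤n) (ℕ.≤-reflexive (sym r≡1+k))) (∣p∣≤n S)

    -- `Wˢ * Uˢ` is the number of outcomes. With 1 + N ≤ 2N and 1 + s ≤ 2s the number of searches is
    -- at most 10 + 26 = 36 times `s * N`, and `findCost ≤ 2 (1 + log n)` doubles this to 72.
    expected≤ : sumSamples s (λ ws → sumSamples s (λ us → sampleCost ws us)) ≤ Wˢ * Uˢ * (72 * (1 + ⌊log₂ N ⌋) * (s * N))
    expected≤ = begin
      sumSamples s (λ ws → sumSamples s (λ us → sampleCost ws us))       ≤⟨ sum-cost ⟩
      Wˢ * (Uˢ * base) + Uˢ * insideTails * F + Wˢ * outsideTails * F                      ≤⟨ ℕ.+-mono-≤ (ℕ.+-monoʳ-≤ (Wˢ * (Uˢ * base)) (ℕ.*-monoˡ-≤ F (ℕ.*-monoʳ-≤ Uˢ insideTails≤))) (ℕ.*-monoˡ-≤ F (ℕ.*-monoʳ-≤ Wˢ outsideTails≤)) ⟩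
      Wˢ * (Uˢ * base) + Uˢ * (suc s * suc N * Wˢ) * F + Wˢ * (suc s * N * Uˢ) * F   ≡⟨ factor Wˢ Uˢ base s N F ⟩
      Wˢ * Uˢ * (base + suc s * (suc N + N) * F)                      ≤⟨ ℕ.*-monoʳ-≤ (Wˢ * Uˢ) bracket ⟩
      Wˢ * Uˢ * (72 * (1 + ⌊log₂ N ⌋) * (s * N))                   ∎
      where
      factor : ∀ w u a s n f → w * (u * a) + u * (suc s * suc n * w) * f + w * (suc s * n * u) * f ≡ w * u * (a + suc s * (suc n + n) * f)
      factor = solve-∀
      s*N : ℕ
      s*N = s * N
      N≤ : N ≤ s * N
      N≤ = ℕ.≤-trans (ℕ.≤-reflexive (sym (ℕ.+-identityʳ N))) (ℕ.*-monoˡ-≤ N 1≤s)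
      1+N≤ : suc N ≤ 2 * N
      1+N≤ = ℕ.≤-trans (ℕ.+-monoˡ-≤ N 1≤N) (ℕ.≤-reflexive (cong (N +_) (sym (ℕ.+-identityʳ N))))
      1+s≤ : suc s ≤ 2 * s
      1+s≤ = ℕ.≤-trans (ℕ.+-monoˡ-≤ s 1≤s) (ℕ.≤-reflexive (cong (s +_) (sym (ℕ.+-identityʳ s))))
      collect : ∀ s n m f → (4 * m + 5 * ((s + s) * (2 * n))) * f + (m + 2 * m) * (2 * f) + 2 * s * (2 * n + n) * f ≡ (10 * m + 26 * (s * n)) * f
      collect = solve-∀
      expand : ∀ m l → (10 * m + 26 * m) * (2 + l + l) ≡ 72 * (1 + l) * m
      expand = solve-∀
      bracket : base + suc s * (suc N + N) * F ≤ 72 * (1 + ⌊log₂ N ⌋) * (s * N)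
      bracket = begin
        base + suc s * (suc N + N) * F                 ≤⟨ ℕ.+-mono-≤ (ℕ.+-mono-≤
            (ℕ.*-monoˡ-≤ F (ℕ.+-mono-≤ (ℕ.*-monoʳ-≤ 4 N≤) (ℕ.*-monoʳ-≤ 5 (ℕ.*-monoʳ-≤ (s + s) 1+N≤))))
            (ℕ.*-monoˡ-≤ (2 * F) (ℕ.+-mono-≤ (ℕ.≤-trans 1≤N N≤) (ℕ.*-monoʳ-≤ 2 N≤))))
            (ℕ.*-monoˡ-≤ F (ℕ.*-mono-≤ 1+s≤ (ℕ.+-monoˡ-≤ N 1+N≤))) ⟩
        (4 * s*N + 5 * ((s + s) * (2 * N))) * F + (s*N + 2 * s*N) * (2 * F) + 2 * s * (2 * N + N) * F   ≡⟨ collect s N s*N F ⟩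
        (10 * s*N + 26 * s*N) * F                   ≤⟨ ℕ.*-monoʳ-≤ (10 * s*N + 26 * s*N) (ℕ.m≤m+n F ⌊log₂ N ⌋) ⟩
        (10 * s*N + 26 * s*N) * (F + ⌊log₂ N ⌋)     ≡⟨ expand s*N ⌊log₂ N ⌋ ⟩
        72 * (1 + ⌊log₂ N ⌋) * (s * N)              ∎

-- Natural numbers as rationals

fromℕ : ℕ → ℚ
fromℕ m = ℤ.+ m ℚ./ 1

private
  toℚᵘ-fromℕ : ∀ m → toℚᵘ (fromℕ m) ℚᵘ.≃ mkℚᵘ (ℤ.+ m) 0
  toℚᵘ-fromℕ m = ℚ.toℚᵘ-fromℚᵘ (mkℚᵘ (ℤ.+ m) 0)

fromℕ-+ : ∀ a b → fromℕ (a + b) ≡ fromℕ a ℚ.+ fromℕ b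
fromℕ-+ a b = ℚ.toℚᵘ-injective (begin
  toℚᵘ (fromℕ (a + b))                   ≈⟨ toℚᵘ-fromℕ (a + b) ⟩
  mkℚᵘ (ℤ.+ (a + b)) 0                     ≈⟨ *≡* (cong (ℤ._* ℤ.+ 1) (cong₂ ℤ._+_ (sym (ℤ.*-identityʳ (ℤ.+ a))) (sym (ℤ.*-identityʳ (ℤ.+ b))))) ⟩
  mkℚᵘ (ℤ.+ a) 0 ℚᵘ.+ mkℚᵘ (ℤ.+ b) 0         ≈⟨ ℚᵘ.+-cong (toℚᵘ-fromℕ a) (toℚᵘ-fromℕ b) ⟨
  toℚᵘ (fromℕ a) ℚᵘ.+ toℚᵘ (fromℕ b)     ≈⟨ ℚ.toℚᵘ-homo-+ (fromℕ a) (fromℕ b) ⟨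
  toℚᵘ (fromℕ a ℚ.+ fromℕ b)             ∎)
  where open ℚᵘ.≃-Reasoning

fromℕ-* : ∀ a b → fromℕ (a * b) ≡ fromℕ a ℚ.* fromℕ b
fromℕ-* a b = ℚ.toℚᵘ-injective (begin
  toℚᵘ (fromℕ (a * b))                   ≈⟨ toℚᵘ-fromℕ (a * b) ⟩
  mkℚᵘ (ℤ.+ (a * b)) 0                     ≈⟨ *≡* (cong (ℤ._* ℤ.+ 1) (ℤ.pos-* a b)) ⟩
  mkℚᵘ (ℤ.+ a) 0 ℚᵘ.* mkℚᵘ (ℤ.+ b) 0         ≈⟨ ℚᵘ.*-cong (toℚᵘ-fromℕ a) (toℚᵘ-fromℕ b) ⟨
  toℚᵘ (fromℕ a) ℚᵘ.* toℚᵘ (fromℕ b)     ≈⟨ ℚ.toℚᵘ-homo-* (fromℕ a) (fromℕ b) ⟨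
  toℚᵘ (fromℕ a ℚ.* fromℕ b)             ∎)
  where open ℚᵘ.≃-Reasoning

fromℕ-mono : ∀ {a b} → a ≤ b → fromℕ a ℚ.≤ fromℕ b
fromℕ-mono {a} {b} a≤b = ℚ.toℚᵘ-cancel-≤ (begin
  toℚᵘ (fromℕ a)  ≃⟨ toℚᵘ-fromℕ a ⟩
  mkℚᵘ (ℤ.+ a) 0    ≤⟨ *≤* (ℤ.*-monoʳ-≤-nonNeg (ℤ.+ 1) (ℤ.+≤+ a≤b)) ⟩
  mkℚᵘ (ℤ.+ b) 0    ≃⟨ toℚᵘ-fromℕ b ⟨
  toℚᵘ (fromℕ b)  ∎)
  where open ℚᵘ.≤-Reasoning

fromℕ-inverse : ∀ k → fromℕ (suc k) ℚ.* (ℤ.+ 1 ℚ./ suc k) ≡ 1ℚ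
fromℕ-inverse k = ℚ.toℚᵘ-injective (begin
  toℚᵘ (fromℕ (suc k) ℚ.* (ℤ.+ 1 ℚ./ suc k))            ≈⟨ ℚ.toℚᵘ-homo-* (fromℕ (suc k)) (ℤ.+ 1 ℚ./ suc k) ⟩
  toℚᵘ (fromℕ (suc k)) ℚᵘ.* toℚᵘ (ℤ.+ 1 ℚ./ suc k)      ≈⟨ ℚᵘ.*-cong (toℚᵘ-fromℕ (suc k)) (ℚ.toℚᵘ-fromℚᵘ (mkℚᵘ (ℤ.+ 1) k)) ⟩
  mkℚᵘ (ℤ.+ suc k) 0 ℚᵘ.* mkℚᵘ (ℤ.+ 1) k                  ≈⟨ *≡* (cong ℤ.+_ (swap-ones k)) ⟩
  toℚᵘ 1ℚ                                             ∎)
  where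
  open ℚᵘ.≃-Reasoning
  swap-ones : ∀ k → suc k * 1 * 1 ≡ 1 * (1 * suc k)
  swap-ones = solve-∀

instance
  fromℕ-pos : ∀ {m} → ⦃ NonZero m ⦄ → ℚ.Positive (fromℕ m)
  fromℕ-pos {suc m} = ℚ.normalize-pos (suc m) 1

  fromℕ-nonNeg : ∀ {m} → ℚ.NonNegative (fromℕ m)
  fromℕ-nonNeg {m} = ℚ.normalize-nonNeg m 1

power≤ : ∀ {p B} b → 0ℚ ℚ.≤ p → p ℚ.≤ fromℕ B → p ^ℚ b ℚ.≤ fromℕ (B ^ b)
power≤ zero _ _ = ℚ.≤-refl
power≤ {p} {B} (suc b) 0≤p p≤ = begin
  p ℚ.* p ^ℚ b                  ≤⟨ ℚ.*-monoˡ-≤-nonNeg p ⦃ ℚ.nonNegative 0≤p ⦄ (power≤ b 0≤p p≤) ⟩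
  p ℚ.* fromℕ (B ^ b)           ≤⟨ ℚ.*-monoʳ-≤-nonNeg (fromℕ (B ^ b)) ⦃ fromℕ-nonNeg {B ^ b} ⦄ p≤ ⟩
  fromℕ B ℚ.* fromℕ (B ^ b)     ≡⟨ fromℕ-* B (B ^ b) ⟨
  fromℕ (B ^ suc b)             ∎
  where open ℚ.≤-Reasoning

-- Randomised programs

lift : DProgram n A → Program n A randomized
lift (return x) = return x
lift (query i X p) = query i X (λ b → lift (p b))

draw : ∀ {k} → ℕ → (List (Fin (suc k)) → Program n A randomized) → Program n A randomized
draw zero f = f []
draw {k = k} (suc s) f = choose k (λ c → draw s (λ cs → f (c ∷ cs)))

module _ {O : Fin 2 → Subset n → Bool} where

  every-det : ∀ {P : Pred A 0ℓ} (p : DProgram n A) → P (run O p) → EveryOutput O P p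
  every-det (return x) h = h
  every-det (query i X p) h = every-det (p (O i X)) h

  every-lift : ∀ {P : Pred A 0ℓ} (p : DProgram n A) → P (run O p) → EveryOutput O P (lift p)
  every-lift (return x) h = h
  every-lift (query i X p) h = every-lift (p (O i X)) h

  every-draw : ∀ {P : Pred A 0ℓ} {k} s {f : List (Fin (suc k)) → Program n A randomized} →
               (∀ cs → EveryOutput O P (f cs)) → EveryOutput O P (draw s f)
  every-draw zero h = h []
  every-draw (suc s) h c = every-draw s λ cs → h (c ∷ cs)

  expected-lift : (p : DProgram n A) → expectedQueries O (lift p) ≡ fromℕ (queries O p)
  expected-lift (return x) = refl
  expected-lift (query i X p) = trans (cong (1ℚ ℚ.+_) (expected-lift (p (O i X)))) (sym (fromℕ-+ 1 (queries O (p (O i X)))))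

  -- Both sides are scaled by the number of outcomes, which keeps the right
  -- one a natural number.
  scaled-sum : ∀ M {m} (E : Fin m → ℚ) (F : Fin m → ℕ) → (∀ c → fromℕ M ℚ.* E c ≡ fromℕ (F c)) →
               fromℕ M ℚ.* sumℚ E ≡ fromℕ (sum F)
  scaled-sum M {zero} E F h = ℚ.*-zeroʳ (fromℕ M)
  scaled-sum M {suc m} E F h = begin
    fromℕ M ℚ.* (E zero ℚ.+ sumℚ (E ∘ suc))                  ≡⟨ ℚ.*-distribˡ-+ (fromℕ M) (E zero) (sumℚ (E ∘ suc)) ⟩
    fromℕ M ℚ.* E zero ℚ.+ fromℕ M ℚ.* sumℚ (E ∘ suc)        ≡⟨ cong₂ ℚ._+_ (h zero) (scaled-sum M (E ∘ suc) (F ∘ suc) (h ∘ suc)) ⟩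
    fromℕ (F zero) ℚ.+ fromℕ (sum (F ∘ suc))                 ≡⟨ fromℕ-+ (F zero) (sum (F ∘ suc)) ⟨
    fromℕ (sum F)                                            ∎
    where open ≡-Reasoning

  scaled-draw : ∀ {k} s M {f : List (Fin (suc k)) → Program n A randomized} {F : List (Fin (suc k)) → ℕ} →
    (∀ cs → fromℕ M ℚ.* expectedQueries O (f cs) ≡ fromℕ (F cs)) →
    fromℕ (suc k ^ s * M) ℚ.* expectedQueries O (draw s f) ≡ fromℕ (sumSamples s F)
  scaled-draw zero M {f} h = trans (cong (λ m → fromℕ m ℚ.* expectedQueries O (f [])) (ℕ.+-identityʳ M)) (h [])
  scaled-draw {k = k} (suc s) M {f} {F} h = begin
    fromℕ (suc k * suc k ^ s * M) ℚ.* (1/K ℚ.* sumℚ E)             ≡⟨ cong (λ m → fromℕ m ℚ.* (1/K ℚ.* sumℚ E)) (ℕ.*-assoc (suc k) (suc k ^ s) M) ⟩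
    fromℕ (suc k * M′) ℚ.* (1/K ℚ.* sumℚ E)                        ≡⟨ cong (ℚ._* (1/K ℚ.* sumℚ E)) (trans (fromℕ-* (suc k) M′) (ℚ.*-comm (fromℕ (suc k)) (fromℕ M′))) ⟩
    fromℕ M′ ℚ.* fromℕ (suc k) ℚ.* (1/K ℚ.* sumℚ E)                ≡⟨ ℚ.*-assoc (fromℕ M′) (fromℕ (suc k)) (1/K ℚ.* sumℚ E) ⟩
    fromℕ M′ ℚ.* (fromℕ (suc k) ℚ.* (1/K ℚ.* sumℚ E))              ≡⟨ cong (fromℕ M′ ℚ.*_) (trans (sym (ℚ.*-assoc (fromℕ (suc k)) 1/K (sumℚ E)))
                                                                        (trans (cong (ℚ._* sumℚ E) (fromℕ-inverse k)) (ℚ.*-identityˡ (sumℚ E)))) ⟩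
    fromℕ M′ ℚ.* sumℚ E                                            ≡⟨ scaled-sum M′ E (λ c → sumSamples s (λ cs → F (c ∷ cs))) (λ c → scaled-draw s M (λ cs → h (c ∷ cs))) ⟩
    fromℕ (sumSamples (suc s) F)                                   ∎
    where
    open ≡-Reasoning
    M′ = suc k ^ s * M
    1/K = ℤ.+ 1 ℚ./ suc k
    E : Fin (suc k) → ℚ
    E c = expectedQueries O (draw s (λ cs → f (c ∷ cs)))

scaled≤ : ∀ M ⦃ _ : NonZero M ⦄ {p x B} → fromℕ M ℚ.* p ≡ fromℕ x → x ≤ M * B → 0ℚ ℚ.≤ p × p ℚ.≤ fromℕ B
scaled≤ M {p} {x} {B} eq x≤ =
  ℚ.*-cancelˡ-≤-pos (fromℕ M) ⦃ fromℕ-pos {M} ⦄ (begin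
    fromℕ M ℚ.* 0ℚ        ≡⟨ ℚ.*-zeroʳ (fromℕ M) ⟩
    0ℚ                    ≤⟨ fromℕ-mono {0} {x} z≤n ⟩
    fromℕ x               ≡⟨ eq ⟨
    fromℕ M ℚ.* p         ∎) ,
  ℚ.*-cancelˡ-≤-pos (fromℕ M) ⦃ fromℕ-pos {M} ⦄ (begin
    fromℕ M ℚ.* p         ≡⟨ eq ⟩
    fromℕ x               ≤⟨ fromℕ-mono x≤ ⟩
    fromℕ (M * B)         ≡⟨ fromℕ-* M B ⟩
    fromℕ M ℚ.* fromℕ B   ∎)
  where open ℚ.≤-Reasoning

-- One less than the integer part of the k-th root of r + 1.
rootPred : ℕ → ℕ → ℕ
rootPred k zero = 0
rootPred k (suc r) =
  let b = rootPred k r in if (2 + b) ^ k ≤ᵇ 2 + r then suc b else b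

rootPred-correct : ∀ k .⦃ _ : NonZero k ⦄ r → suc (rootPred k r) ^ k ≤ suc r × suc r < (2 + rootPred k r) ^ k
rootPred-correct k zero = ℕ.≤-reflexive (ℕ.^-zeroˡ k) , ℕ.≤-trans (ℕ.≤-reflexive (sym (ℕ.*-identityʳ 2))) (ℕ.^-monoʳ-≤ 2 (>-nonZero⁻¹ k))
rootPred-correct k (suc r) with rootPred-correct k r
... | lower , upper with (2 + rootPred k r) ^ k ≤ᵇ 2 + r in eq
... | true = ℕ.≤ᵇ⇒≤ _ _ (subst T (sym eq) _) , ℕ.≤-<-trans upper (ℕ.^-monoˡ-< k (ℕ.n<1+n (2 + rootPred k r)))
... | false = ℕ.m≤n⇒m≤1+n lower , ℕ.≰⇒> λ h → subst T eq (ℕ.≤⇒≤ᵇ h)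

-- The two algorithms

module _ {S : Subset n} where

  empty⇒∉ : ∣ S ∣ ≡ 0 → ∀ {x} → x ∉ S
  empty⇒∉ eq x∈ = contradiction (ℕ.<-≤-trans (x∈p⇒∣p-x∣<∣p∣ x∈) (ℕ.≤-reflexive eq)) λ ()

-- All maximum common independent sets have size r, so for r = 0 there is no other one. This case
-- stands apart because the root and the sample from `S` need r ≥ 1.
empty-correct : ∀ I → Instance.r I ≡ 0 → Instance.CorrectOutput I nothing
empty-correct I r≡0 (T , maxT , T≢S) = T≢S (all-agree maxT λ where
    x (inj₁ (x∈S , _)) → empty⇒∉ r≡0 x∈S
    x (inj₂ (_ , x∈T)) → empty⇒∉ (trans (sym (S≡T maxT)) r≡0) x∈T)
  where open OnInstance I using (all-agree; S≡T)

module DeterministicAlgorithm where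

  solveBy : (S : Subset n) → ℕ → DProgram n (Maybe (Subset n))
  solveBy S zero = return nothing
  solveBy S (suc r) = Solver.solve S (Sides.detPolicy S (suc (rootPred 3 r)))

  algorithm : Algorithm deterministic
  algorithm n S = solveBy S ∣ S ∣

  module _ (I : Instance) where
    open Instance I renaming (n to N)

    budget : ℕ → ℕ
    budget r = (448 * (1 + ⌊log₂ N ⌋) ^ 1 * N) ^ 3 * r ^ 2

    solveBy-correct : ∀ r → ∣ S ∣ ≡ r → Ensures oracle (solveBy S r) (λ out c → CorrectOutput out × c ^ 3 ≤ budget r)
    solveBy-correct zero eq = ensures (empty-correct I eq , z≤n)
    solveBy-correct (suc r) eq = ensures-map oracle (λ {_} {c} (correct , c≤) → correct , (begin
        c ^ 3                                                       ≤⟨ ℕ.^-monoˡ-≤ 3 c≤ ⟩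
        (448 * (1 + ⌊log₂ N ⌋) * (N * (a * a))) ^ 3                 ≡⟨ regroup (⌊log₂ N ⌋) N a ⟩
        (448 * (1 + ⌊log₂ N ⌋) ^ 1 * N) ^ 3 * (a ^ 3) ^ 2           ≤⟨ ℕ.*-monoʳ-≤ ((448 * (1 + ⌊log₂ N ⌋) ^ 1 * N) ^ 3) (ℕ.^-monoˡ-≤ 2 a³≤) ⟩
        budget (suc r)                                              ∎))
      (Deterministic.solved I b
        (ℕ.≤-trans (ℕ.≤-reflexive (cube a)) (ℕ.≤-trans a³≤ (ℕ.≤-reflexive (sym eq))))
        (ℕ.≤-trans (ℕ.≤-reflexive eq) (ℕ.≤-trans (ℕ.<⇒≤ <2+b³) (ℕ.≤-trans (ℕ.^-monoˡ-≤ 3 2+b≤2a) (ℕ.≤-reflexive (double-cube a))))))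
      where
      open ℕ.≤-Reasoning
      b a : ℕ
      b = rootPred 3 r
      a = suc b
      a³≤ : a ^ 3 ≤ suc r
      a³≤ = proj₁ (rootPred-correct 3 r)
      <2+b³ : suc r < (2 + b) ^ 3
      <2+b³ = proj₂ (rootPred-correct 3 r)
      2+b≤2a : 2 + b ≤ 2 * a
      2+b≤2a = s≤s (ℕ.≤-trans (ℕ.m≤n+m a b) (ℕ.≤-reflexive (cong (b +_) (sym (ℕ.+-identityʳ a)))))
      cube : ∀ a → a * a * a ≡ a * (a * (a * 1))
      cube = solve-∀
      double-cube : ∀ a → 2 * a * (2 * a * (2 * a * 1)) ≡ 8 * (a * a * a)
      double-cube = solve-∀
      regroup : ∀ l m a → (448 * (1 + l) * (m * (a * a))) ^ 3 ≡ (448 * (1 + l) ^ 1 * m) ^ 3 * (a ^ 3) ^ 2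
      regroup l m a = trans (cong (_^ 3) (move l m a)) (trans (product-cube (448 * (1 + l) ^ 1 * m) (a * a)) (cong ((448 * (1 + l) ^ 1 * m) ^ 3 *_) (sixth a)))
        where
        product-cube : ∀ x y → x * y * (x * y * (x * y * 1)) ≡ x * (x * (x * 1)) * (y * (y * (y * 1)))
        product-cube = solve-∀
        move : ∀ l m a → 448 * (1 + l) * (m * (a * a)) ≡ 448 * ((1 + l) * 1) * m * (a * a)
        move = solve-∀
        sixth : ∀ a → a * a * (a * a * (a * a * 1)) ≡ a * (a * (a * 1)) * (a * (a * (a * 1)) * 1)
        sixth = solve-∀

    correct : EveryOutput oracle CorrectOutput (runOn algorithm I)
    correct = every-det (runOn algorithm I) (proj₁ (holds (solveBy-correct ∣ S ∣ refl)))

    few-queries : queries oracle (runOn algorithm I) ^ 3 ≤ budget r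
    few-queries = proj₂ (holds (solveBy-correct ∣ S ∣ refl))

module RandomisedAlgorithm where

  solveBy : (S : Subset n) (r : ℕ) → (Fin r → Fin n) → Program n (Maybe (Subset n)) randomized
  solveBy S zero _ = return nothing
  solveBy S (suc k) member = let s = suc (rootPred 2 k) in
    draw s λ ws → draw s λ us → lift (Solver.solve S (Sampling.samplePolicy S member (Sampling.sample S member ws us)))

  algorithm : Algorithm randomized
  algorithm n S = solveBy S ∣ S ∣ (elements S)

  module _ (I : Instance) where
    open Instance I renaming (n to N)

    Enumerates : ∀ {r} → (Fin r → Fin N) → Set₁
    Enumerates member = ∀ {P : Pred (Fin N) 0ℓ} (P? : Decidable P) → (∀ {x} → P x → x ∈ S) → count P? ≤ count (λ j → P? (member j))

    -- The expectation is bounded by a natural number `B`, so that the comparison with √r can be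
    -- made by squaring in ℕ; its nonnegativity is recorded because squaring the inequality uses it.
    solveBy-correct : ∀ r member → ∣ S ∣ ≡ r → Enumerates member →
      EveryOutput oracle CorrectOutput (solveBy S r member) ×
      ∃[ B ] B ^ 2 ≤ (72 * (1 + ⌊log₂ N ⌋) ^ 1 * N) ^ 2 * r ^ 1 ×
        0ℚ ℚ.≤ expectedQueries oracle (solveBy S r member) ×
        expectedQueries oracle (solveBy S r member) ℚ.≤ fromℕ B
    solveBy-correct zero member eq _ = empty-correct I eq , 0 , z≤n , ℚ.≤-refl , ℚ.≤-refl
    solveBy-correct (suc k) member eq enum =
        every-draw s {outer} (λ ws → every-draw s {inner ws} λ us → every-lift (program ws us) (proj₁ (holds (solved ws us)))) ,
        72 * (1 + ⌊log₂ N ⌋) * (s * N) , squared ,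
        scaled≤ (suc N ^ s * (suc k ^ s * 1)) ⦃ ℕ.m*n≢0 (suc N ^ s) (suc k ^ s * 1) ⦃ ℕ.m^n≢0 (suc N) s ⦄ ⦃ ℕ.m*n≢0 (suc k ^ s) 1 ⦃ ℕ.m^n≢0 (suc k) s ⦄ ⦄ ⦄
          (scaled-draw s (suc k ^ s * 1) {outer} {λ ws → sumSamples s (sampleCost ws)} λ ws → scaled-draw s 1 {inner ws} {sampleCost ws} λ us →
            trans (ℚ.*-identityˡ _) (expected-lift (program ws us)))
          (ℕ.≤-trans (expected≤ s (s≤s z≤n) (ℕ.≤-trans (ℕ.≤-reflexive eq) (ℕ.≤-trans (ℕ.<⇒≤ <[1+s]²) (ℕ.≤-reflexive (square (suc s))))))
            (ℕ.≤-reflexive (cong (λ u → suc N ^ s * u * (72 * (1 + ⌊log₂ N ⌋) * (s * N))) (sym (ℕ.*-identityʳ (suc k ^ s))))))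
      where
      open Randomised I member eq enum
      open ℕ.≤-Reasoning
      s : ℕ
      s = suc (rootPred 2 k)
      program : List (Fin (suc N)) → List (Fin (suc k)) → DProgram N (Maybe (Subset N))
      program ws us = Solver.solve S (Sampling.samplePolicy S member (Sampling.sample S member ws us))
      inner : List (Fin (suc N)) → List (Fin (suc k)) → Program N (Maybe (Subset N)) randomized
      inner ws us = lift (program ws us)
      outer : List (Fin (suc N)) → Program N (Maybe (Subset N)) randomized
      outer ws = draw s (inner ws)
      s²≤ : s ^ 2 ≤ suc k
      s²≤ = proj₁ (rootPred-correct 2 k)
      <[1+s]² : suc k < suc s ^ 2
      <[1+s]² = proj₂ (rootPred-correct 2 k)
      square : ∀ m → m * (m * 1) ≡ m * m
      square = solve-∀
      squared : (72 * (1 + ⌊log₂ N ⌋) * (s * N)) ^ 2 ≤ (72 * (1 + ⌊log₂ N ⌋) ^ 1 * N) ^ 2 * suc k ^ 1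
      squared = begin
        (72 * (1 + ⌊log₂ N ⌋) * (s * N)) ^ 2              ≡⟨ regroup ⌊log₂ N ⌋ s N ⟩
        (72 * (1 + ⌊log₂ N ⌋) ^ 1 * N) ^ 2 * s ^ 2        ≤⟨ ℕ.*-monoʳ-≤ ((72 * (1 + ⌊log₂ N ⌋) ^ 1 * N) ^ 2) s²≤ ⟩
        (72 * (1 + ⌊log₂ N ⌋) ^ 1 * N) ^ 2 * suc k        ≡⟨ cong ((72 * (1 + ⌊log₂ N ⌋) ^ 1 * N) ^ 2 *_) (ℕ.*-identityʳ (suc k)) ⟨
        (72 * (1 + ⌊log₂ N ⌋) ^ 1 * N) ^ 2 * suc k ^ 1    ∎
        where
        regroup : ∀ l s m → (72 * (1 + l) * (s * m)) ^ 2 ≡ (72 * (1 + l) ^ 1 * m) ^ 2 * s ^ 2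
        regroup l s m = trans (cong (_^ 2) (move l s m)) (product-square (72 * (1 + l) ^ 1 * m) s)
          where
          product-square : ∀ x y → x * y * (x * y * 1) ≡ x * (x * 1) * (y * (y * 1))
          product-square = solve-∀
          move : ∀ l s m → 72 * (1 + l) * (s * m) ≡ 72 * ((1 + l) * 1) * m * s
          move = solve-∀

    solved-instance = solveBy-correct ∣ S ∣ (elements S) refl (count-elements S)

theorem1p1 : (∃[ 𝒜 ] SolvesAnother {randomized} 𝒜 × expectedCost 𝒜 ∈Õ[n·r^ 1 / 2 ])
    × (∃[ 𝒜 ] SolvesAnother {deterministic} 𝒜 × cost 𝒜 ∈Õ[n·r^ 2 / 3 ])
theorem1p1 =
  (R.algorithm , (λ I → proj₁ (R.solved-instance I)) , 72 , 1 , λ I →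
    let B , B²≤ , 0≤ , ≤B = proj₂ (R.solved-instance I) in
    ℚ.≤-trans (power≤ {B = B} 2 0≤ ≤B) (fromℕ-mono B²≤)) ,
  (D.algorithm , D.correct , 448 , 1 , λ I →
    let q = queries (Instance.oracle I) (runOn D.algorithm I) in
    ℚ.≤-trans (power≤ {B = q} 3 (fromℕ-mono {0} {q} z≤n) ℚ.≤-refl) (fromℕ-mono (D.few-queries I)))
  where
  module R = RandomisedAlgorithm
  module D = DeterministicAlgorithm
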